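{- Let $n$ be a positive integer. With the notation of the context, the roots of the polynomials $K(x), L(x), M(x)$ and the eigenspaces of $A_{Q_n}, A_{\hat{Q}_n}, A_{\hat{\hat{Q}}_n}$ are related as follows. (i) All three polynomials $K(x), L(x), M(x)$ have only simple roots, which are real and symmetric about $0$ in $\mathbb{R}$. (ii) The roots of $K(x)$ are the same as the eigenvalues of $A_{Q_n}$, namely $\{ -n,-(n-2),\ldots,n-2,n\}$. (iii) The roots of $L(x)$ strictly interlace the roots of $K(x)$. (iv) The roots of $M(x)$ strictly interlace the roots of $L(x)$. (v) The positive (resp. negative) roots of $M(x)$ strictly interlace the positive (resp. negative) roots of $K(x)$. (vi) For each $1\le k\le n-1$, the matrices $A_{\hat{Q}_n}$ and $A_{\hat{\hat{Q}}_n}$ have the common $(n-2k)$-eigen-subspace $\hat{\hat{V}}_{n-2k}$ (that is, $\hat{\hat{V}}_{n-2k}\subseteq\hat{\hat{V}}\subseteq\hat V$ and both operators act on it as the scalar $n-2k$), and the $S_n$-action on $\hat{\hat{V}}_{n-2k}$ is the permutation action on the $k$-subsets of $\{1,2,\ldots,n\}$ with the trivial representation removed (that is, the direct sum of $\hat{\hat{V}}_{n-2k}$ with the one-dimensional trivial representation is isomorphic to the real permutation representation on $k$-subsets). (vii) The matrices $A_{\hat{Q}_n}$ and $A_{\hat{\hat{Q}}_n}$ have, in addition to the subspaces in (vi), one-dimensional eigen-subspaces with trivial $S_n$-action, one for each root of the characteristic polynomial $L(x)$, respectively $M(x)$ (with eigenvalue that root). When $n$ is even, the root $0$ of $M(x)$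 coincides with $n-2(n/2)$, so that the $0$-eigenspace of $A_{\hat{\hat{Q}}_n}$ is the direct sum of $\hat{\hat{V}}_0$ and the one-dimensional $0$-eigen-subspace arising from the root $0$ of $M(x)$.
   Context: Let $\mathbb{Z}_2=\{0,1\}$. The hypercube graph $Q_n$ has vertex set $\mathbb{Z}_2^n$, with $u,v$ adjacent iff the Hamming distance $d(u,v)=\#\{i:u_i\ne v_i\}$ equals $1$. Let $\mathbf{0}_n=(0,\dots,0)$, $\mathbf{1}_n=(1,\dots,1)$. The graph $\hat{Q}_n$ is obtained from $Q_n$ by deleting the vertex $\mathbf{0}_n$, and $\hat{\hat{Q}}_n$ by deleting both $\mathbf{0}_n$ and $\mathbf{1}_n$. The Hamming weight is $\omega(u)=\#\{i:u_i=1\}$. Let $V=\mathbb{R}^{\mathbb{Z}_2^n}$ with standard basis $\{\mathbf{e}_u\}_{u\in\mathbb{Z}_2^n}$; let $\hat V\subset V$ be the subspace of vectors whose $\mathbf{0}_n$-coordinate vanishes, and $\hat{\hat V}\subset\hat V$ the subspace of vectors whose $\mathbf{0}_n$- and $\mathbf{1}_n$-coordinates both vanish. The $\{0,1\}$-adjacency matrices $A_{Q_n}, A_{\hat Q_n}, A_{\hat{\hat Q}_n}$ are viewed as linear operators on $V,\hat V,\hat{\hat V}$ respectively, each sending $\mathbf{e}_u$ (for $u$ a vertex of the graph) to $\sum_w \mathbf{e}_w$ over the vertices $w$ of that graph with $d(u,w)=1$. The symmetric group $S_n$ acts on $\mathbb{Z}_2^n$ by $\sigma(u_1,\dots,u_n)=(u_{\sigma^{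 -1}(1)},\dots,u_{\sigma^{ -1}(n)})$, and correspondingly acts linearly on $V,\hat V,\hat{\hat V}$ by $\sigma(\mathbf{e}_u)=\mathbf{e}_{\sigma(u)}$. For $u\in\mathbb{Z}_2^n$ let $E_u\in V$ have coordinates $(E_u)_v=(-1)^{u\cdot v}$, where $u\cdot v=\sum_i u_iv_i\in\mathbb{Z}_2$. For $0\le k\le n$ define $\hat{\hat V}_{n-2k}=\operatorname{span}_{\mathbb{R}}\{E_u-E_v: u,v\in\mathbb{Z}_2^n,\ \omega(u)=\omega(v)=k\}$. Let $K$ be the $(n+1)\times(n+1)$ tridiagonal matrix, with rows and columns indexed by $0,1,\dots,n$, whose nonzero entries are exactly $K_{k,k+1}=n-k$ and $K_{k+1,k}=k+1$ for $0\le k\le n-1$. Let $L$ be the $n\times n$ principal submatrix of $K$ obtained by removing the first row and column, and $M$ the $(n-1)\times(n-1)$ principal submatrix obtained from $L$ by further removing the last row and column. Let $K(x)=\det(xI-K)$, $L(x)=\det(xI-L)$, $M(x)=\det(xI-M)$ be their characteristic polynomials (with the $0\times0$ determinant equal to $1$). With $e_k\in V$ defined by $(e_k)_v=1$ if $\omega(v)=k$ and $0$ otherwise, $K$ is the matrix of $A_{Q_n}$ acting on $U=\operatorname{span}_{\mathbb{R}}\{e_0,\dots,e_n\}$, $L$ is the matrix of $A_{\hat Q_n}$ acting on $\hat U=\operatorname{span}_{\mathbb{R}}\{e_1,\dots,e_n\}$, and $M$ is the matrix of $A_{\hat{\hat Q}_n}$ acting on $\hat{\hat U}=\operatorname{span}_{\mathbb{R}}\{e_1,\dots,e_{n-1}\}$,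 in these ordered bases. The eigen-subspace "arising from" a root of $L(x)$ (resp. $M(x)$) is the corresponding eigenspace of $A_{\hat Q_n}$ restricted to $\hat U$ (resp. $A_{\hat{\hat Q}_n}$ restricted to $\hat{\hat U}$). A finite set of reals $b_1<\dots<b_{r-1}$ strictly interlaces $a_1<\dots<a_r$ if $a_1<b_1<a_2<b_2<\cdots<b_{r-1}<a_r$. -}

module Defs where

open import Algebra.Bundles using (CommutativeRing; RawRing)
open import Algebra.Module.Bundles using (LeftModule)
import Algebra.Construct.Pointwise as Pointwise
import Algebra.Definitions.RawMonoid as RawMonoidDefinitions
import Algebra.Module.Construct.DirectProduct as DirectProduct
import Algebra.Module.Construct.TensorUnit as TensorUnit
import Algebra.Module.Morphism.Structures as ModuleMorphisms
import Algebra.Module.Properties.LeftModule as LeftModuleProperties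
import Algebra.Properties.CommutativeMonoid.Sum as Sum
open import Data.Bool.Base using (if_then_else_)
open import Data.Fin.Base as Fin using (Fin; zero; suc; toℕ; inject₁; punchIn)
import Data.Fin.Properties as Fin
open import Data.Fin.Permutation as Perm using (Permutation′; _⟨$⟩ˡ_; _⟨$⟩ʳ_; _∘ₚ_)
open import Data.Fin.Subset using (Subset; ∣_∣)
open import Data.List.Base using (List; []; _∷_; map)
open import Data.Nat.Base as ℕ using (ℕ; zero; suc; _∸_; pred)
import Data.Nat.Properties as ℕ
open import Data.Parity.Base as Parity using (Parity; 0ℙ; 1ℙ)
import Data.Parity.Properties as Parity
open import Data.Product.Base using (Σ; ∃; ∃₂; _×_; _,_; proj₁; proj₂; swap)
open import Data.Product.Properties using (Σ-≡,≡→≡)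
open import Data.Sum.Base using (_⊎_)
open import Data.Vec.Base as Vec using (Vec; []; _∷_; lookup; tabulate; zip; count; replicate)
import Data.Vec.Properties as Vec
open import Function.Base using (_∘_)
open import Level using (Level; _⊔_; 0ℓ) renaming (suc to lsuc)
open import Relation.Binary.Core using (Rel)
open import Relation.Binary.Definitions using (DecidableEquality)
open import Relation.Binary.Structures using (IsStrictTotalOrder)
open import Relation.Binary.PropositionalEquality as ≡ using (_≡_; _≢_)
open import Relation.Nullary using (¬_; does; yes; no)
open import Relation.Nullary.Decidable using (_×-dec_; ¬?)
open import Relation.Unary using (Pred; Decidable; _∈_; _∩_; _⊆_; U)
open import Relation.Unary.Properties using (U?; _∩?_)

------------------------------------------------------------------------
-- The real numbers

-- The real field is characterised, up to unique isomorphism, as the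
-- Dedekind-complete ordered field, and everything below is relative to an
-- arbitrary one.  The reading is the classical one: trichotomy of the order
-- is part of `IsStrictTotalOrder`, and every inhabited bounded set has a
-- least upper bound.

record RealNumbers ℓ : Set (lsuc ℓ) where
  infix 4 _<_ _≤_
  field
    commutativeRing : CommutativeRing ℓ ℓ

  open CommutativeRing commutativeRing public

  field
    _<_                : Rel Carrier ℓ
    isStrictTotalOrder : IsStrictTotalOrder _≈_ _<_
    0<1                : 0# < 1#
    +-monoˡ-<          : ∀ {x y} z → x < y → x + z < y + z
    *-pos              : ∀ {x y} → 0# < x → 0# < y → 0# < x * y
    inverse            : ∀ {x} → ¬ x ≈ 0# → ∃ λ y → x * y ≈ 1#

  _≤_ : Rel Carrier ℓ
  x ≤ y = x < y ⊎ x ≈ y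

  IsUpperBound : Pred Carrier ℓ → Pred Carrier ℓ
  IsUpperBound S b = ∀ x → x ∈ S → x ≤ b

  field
    supremum : (S : Pred Carrier ℓ) → ∃ S → ∃ (IsUpperBound S) →
               ∃ λ s → IsUpperBound S s × (∀ b → IsUpperBound S b → s ≤ b)

------------------------------------------------------------------------
-- Polynomials in one variable, as lists of coefficients in increasing degree

module Polynomials {c ℓ} (R : RawRing c ℓ) where
  open RawRing R

  infix  8 -ₚ_
  infixl 7 _*ₚ_
  infixl 6 _+ₚ_
  infix  4 _≈ₚ_

  Poly : Set c
  Poly = List Carrier

  coeff : Poly → ℕ → Carrier
  coeff []      _       = 0#
  coeff (a ∷ p) zero    = a
  coeff (a ∷ p) (suc i) = coeff p i

  -- Trailing zero coefficients are not significant.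
  _≈ₚ_ : Rel Poly ℓ
  p ≈ₚ q = ∀ i → coeff p i ≈ coeff q i

  constₚ : Carrier → Poly
  constₚ a = a ∷ []

  X : Poly
  X = 0# ∷ 1# ∷ []

  _+ₚ_ : Poly → Poly → Poly
  []      +ₚ q       = q
  (a ∷ p) +ₚ []      = a ∷ p
  (a ∷ p) +ₚ (b ∷ q) = (a + b) ∷ (p +ₚ q)

  -ₚ_ : Poly → Poly
  -ₚ_ = map -_

  _*ₚ_ : Poly → Poly → Poly
  []      *ₚ q = []
  (a ∷ p) *ₚ q = map (a *_) q +ₚ (0# ∷ p *ₚ q)

  eval : Poly → Carrier → Carrier
  eval []      x = 0#
  eval (a ∷ p) x = a + x * eval p x

  polyRawRing : RawRing c ℓ
  polyRawRing = record
    { Carrier = Poly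
    ; _≈_ = _≈ₚ_
    ; _+_ = _+ₚ_
    ; _*_ = _*ₚ_
    ; -_ = -ₚ_
    ; 0# = []
    ; 1# = constₚ 1#
    }

  IsRoot : Poly → Pred Carrier ℓ
  IsRoot p a = eval p a ≈ 0#

  -- Multiplicity exactly one: p = (X - a) q with q(a) ≠ 0.
  IsSimpleRoot : Poly → Pred Carrier (c ⊔ ℓ)
  IsSimpleRoot p a = ∃ λ q → p ≈ₚ (X +ₚ -ₚ constₚ a) *ₚ q × ¬ IsRoot q a

------------------------------------------------------------------------
-- Square matrices and determinants

Matrix : ∀ {c} → Set c → ℕ → Set c
Matrix A n = Fin n → Fin n → A

withoutFirst : ∀ {c} {A : Set c} {n} → Matrix A (suc n) → Matrix A n
withoutFirst A i j = A (suc i) (suc j)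

withoutLast : ∀ {c} {A : Set c} {n} → Matrix A (suc n) → Matrix A n
withoutLast A i j = A (inject₁ i) (inject₁ j)

module Determinants {c ℓ} (R : RawRing c ℓ) where
  open RawRing R

  -- f 0 - f 1 + f 2 - …
  alternatingSum : ∀ {n} → (Fin n → Carrier) → Carrier
  alternatingSum {zero}  f = 0#
  alternatingSum {suc n} f = f zero + - alternatingSum (f ∘ suc)

  -- Laplace expansion along the first row.
  det : ∀ {n} → Matrix Carrier n → Carrier
  det {zero}  A = 1#
  det {suc n} A = alternatingSum λ j →
    A zero j * det (λ i k → A (suc i) (punchIn j k))

module CharacteristicPolynomials {c ℓ} (R : RawRing c ℓ) where
  open Polynomials R
  open Determinants polyRawRing

  charPoly : ∀ {n} → Matrix (RawRing.Carrier R) n → Poly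
  charPoly A = det λ i j →
    (if does (i Fin.≟ j) then X else []) +ₚ -ₚ constₚ (A i j)

------------------------------------------------------------------------
-- The symmetric group acting on vectors

permute : ∀ {a} {A : Set a} {n} → Permutation′ n → Vec A n → Vec A n
permute σ u = tabulate λ i → lookup u (σ ⟨$⟩ˡ i)

lookup-permute : ∀ {a} {A : Set a} {n} (σ : Permutation′ n) (u : Vec A n) i →
                 lookup (permute σ u) i ≡ lookup u (σ ⟨$⟩ˡ i)
lookup-permute σ u = Vec.lookup∘tabulate λ i → lookup u (σ ⟨$⟩ˡ i)

-- `τ ∘ₚ σ` is the composite "first τ, then σ".
record Action (n : ℕ) (X : Set) : Set where
  field
    act      : Permutation′ n → X → X
    act-cong : ∀ {σ τ} → σ Perm.≈ τ → ∀ x → act σ x ≡ act τ x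
    act-id   : ∀ x → act Perm.id x ≡ x
    act-∘    : ∀ σ τ x → act (τ ∘ₚ σ) x ≡ act σ (act τ x)

≈⇒≗ˡ : ∀ {n} {σ τ : Permutation′ n} → σ Perm.≈ τ → ∀ i → σ ⟨$⟩ˡ i ≡ τ ⟨$⟩ˡ i
≈⇒≗ˡ {σ = σ} {τ} σ≈τ i = begin
  σ ⟨$⟩ˡ i                      ≡⟨ ≡.cong (σ ⟨$⟩ˡ_) (Perm.inverseʳ τ) ⟨
  σ ⟨$⟩ˡ (τ ⟨$⟩ʳ (τ ⟨$⟩ˡ i))    ≡⟨ ≡.cong (σ ⟨$⟩ˡ_) (σ≈τ (τ ⟨$⟩ˡ i)) ⟨
  σ ⟨$⟩ˡ (σ ⟨$⟩ʳ (τ ⟨$⟩ˡ i))    ≡⟨ Perm.inverseˡ σ ⟩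
  τ ⟨$⟩ˡ i                      ∎
  where open ≡.≡-Reasoning

vecAction : ∀ n (A : Set) → Action n (Vec A n)
vecAction n A = record
  { act      = permute
  ; act-cong = λ {σ} {τ} σ≈τ u →
      Vec.tabulate-cong λ i → ≡.cong (lookup u) (≈⇒≗ˡ {σ = σ} {τ} σ≈τ i)
  ; act-id   = Vec.tabulate∘lookup
  ; act-∘    = λ σ τ u → Vec.tabulate-cong λ i →
      ≡.sym (lookup-permute τ u (σ ⟨$⟩ˡ i))
  }

module _ {A : Set} {P : Pred A 0ℓ} (P? : Decidable P) where
  open Sum ℕ.+-0-commutativeMonoid using (sum; sum-permute; sum-cong-≗)

  private
    indicator : A → ℕ
    indicator a = if does (P? a) then 1 else 0

    count≡sum : ∀ {n} (u : Vec A n) → count P? u ≡ sum (indicator ∘ lookup u)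
    count≡sum []      = ≡.refl
    count≡sum (a ∷ u) with P? a
    ... | yes _ = ≡.cong suc (count≡sum u)
    ... | no  _ = count≡sum u

  count-permute : ∀ {n} (σ : Permutation′ n) u → count P? (permute σ u) ≡ count P? u
  count-permute {n} σ u = begin
    count P? (permute σ u)                      ≡⟨ count≡sum (permute σ u) ⟩
    sum (indicator ∘ lookup (permute σ u))      ≡⟨ sum-cong-≗ {n} (≡.cong indicator ∘ lookup-permute σ u) ⟩
    sum (λ i → indicator (lookup u (σ ⟨$⟩ˡ i))) ≡⟨ sum-permute (indicator ∘ lookup u) (Perm.flip σ) ⟨
    sum (indicator ∘ lookup u)                  ≡⟨ count≡sum u ⟨
    count P? u                                  ∎
    where open ≡.≡-Reasoning

KSubset : ℕ → ℕ → Set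
KSubset n k = Σ (Subset n) λ p → ∣ p ∣ ≡ k

-- σ sends p to its image { σ i ∣ i ∈ p }.
kSubsetAction : ∀ n k → Action n (KSubset n k)
kSubsetAction n k = record
  { act      = λ σ (p , ∣p∣≡k) → act σ p , ≡.trans (count-permute _ σ p) ∣p∣≡k
  ; act-cong = λ {σ} {τ} σ≈τ (p , _) → ext (act-cong {σ} {τ} σ≈τ p)
  ; act-id   = λ (p , _) → ext (act-id p)
  ; act-∘    = λ σ τ (p , _) → ext (act-∘ σ τ p)
  }
  where
  open Action (vecAction n _)
  ext : {P Q : KSubset n k} → proj₁ P ≡ proj₁ Q → P ≡ Q
  ext p≡q = Σ-≡,≡→≡ (p≡q , ℕ.≡-irrelevant _ _)

------------------------------------------------------------------------
-- The hypercube; ℤ₂ is `Parity`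

Vertex : ℕ → Set
Vertex = Vec Parity

_≟ᵥ_ : ∀ {n} → DecidableEquality (Vertex n)
_≟ᵥ_ = Vec.≡-dec Parity._≟_

𝟎 𝟏 : ∀ {n} → Vertex n
𝟎 = replicate _ 0ℙ
𝟏 = replicate _ 1ℙ

ω : ∀ {n} → Vertex n → ℕ
ω = count (Parity._≟ 1ℙ)

hamming : ∀ {n} → Vertex n → Vertex n → ℕ
hamming u v = count (λ (a , b) → ¬? (a Parity.≟ b)) (zip u v)

infix 7 _∙_
_∙_ : ∀ {n} → Vertex n → Vertex n → Parity
u ∙ v = sum λ i → lookup u i Parity.* lookup v i
  where open Sum Parity.+-0-commutativeMonoid using (sum)

-- (σu)·v = u·(σ⁻¹v)
∙-permute : ∀ {n} (σ : Permutation′ n) (u v : Vertex n) →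
            permute σ u ∙ v ≡ u ∙ permute (Perm.flip σ) v
∙-permute {n} σ u v = begin
  sum (λ i → lookup (permute σ u) i Parity.* lookup v i)
    ≡⟨ sum-cong-≗ {n} (λ i → ≡.cong (Parity._* lookup v i) (lookup-permute σ u i)) ⟩
  sum (λ i → lookup u (σ ⟨$⟩ˡ i) Parity.* lookup v i)
    ≡⟨ sum-permute _ σ ⟩
  sum (λ i → lookup u (σ ⟨$⟩ˡ (σ ⟨$⟩ʳ i)) Parity.* lookup v (σ ⟨$⟩ʳ i))
    ≡⟨ sum-cong-≗ {n} (λ i → ≡.cong₂ Parity._*_
         (≡.cong (lookup u) (Perm.inverseˡ σ))
         (≡.sym (lookup-permute (Perm.flip σ) v i))) ⟩
  sum (λ i → lookup u i Parity.* lookup (permute (Perm.flip σ) v) i) ∎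
  where
  open ≡.≡-Reasoning
  open Sum Parity.+-0-commutativeMonoid using (sum; sum-permute; sum-cong-≗)

-- The induced subgraphs Q, Q̂, Q̂̂ of the hypercube are given by deciding which
-- vertices they contain.

Q? : ∀ {n} → Decidable {A = Vertex n} U
Q? = U?

Q̂? : ∀ {n} → Decidable {A = Vertex n} (_≢ 𝟎)
Q̂? u = ¬? (u ≟ᵥ 𝟎)

Q̂̂? : ∀ {n} → Decidable {A = Vertex n} ((_≢ 𝟎) ∩ (_≢ 𝟏))
Q̂̂? u = ¬? (u ≟ᵥ 𝟎) ×-dec ¬? (u ≟ᵥ 𝟏)

------------------------------------------------------------------------

module Spectra {ℓ} (ℝ : RealNumbers ℓ) where

  open RealNumbers ℝ hiding (zero; 0#; _≈_)
  open RealNumbers ℝ public using (0#; _≈_)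
  open RawMonoidDefinitions +-rawMonoid using () renaming (_×_ to _·_)

  ⟦_⟧ : ℕ → Carrier
  ⟦ n ⟧ = n · 1#

  -- n - 2k
  κ : ℕ → ℕ → Carrier
  κ n k = ⟦ n ⟧ - ⟦ 2 ℕ.* k ⟧

  Positive Negative : Pred Carrier ℓ
  Positive x = 0# < x
  Negative x = x < 0#

  ----------------------------------------------------------------------
  -- Polynomials over ℝ and their complex roots

  open Polynomials rawRing public using (Poly; IsRoot)
  open CharacteristicPolynomials rawRing public using (charPoly)

  ℂ : RawRing ℓ ℓ
  ℂ = record
    { Carrier = Carrier × Carrier
    ; _≈_ = λ (a , b) (c , d) → a ≈ c × b ≈ d
    ; _+_ = λ (a , b) (c , d) → a + c , b + d
    ; _*_ = λ (a , b) (c , d) → a * c - b * d , a * d + b * c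
    ; -_ = λ (a , b) → - a , - b
    ; 0# = 0# , 0#
    ; 1# = 1# , 0#
    }

  module ℂ[X] = Polynomials ℂ

  fromℝ[X] : Poly → ℂ[X].Poly
  fromℝ[X] = map λ a → a , 0#

  AllRootsSimple : Pred Poly ℓ
  AllRootsSimple p = ∀ z → ℂ[X].IsRoot (fromℝ[X] p) z → ℂ[X].IsSimpleRoot (fromℝ[X] p) z

  AllRootsReal : Pred Poly ℓ
  AllRootsReal p = ∀ ((a , b) : RawRing.Carrier ℂ) → ℂ[X].IsRoot (fromℝ[X] p) (a , b) → b ≈ 0#

  RootsSymmetric : Pred Poly ℓ
  RootsSymmetric p = ∀ x → IsRoot p x → IsRoot p (- x)

  ----------------------------------------------------------------------
  -- Interlacing

  record Enumerates {r} (S : Pred Carrier ℓ) (a : Fin r → Carrier) : Set ℓ where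
    field
      increasing : ∀ {i j} → i Fin.< j → a i < a j
      sound      : ∀ i → a i ∈ S
      complete   : ∀ x → x ∈ S → ∃ λ i → x ≈ a i

  infix 4 _StrictlyInterlaces_
  _StrictlyInterlaces_ : Rel (Pred Carrier ℓ) ℓ
  B StrictlyInterlaces A =
    ∃ λ r → ∃₂ λ (a : Fin (suc r) → Carrier) (b : Fin r → Carrier) →
      Enumerates A a × Enumerates B b × (∀ i → a (inject₁ i) < b i × b i < a (suc i))

  ----------------------------------------------------------------------
  -- The tridiagonal matrices

  K : ∀ n → Matrix Carrier (suc n)
  K n i j =
    if does (toℕ j ℕ.≟ suc (toℕ i)) then ⟦ n ∸ toℕ i ⟧ else
    if does (toℕ i ℕ.≟ suc (toℕ j)) then ⟦ suc (toℕ j) ⟧ else 0#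

  L : ∀ n → Matrix Carrier n
  L n = withoutFirst (K n)

  -- Only meaningful for n ≥ 1.
  M : ∀ n → Matrix Carrier (pred n)
  M zero    ()
  M (suc n) = withoutLast (L (suc n))

  ----------------------------------------------------------------------
  -- Representations of the symmetric group over ℝ

  record Representation (n : ℕ) : Set (lsuc ℓ) where
    field
      space : LeftModule ring ℓ ℓ
    open LeftModule space public
    field
      act      : Permutation′ n → Carrierᴹ → Carrierᴹ
      act-cong : ∀ {σ τ x y} → σ Perm.≈ τ → x ≈ᴹ y → act σ x ≈ᴹ act τ y
      act-+    : ∀ σ x y → act σ (x +ᴹ y) ≈ᴹ act σ x +ᴹ act σ y
      act-*ₗ   : ∀ σ c x → act σ (c *ₗ x) ≈ᴹ c *ₗ act σ x
      act-id   : ∀ x → act Perm.id x ≈ᴹ x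
      act-∘    : ∀ σ τ x → act (τ ∘ₚ σ) x ≈ᴹ act σ (act τ x)

  infix 4 _≅_
  record _≅_ {n} (ρ₁ ρ₂ : Representation n) : Set ℓ where
    private
      module ρ₁ = Representation ρ₁
      module ρ₂ = Representation ρ₂
    open ModuleMorphisms.LeftModuleMorphisms ρ₁.rawLeftModule ρ₂.rawLeftModule
    field
      to            : ρ₁.Carrierᴹ → ρ₂.Carrierᴹ
      isIsomorphism : IsLeftModuleIsomorphism to
      equivariant   : ∀ σ x → to (ρ₁.act σ x) ρ₂.≈ᴹ ρ₂.act σ (to x)

  infixr 5 _⊕_
  _⊕_ : ∀ {n} → Representation n → Representation n → Representation n
  ρ₁ ⊕ ρ₂ = record
    { space    = DirectProduct.leftModule ρ₁.space ρ₂.space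
    ; act      = λ σ (x , y) → ρ₁.act σ x , ρ₂.act σ y
    ; act-cong = λ {σ} {τ} σ≈τ (x , y) → ρ₁.act-cong {σ} {τ} σ≈τ x , ρ₂.act-cong {σ} {τ} σ≈τ y
    ; act-+    = λ σ (x₁ , y₁) (x₂ , y₂) → ρ₁.act-+ σ x₁ x₂ , ρ₂.act-+ σ y₁ y₂
    ; act-*ₗ   = λ σ c (x , y) → ρ₁.act-*ₗ σ c x , ρ₂.act-*ₗ σ c y
    ; act-id   = λ (x , y) → ρ₁.act-id x , ρ₂.act-id y
    ; act-∘    = λ σ τ (x , y) → ρ₁.act-∘ σ τ x , ρ₂.act-∘ σ τ y
    }
    where
    module ρ₁ = Representation ρ₁
    module ρ₂ = Representation ρ₂

  trivial : ∀ n → Representation n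
  trivial n = record
    { space    = TensorUnit.leftModule
    ; act      = λ _ x → x
    ; act-cong = λ _ x≈y → x≈y
    ; act-+    = λ _ _ _ → refl
    ; act-*ₗ   = λ _ _ _ → refl
    ; act-id   = λ _ → refl
    ; act-∘    = λ _ _ _ → refl
    }

  functions : Set → LeftModule ring ℓ ℓ
  functions X = record
    { Carrierᴹ = X → Carrier
    ; _≈ᴹ_ = λ f g → ∀ x → f x ≈ g x
    ; _+ᴹ_ = λ f g x → f x + g x
    ; _*ₗ_ = λ c f x → c * f x
    ; 0ᴹ = λ _ → 0#
    ; -ᴹ_ = λ f x → - f x
    ; isLeftModule = record
      { isLeftSemimodule = record
        { +ᴹ-isCommutativeMonoid = Pointwise.isCommutativeMonoid X +-isCommutativeMonoid
        ; isPreleftSemimodule = record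
          { *ₗ-cong      = λ c≈d f≈g x → *-cong c≈d (f≈g x)
          ; *ₗ-zeroˡ     = λ f x → zeroˡ (f x)
          ; *ₗ-distribʳ  = λ f c d x → distribʳ (f x) c d
          ; *ₗ-identityˡ = λ f x → *-identityˡ (f x)
          ; *ₗ-assoc     = λ c d f x → *-assoc c d (f x)
          ; *ₗ-zeroʳ     = λ c x → zeroʳ c
          ; *ₗ-distribˡ  = λ c f g x → distribˡ c (f x) (g x)
          }
        }
      ; -ᴹ‿cong    = λ f≈g x → -‿cong (f≈g x)
      ; -ᴹ‿inverse = (λ f x → -‿inverseˡ (f x)) , (λ f x → -‿inverseʳ (f x))
      }
    }

  -- The linear extension of σ e_x = e_{σ x} to functions: (σ f)(x) = f (σ⁻¹ x).
  permutationRep : ∀ {n X} → Action n X → Representation n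
  permutationRep {n} {X} A = record
    { space    = functions X
    ; act      = λ σ f x → f (act (Perm.flip σ) x)
    ; act-cong = λ {σ} {τ} {f} {g} σ≈τ f≈g x → trans (f≈g _)
        (reflexive (≡.cong g (act-cong {Perm.flip σ} {Perm.flip τ} (≈⇒≗ˡ {σ = σ} {τ} σ≈τ) x)))
    ; act-+    = λ _ _ _ _ → refl
    ; act-*ₗ   = λ _ _ _ _ → refl
    ; act-id   = λ f x → reflexive (≡.cong f
        (≡.trans (act-cong {Perm.flip Perm.id} {Perm.id} (λ _ → ≡.refl) x) (act-id x)))
    ; act-∘    = λ σ τ f x → reflexive (≡.cong f (≡.trans
        (act-cong {Perm.flip (τ ∘ₚ σ)} {Perm.flip σ ∘ₚ Perm.flip τ} (λ _ → ≡.refl) x)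
        (act-∘ (Perm.flip τ) (Perm.flip σ) x)))
    }
    where open Action A

  kSubsetRep : ∀ n k → Representation n
  kSubsetRep n k = permutationRep (kSubsetAction n k)

  ----------------------------------------------------------------------
  -- Subspaces spanned by a set of vectors

  module _ (E : LeftModule ring ℓ ℓ) where
    open LeftModule E

    data Span (G : Pred Carrierᴹ ℓ) : Pred Carrierᴹ ℓ where
      generator : ∀ {x} → x ∈ G → Span G x
      0∈        : Span G 0ᴹ
      +∈        : ∀ {x y} → Span G x → Span G y → Span G (x +ᴹ y)
      *∈        : ∀ c {x} → Span G x → Span G (c *ₗ x)
      resp      : ∀ {x y} → x ≈ᴹ y → Span G x → Span G y

    -∈ : ∀ {G x} → Span G x → Span G (-ᴹ x)
    -∈ {x = x} x∈ = resp (inverseʳ-uniqueᴹ x (- 1# *ₗ x) eq) (*∈ (- 1#) x∈)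
      where
      open LeftModuleProperties E using (inverseʳ-uniqueᴹ)
      open import Relation.Binary.Reasoning.Setoid ≈ᴹ-setoid
      eq : x +ᴹ - 1# *ₗ x ≈ᴹ 0ᴹ
      eq = begin
        x +ᴹ - 1# *ₗ x        ≈⟨ +ᴹ-congʳ (*ₗ-identityˡ x) ⟨
        1# *ₗ x +ᴹ - 1# *ₗ x  ≈⟨ *ₗ-distribʳ x 1# (- 1#) ⟨
        (1# + - 1#) *ₗ x      ≈⟨ *ₗ-congʳ (-‿inverseʳ 1#) ⟩
        0# *ₗ x               ≈⟨ *ₗ-zeroˡ x ⟩
        0ᴹ                    ∎

    spanModule : Pred Carrierᴹ ℓ → LeftModule ring ℓ ℓ
    spanModule G = record
      { Carrierᴹ = Σ Carrierᴹ (Span G)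
      ; _≈ᴹ_ = λ (x , _) (y , _) → x ≈ᴹ y
      ; _+ᴹ_ = λ (x , x∈) (y , y∈) → x +ᴹ y , +∈ x∈ y∈
      ; _*ₗ_ = λ c (x , x∈) → c *ₗ x , *∈ c x∈
      ; 0ᴹ = 0ᴹ , 0∈
      ; -ᴹ_ = λ (x , x∈) → -ᴹ x , -∈ x∈
      ; isLeftModule = record
        { isLeftSemimodule = record
          { +ᴹ-isCommutativeMonoid = record
            { isMonoid = record
              { isSemigroup = record
                { isMagma = record
                  { isEquivalence = record { refl = ≈ᴹ-refl ; sym = ≈ᴹ-sym ; trans = ≈ᴹ-trans }
                  ; ∙-cong = +ᴹ-cong
                  }
                ; assoc = λ _ _ _ → +ᴹ-assoc _ _ _
                }
              ; identity = (λ _ → +ᴹ-identityˡ _) , (λ _ → +ᴹ-identityʳ _)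
              }
            ; comm = λ _ _ → +ᴹ-comm _ _
            }
          ; isPreleftSemimodule = record
            { *ₗ-cong      = *ₗ-cong
            ; *ₗ-zeroˡ     = λ _ → *ₗ-zeroˡ _
            ; *ₗ-distribʳ  = λ _ _ _ → *ₗ-distribʳ _ _ _
            ; *ₗ-identityˡ = λ _ → *ₗ-identityˡ _
            ; *ₗ-assoc     = λ _ _ _ → *ₗ-assoc _ _ _
            ; *ₗ-zeroʳ     = λ _ → *ₗ-zeroʳ _
            ; *ₗ-distribˡ  = λ _ _ _ → *ₗ-distribˡ _ _ _
            }
          }
        ; -ᴹ‿cong    = -ᴹ‿cong
        ; -ᴹ‿inverse = (λ _ → -ᴹ‿inverseˡ _) , (λ _ → -ᴹ‿inverseʳ _)
        }
      }

  spanRep : ∀ {n} (ρ : Representation n) (G : Pred (Representation.Carrierᴹ ρ) ℓ) →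
            (∀ σ {x} → x ∈ G → Representation.act ρ σ x ∈ G) → Representation n
  spanRep ρ G closed = record
    { space    = spanModule space G
    ; act      = λ σ (x , x∈) → act σ x , act∈ σ x∈
    ; act-cong = λ {σ} {τ} → act-cong {σ} {τ}
    ; act-+    = λ σ _ _ → act-+ σ _ _
    ; act-*ₗ   = λ σ c _ → act-*ₗ σ c _
    ; act-id   = λ _ → act-id _
    ; act-∘    = λ σ τ _ → act-∘ σ τ _
    }
    where
    open Representation ρ
    act∈ : ∀ σ {x} → Span space G x → Span space G (act σ x)
    act∈ σ (generator x∈G) = generator (closed σ x∈G)
    act∈ σ 0∈ = resp
      (≈ᴹ-trans (≈ᴹ-sym (*ₗ-zeroˡ _))
      (≈ᴹ-trans (≈ᴹ-sym (act-*ₗ σ 0# 0ᴹ))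
                (act-cong {σ} {σ} (λ _ → ≡.refl) (*ₗ-zeroˡ 0ᴹ)))) 0∈
    act∈ σ (+∈ x∈ y∈)      = resp (≈ᴹ-sym (act-+ σ _ _)) (+∈ (act∈ σ x∈) (act∈ σ y∈))
    act∈ σ (*∈ c x∈)       = resp (≈ᴹ-sym (act-*ₗ σ c _)) (*∈ c (act∈ σ x∈))
    act∈ σ (resp x≈y x∈)   = resp (act-cong {σ} {σ} (λ _ → ≡.refl) x≈y) (act∈ σ x∈)

  ----------------------------------------------------------------------
  -- The vector space of the hypercube and its subspaces

  vertexRep : ∀ n → Representation n
  vertexRep n = permutationRep (vecAction n Parity)

  module _ {n : ℕ} where
    open Representation (vertexRep n) public
      using (_≈ᴹ_; _+ᴹ_; _*ₗ_; 0ᴹ; -ᴹ_; act)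

  V : ℕ → Set ℓ
  V n = Representation.Carrierᴹ (vertexRep n)

  Subspace : ℕ → Set (lsuc ℓ)
  Subspace n = Pred (V n) ℓ

  span : ∀ {n} → Pred (V n) ℓ → Subspace n
  span {n} = Span (functions (Vertex n))

  V̂ V̂̂ : ∀ {n} → Subspace n
  V̂ f = f 𝟎 ≈ 0#
  V̂̂ f = f 𝟎 ≈ 0# × f 𝟏 ≈ 0#

  sign : Parity → Carrier
  sign 0ℙ = 1#
  sign 1ℙ = - 1#

  E : ∀ {n} → Vertex n → V n
  E u v = sign (u ∙ v)

  EDifference : ∀ n → ℕ → Pred (V n) ℓ
  EDifference n k f = ∃₂ λ u v → ω u ≡ k × ω v ≡ k × f ≈ᴹ E u +ᴹ -ᴹ E v

  -- V̂̂ₙ₋₂ₖ, indexed by k rather than by n - 2k.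
  V̂̂[_-2*_] : ∀ n → ℕ → Subspace n
  V̂̂[ n -2* k ] = span (EDifference n k)

  EDifference-closed : ∀ n k σ {f} → f ∈ EDifference n k → act σ f ∈ EDifference n k
  EDifference-closed n k σ {f} (u , v , ωu≡k , ωv≡k , f≈) =
    permute σ u , permute σ v ,
    ≡.trans (count-permute _ σ u) ωu≡k , ≡.trans (count-permute _ σ v) ωv≡k ,
    λ w → trans (f≈ (permute (Perm.flip σ) w))
                (+-cong (E-permute u w) (-‿cong (E-permute v w)))
    where
    E-permute : ∀ u w → E u (permute (Perm.flip σ) w) ≈ E (permute σ u) w
    E-permute u w = reflexive (≡.cong sign (≡.sym (∙-permute σ u w)))

  V̂̂Rep : ∀ n k → Representation n
  V̂̂Rep n k = spanRep (vertexRep n) (EDifference n k) (EDifference-closed n k)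

  e : ∀ {n} → ℕ → V n
  e k v = if does (ω v ℕ.≟ k) then 1# else 0#

  Û Û̂ : ∀ n → Subspace n
  Û n = span λ f → ∃ λ k → 1 ℕ.≤ k × k ℕ.≤ n × f ≈ᴹ e k
  Û̂ n = span λ f → ∃ λ k → 1 ℕ.≤ k × k ℕ.< n × f ≈ᴹ e k

  ----------------------------------------------------------------------
  -- Adjacency operators and eigenspaces

  ∑ᵥ : ∀ {n} → (Vertex n → Carrier) → Carrier
  ∑ᵥ {zero}  f = f []
  ∑ᵥ {suc n} f = ∑ᵥ (λ u → f (0ℙ ∷ u)) + ∑ᵥ (λ u → f (1ℙ ∷ u))

  module _ {n} {G : Pred (Vertex n) 0ℓ} (G? : Decidable G) where

    adjacency : Vertex n → Vertex n → Carrier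
    adjacency u w = if does (G? u ×-dec G? w ×-dec hamming u w ℕ.≟ 1) then 1# else 0#

    -- The subspace of V spanned by the e_u with u a vertex of the graph is
    -- mapped into itself; the other e_u are mapped to 0.
    A : V n → V n
    A f w = ∑ᵥ λ u → f u * adjacency u w

    IsEigenvalue : Pred Carrier ℓ
    IsEigenvalue μ = ∃ λ f → ¬ f ≈ᴹ 0ᴹ × A f ≈ᴹ μ *ₗ f

    Eigenspace : Carrier → Subspace n
    Eigenspace μ f = A f ≈ᴹ μ *ₗ f

  OneDimensional : ∀ {n} → Subspace n → Set ℓ
  OneDimensional W = ∃ λ f → f ∈ W × ¬ f ≈ᴹ 0ᴹ × (∀ g → g ∈ W → ∃ λ c → g ≈ᴹ c *ₗ f)

  TrivialAction : ∀ {n} → Subspace n → Set ℓ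
  TrivialAction W = ∀ σ f → f ∈ W → act σ f ≈ᴹ f

  TrivialIntersection : ∀ {n} → Subspace n → Subspace n → Set ℓ
  TrivialIntersection W₁ W₂ = ∀ f → f ∈ W₁ → f ∈ W₂ → f ≈ᴹ 0ᴹ

  IsDirectSum : ∀ {n} → Subspace n → Subspace n → Subspace n → Set ℓ
  IsDirectSum W W₁ W₂ =
    W₁ ⊆ W × W₂ ⊆ W × TrivialIntersection W₁ W₂ ×
    (∀ f → f ∈ W → ∃₂ λ f₁ f₂ → f₁ ∈ W₁ × f₂ ∈ W₂ × f ≈ᴹ f₁ +ᴹ f₂)

  -- The sum of the subspaces V̂̂ₙ₋₂ₖ over 1 ≤ k ≤ n - 1.
  ∑V̂̂ : ∀ n → Subspace n
  ∑V̂̂ n = span λ f → ∃ λ k → 1 ℕ.≤ k × k ℕ.< n × f ∈ V̂̂[ n -2* k ]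

{-# OPTIONS --safe #-}
-- The characters E_u diagonalise the adjacency operator N of the hypercube,
-- N E_u = (n - 2ω(u)) E_u, and the Fourier transform f^ turns questions about
-- N into questions about single coordinates.  On functions of the weight alone
-- N is tridiagonal, and the solutions of its rows are continuants D, with
-- K(x) = D x (n + 1) 0, L(x) = D x n 1 and M(x) = D x (n - 1) 1.
--
-- The sum of the E_u with ω(u) = k takes the values C(n,k) at 𝟎 and
-- (-1)ᵏ C(n,k) at 𝟏, whence K(n - 2k) = 0 and L(n - 2k) = (-1)ᵏ n!.  By the
-- intermediate value theorem, L has a root in each gap between roots of K.  At
-- a root of L the determinant identity for continuants makes K M a negative
-- constant, so M has the sign opposite to that of K there.  Finally
--
--   2ⁿ (-1)ʲ M(n - 2j) = 2 n! ∑ 1 / (ω(u) - j)  over the u with ω(u) ≢ j mod 2,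
--
-- which is positive for 2j < n because there are at least as many vertices of
-- weight j + d as of weight j - d.  Hence each gap between a nonzero root of K
-- and the next root of L away from 0 contains a root of M.  These roots and, for
-- even n, the root 0 are n - 1 in number, so they are all of them.
--
-- The transform of an element of V̂̂ₙ₋₂ₖ is an arbitrary function on the vertices
-- of weight k with sum 0, which gives the isomorphism in (vi).  The transform of
-- a radial function is radial, so it vanishes if its sums over all weights do.

module Submission where

open import Defs
open import Algebra.Bundles using (CommutativeRing; RawRing)
import Algebra.Properties.Ring as RingProperties
import Algebra.Properties.AbelianGroup as AbelianGroupProperties
import Algebra.Properties.Semiring.Mult as Mult
import Algebra.Properties.Semiring.Mult.TCOptimised as MultTC
import Algebra.Solver.Ring as RingSolver
open import Algebra.Solver.Ring.AlmostCommutativeRing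
  using (fromCommutativeRing; _-Raw-AlmostCommutative⟶_)
open import Data.Bool.Base using (Bool; true; false; if_then_else_)
open import Data.Empty using (⊥-elim)
open import Data.Fin.Base as Fin using (Fin; zero; suc; toℕ; inject₁; punchIn; fromℕ<)
import Data.Fin.Properties as Fin
open import Data.Fin.Permutation as Perm using (_⟨$⟩ˡ_)
open import Data.Fin.Subset using (Subset; ∣_∣)
open import Data.Integer.Base as ℤ using (ℤ; -[1+_]; _⊖_; _◃_) renaming (+_ to pos)
import Data.Integer.Properties as ℤ
open import Data.List.Base using ([]; _∷_; map)
open import Data.Maybe.Base using (Maybe; just; nothing)
open import Data.Nat.Base as ℕ using (ℕ; zero; suc; NonZero; _∸_; z≤n; s≤s)
import Data.Nat.Properties as ℕ
open import Data.Parity.Base as Parity using (Parity; 0ℙ; 1ℙ)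
import Data.Parity.Properties as Parity
open import Data.Product.Properties using (Σ-≡,≡→≡)
open import Data.Product.Base using (Σ; ∃; _×_; _,_; proj₁; proj₂)
import Data.Sign.Base as Sign
open import Data.Sum.Base using (_⊎_; inj₁; inj₂)
open import Data.Vec.Base as Vec using ([]; _∷_; lookup)
import Data.Vec.Properties as Vec
open import Function.Base using (_∘_)
open import Function.Bundles using (_⇔_; mk⇔)
open import Level using (0ℓ)
open import Relation.Binary.Definitions using (Decidable; tri<; tri≈; tri>)
open import Relation.Binary.PropositionalEquality as ≡ using (_≡_; _≢_)
open import Relation.Binary.Structures using (IsStrictTotalOrder)
import Relation.Binary.Reasoning.Setoid as SetoidReasoning
open import Relation.Nullary using (¬_; Dec; does; yes; no)
open import Relation.Nullary.Decidable using (dec-true; dec-false; _×-dec_)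
open import Relation.Unary using (Pred; _∈_; _∩_; _⊆_)

-- The sign of M at n - 2j is the hard point, for no product formula like the one for L is at hand
-- there. The vector solving the rows 1, ..., n - 1 has the value M(n - 2j) at 𝟎 and vanishes at 𝟏,
-- and N - (n - 2j) maps it to multiples of e_𝟎 and e_𝟏. Its transform is therefore found by
-- dividing by -2(ω(u) - j), which fails at weight j, where the transform stays unknown. But since
-- the vector vanishes at 𝟏, the inversion formula at 𝟏 can be added to that at 𝟎 for free, with the
-- coefficient that cancels all weights of the parity of j, and j among them. This is why only ω(u)
-- ≢ j mod 2 occurs and where the factor 2 comes from. The terms 1 / (ω(u) - j) are odd about j, so
-- only the numbers of vertices of weight j + d and j - d matter.
--
-- Simplicity and reality of the roots need no separate argument: over an integral domain a monic
-- polynomial of degree d with d distinct roots has neither further nor multiple roots, and this is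
-- applied over ℂ to the real roots that were found.

-- Ring identities with integer coefficients in a commutative ring

module IntegerSolver {c ℓ} (R : CommutativeRing c ℓ) where
  open CommutativeRing R hiding (zero)
  open RingProperties ring
  open AbelianGroupProperties +-abelianGroup using (⁻¹-∙-comm)
  open MultTC semiring using (1+×; ×-homo-+; ×1-homo-*) renaming (_×_ to _·_)
  open SetoidReasoning setoid

  private
    -- With this form of the multiple, the integers 0 and 1 become `0#` and `1#` by definition, so
    -- the constants of the solver match those of the ring.
    ⟦_⟧ℤ : ℤ → Carrier
    ⟦ pos n ⟧ℤ    = n · 1#
    ⟦ -[1+ n ] ⟧ℤ = - (suc n · 1#)

    negation : ∀ i → ⟦ ℤ.- i ⟧ℤ ≈ - ⟦ i ⟧ℤ
    negation (pos zero)    = sym -0#≈0#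
    negation (pos (suc n)) = refl
    negation -[1+ n ]      = sym (-‿involutive _)

    -- Done by hand, because it is an ingredient of the solver itself.
    cancel-suc : ∀ x y → x + - y ≈ (1# + x) + - (1# + y)
    cancel-suc x y = begin
      x + - y                    ≈⟨ +-identityˡ _ ⟨
      0# + (x + - y)             ≈⟨ +-congʳ (-‿inverseʳ 1#) ⟨
      (1# + - 1#) + (x + - y)    ≈⟨ +-assoc _ _ _ ⟩
      1# + (- 1# + (x + - y))    ≈⟨ +-congˡ (+-assoc _ _ _) ⟨
      1# + ((- 1# + x) + - y)    ≈⟨ +-congˡ (+-congʳ (+-comm _ _)) ⟩
      1# + ((x + - 1#) + - y)    ≈⟨ +-congˡ (+-assoc _ _ _) ⟩
      1# + (x + (- 1# + - y))    ≈⟨ +-assoc _ _ _ ⟨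
      (1# + x) + (- 1# + - y)    ≈⟨ +-congˡ (⁻¹-∙-comm 1# y) ⟩
      (1# + x) + - (1# + y)      ∎

    difference : ∀ m n → ⟦ m ⊖ n ⟧ℤ ≈ m · 1# + - (n · 1#)
    difference m       zero    = sym (trans (+-congˡ -0#≈0#) (+-identityʳ _))
    difference zero    (suc n) = sym (+-identityˡ _)
    difference (suc m) (suc n) = begin
      ⟦ suc m ⊖ suc n ⟧ℤ                  ≡⟨ ≡.cong ⟦_⟧ℤ (ℤ.[1+m]⊖[1+n]≡m⊖n m n) ⟩
      ⟦ m ⊖ n ⟧ℤ                          ≈⟨ difference m n ⟩
      m · 1# + - (n · 1#)                 ≈⟨ cancel-suc _ _ ⟩
      (1# + m · 1#) + - (1# + n · 1#)     ≈⟨ +-cong (1+× m 1#) (-‿cong (1+× n 1#)) ⟨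
      suc m · 1# + - (suc n · 1#)         ∎

    addition : ∀ i j → ⟦ i ℤ.+ j ⟧ℤ ≈ ⟦ i ⟧ℤ + ⟦ j ⟧ℤ
    addition (pos m)  (pos n)  = ×-homo-+ 1# m n
    addition (pos m)  -[1+ n ] = difference m (suc n)
    addition -[1+ m ] (pos n)  = trans (difference n (suc m)) (+-comm _ _)
    addition -[1+ m ] -[1+ n ] = begin
      - (suc (suc (m ℕ.+ n)) · 1#)           ≡⟨ ≡.cong (λ k → - (k · 1#)) (ℕ.+-suc (suc m) n) ⟨
      - ((suc m ℕ.+ suc n) · 1#)             ≈⟨ -‿cong (×-homo-+ 1# (suc m) (suc n)) ⟩
      - (suc m · 1# + suc n · 1#)            ≈⟨ ⁻¹-∙-comm _ _ ⟨
      - (suc m · 1#) + - (suc n · 1#)        ∎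

    multiplication : ∀ i j → ⟦ i ℤ.* j ⟧ℤ ≈ ⟦ i ⟧ℤ * ⟦ j ⟧ℤ
    multiplication (pos m) (pos n) = begin
      ⟦ Sign.+ ◃ (m ℕ.* n) ⟧ℤ       ≡⟨ ≡.cong ⟦_⟧ℤ (ℤ.+◃n≡+n (m ℕ.* n)) ⟩
      (m ℕ.* n) · 1#                ≈⟨ ×1-homo-* m n ⟩
      (m · 1#) * (n · 1#)           ∎
    multiplication (pos m) -[1+ n ] = begin
      ⟦ Sign.- ◃ (m ℕ.* suc n) ⟧ℤ        ≡⟨ ≡.cong ⟦_⟧ℤ (ℤ.-◃n≡-n (m ℕ.* suc n)) ⟩
      ⟦ ℤ.- pos (m ℕ.* suc n) ⟧ℤ         ≈⟨ negation (pos (m ℕ.* suc n)) ⟩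
      - ((m ℕ.* suc n) · 1#)             ≈⟨ -‿cong (×1-homo-* m (suc n)) ⟩
      - ((m · 1#) * (suc n · 1#))        ≈⟨ -‿distribʳ-* _ _ ⟩
      (m · 1#) * - (suc n · 1#)          ∎
    multiplication -[1+ m ] (pos n) = begin
      ⟦ Sign.- ◃ (suc m ℕ.* n) ⟧ℤ        ≡⟨ ≡.cong ⟦_⟧ℤ (ℤ.-◃n≡-n (suc m ℕ.* n)) ⟩
      ⟦ ℤ.- pos (suc m ℕ.* n) ⟧ℤ         ≈⟨ negation (pos (suc m ℕ.* n)) ⟩
      - ((suc m ℕ.* n) · 1#)             ≈⟨ -‿cong (×1-homo-* (suc m) n) ⟩
      - ((suc m · 1#) * (n · 1#))        ≈⟨ -‿distribˡ-* _ _ ⟩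
      - (suc m · 1#) * (n · 1#)          ∎
    multiplication -[1+ m ] -[1+ n ] = begin
      (suc m ℕ.* suc n) · 1#             ≈⟨ ×1-homo-* (suc m) (suc n) ⟩
      (suc m · 1#) * (suc n · 1#)        ≈⟨ -‿involutive _ ⟨
      - - ((suc m · 1#) * (suc n · 1#))  ≈⟨ -‿cong (-‿distribˡ-* _ _) ⟩
      - (- (suc m · 1#) * (suc n · 1#))  ≈⟨ -‿distribʳ-* _ _ ⟩
      - (suc m · 1#) * - (suc n · 1#)    ∎

    morphism : ℤ.+-*-rawRing -Raw-AlmostCommutative⟶ fromCommutativeRing R
    morphism = record
      { ⟦_⟧    = ⟦_⟧ℤ
      ; +-homo = addition
      ; *-homo = multiplication
      ; -‿homo = negation
      ; 0-homo = refl
      ; 1-homo = refl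
      }

    equal? : ∀ i j → Maybe (⟦ i ⟧ℤ ≈ ⟦ j ⟧ℤ)
    equal? i j with i ℤ.≟ j
    ... | yes i≡j = just (reflexive (≡.cong ⟦_⟧ℤ i≡j))
    ... | no _    = nothing

  open RingSolver ℤ.+-*-rawRing (fromCommutativeRing R) morphism equal? public
    using (solve; _:=_; _:+_; _:*_; _:-_; :-_)
  open RingSolver ℤ.+-*-rawRing (fromCommutativeRing R) morphism equal? using (Polynomial; con)

  :0 :1 : ∀ {n} → Polynomial n
  :0 = con (pos 0)
  :1 = con (pos 1)

-- Polynomials, tridiagonal characteristic polynomials, and counting of roots

module PolynomialProperties {c ℓ} (R : CommutativeRing c ℓ) where
  open CommutativeRing R hiding (zero)
  open RingProperties ring
  open IntegerSolver R
  open Polynomials rawRing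
  open Determinants polyRawRing
  open CharacteristicPolynomials rawRing
  open SetoidReasoning setoid

  coeff-+ : ∀ p q i → coeff (p +ₚ q) i ≈ coeff p i + coeff q i
  coeff-+ []      q       i       = sym (+-identityˡ _)
  coeff-+ (a ∷ p) []      i       = sym (+-identityʳ _)
  coeff-+ (a ∷ p) (b ∷ q) zero    = refl
  coeff-+ (a ∷ p) (b ∷ q) (suc i) = coeff-+ p q i

  coeff-neg : ∀ p i → coeff (-ₚ p) i ≈ - coeff p i
  coeff-neg []      i       = sym -0#≈0#
  coeff-neg (a ∷ p) zero    = refl
  coeff-neg (a ∷ p) (suc i) = coeff-neg p i

  coeff-scale : ∀ a p i → coeff (map (a *_) p) i ≈ a * coeff p i
  coeff-scale a []      i       = sym (zeroʳ a)
  coeff-scale a (b ∷ p) zero    = refl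
  coeff-scale a (b ∷ p) (suc i) = coeff-scale a p i

  coeff-0∷[] : ∀ i → coeff (0# ∷ []) i ≈ 0#
  coeff-0∷[] zero    = refl
  coeff-0∷[] (suc i) = refl

  coeff-constₚ-* : ∀ a p i → coeff (constₚ a *ₚ p) i ≈ a * coeff p i
  coeff-constₚ-* a p i = begin
    coeff (map (a *_) p +ₚ (0# ∷ [])) i             ≈⟨ coeff-+ (map (a *_) p) (0# ∷ []) i ⟩
    coeff (map (a *_) p) i + coeff (0# ∷ []) i      ≈⟨ +-cong (coeff-scale a p i) (coeff-0∷[] i) ⟩
    a * coeff p i + 0#                              ≈⟨ +-identityʳ _ ⟩
    a * coeff p i                                   ∎

  coeff-linear-*-zero : ∀ a p → coeff ((X +ₚ -ₚ constₚ a) *ₚ p) 0 ≈ - (a * coeff p 0)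
  coeff-linear-*-zero a p = begin
    coeff ((X +ₚ -ₚ constₚ a) *ₚ p) 0               ≈⟨ coeff-+ (map ((0# + - a) *_) p) (0# ∷ _) 0 ⟩
    coeff (map ((0# + - a) *_) p) 0 + 0#            ≈⟨ +-congʳ (coeff-scale (0# + - a) p 0) ⟩
    (0# + - a) * coeff p 0 + 0#
      ≈⟨ solve 2 (λ a x → (:0 :- a) :* x :+ :0 := :- (a :* x)) refl a (coeff p 0) ⟩
    - (a * coeff p 0)                               ∎

  coeff-linear-*-suc : ∀ a p i →
    coeff ((X +ₚ -ₚ constₚ a) *ₚ p) (suc i) ≈ coeff p i - a * coeff p (suc i)
  coeff-linear-*-suc a p i = begin
    coeff ((X +ₚ -ₚ constₚ a) *ₚ p) (suc i)
      ≈⟨ coeff-+ (map ((0# + - a) *_) p) (0# ∷ constₚ 1# *ₚ p) (suc i) ⟩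
    coeff (map ((0# + - a) *_) p) (suc i) + coeff (constₚ 1# *ₚ p) i
      ≈⟨ +-cong (coeff-scale (0# + - a) p (suc i)) (coeff-constₚ-* 1# p i) ⟩
    (0# + - a) * coeff p (suc i) + 1# * coeff p i
      ≈⟨ solve 3 (λ a x y → (:0 :- a) :* x :+ :1 :* y := y :- a :* x) refl
           a (coeff p (suc i)) (coeff p i) ⟩
    coeff p i - a * coeff p (suc i)                 ∎

  eval-+ : ∀ p q x → eval (p +ₚ q) x ≈ eval p x + eval q x
  eval-+ []      q       x = sym (+-identityˡ _)
  eval-+ (a ∷ p) []      x = sym (+-identityʳ _)
  eval-+ (a ∷ p) (b ∷ q) x = begin
    (a + b) + x * eval (p +ₚ q) x                   ≈⟨ +-congˡ (*-congˡ (eval-+ p q x)) ⟩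
    (a + b) + x * (eval p x + eval q x)
      ≈⟨ solve 5 (λ a b x s t → (a :+ b) :+ x :* (s :+ t) := (a :+ x :* s) :+ (b :+ x :* t)) refl
           a b x (eval p x) (eval q x) ⟩
    (a + x * eval p x) + (b + x * eval q x)         ∎

  eval-neg : ∀ p x → eval (-ₚ p) x ≈ - eval p x
  eval-neg []      x = sym -0#≈0#
  eval-neg (a ∷ p) x = begin
    - a + x * eval (-ₚ p) x    ≈⟨ +-congˡ (*-congˡ (eval-neg p x)) ⟩
    - a + x * - eval p x       ≈⟨ solve 3 (λ a x s → :- a :+ x :* (:- s) := :- (a :+ x :* s)) refl a x (eval p x) ⟩
    - (a + x * eval p x)       ∎

  eval-scale : ∀ a p x → eval (map (a *_) p) x ≈ a * eval p x
  eval-scale a []      x = sym (zeroʳ a)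
  eval-scale a (b ∷ p) x = begin
    a * b + x * eval (map (a *_) p) x   ≈⟨ +-congˡ (*-congˡ (eval-scale a p x)) ⟩
    a * b + x * (a * eval p x)
      ≈⟨ solve 4 (λ a b x s → a :* b :+ x :* (a :* s) := a :* (b :+ x :* s)) refl a b x (eval p x) ⟩
    a * (b + x * eval p x)              ∎

  eval-* : ∀ p q x → eval (p *ₚ q) x ≈ eval p x * eval q x
  eval-* []      q x = sym (zeroˡ _)
  eval-* (a ∷ p) q x = begin
    eval (map (a *_) q +ₚ (0# ∷ p *ₚ q)) x                  ≈⟨ eval-+ (map (a *_) q) _ x ⟩
    eval (map (a *_) q) x + (0# + x * eval (p *ₚ q) x)      ≈⟨ +-cong (eval-scale a q x) (+-congˡ (*-congˡ (eval-* p q x))) ⟩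
    a * eval q x + (0# + x * (eval p x * eval q x))
      ≈⟨ solve 4 (λ a x s t → a :* t :+ (:0 :+ x :* (s :* t)) := (a :+ x :* s) :* t) refl
           a x (eval p x) (eval q x) ⟩
    (a + x * eval p x) * eval q x                           ∎

  eval-≈0 : ∀ p → p ≈ₚ [] → ∀ x → eval p x ≈ 0#
  eval-≈0 []      p≈0 x = refl
  eval-≈0 (a ∷ p) p≈0 x = begin
    a + x * eval p x   ≈⟨ +-cong (p≈0 0) (*-congˡ (eval-≈0 p (λ i → p≈0 (suc i)) x)) ⟩
    0# + x * 0#        ≈⟨ trans (+-identityˡ _) (zeroʳ x) ⟩
    0#                 ∎

  eval-cong : ∀ p q → p ≈ₚ q → ∀ x → eval p x ≈ eval q x
  eval-cong []      q       p≈q x = sym (eval-≈0 q (λ i → sym (p≈q i)) x)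
  eval-cong (a ∷ p) []      p≈q x = eval-≈0 (a ∷ p) p≈q x
  eval-cong (a ∷ p) (b ∷ q) p≈q x =
    +-cong (p≈q 0) (*-congˡ (eval-cong p q (λ i → p≈q (suc i)) x))

  eval-congˡ : ∀ p {x y} → x ≈ y → eval p x ≈ eval p y
  eval-congˡ []      x≈y = refl
  eval-congˡ (a ∷ p) x≈y = +-congˡ (*-cong x≈y (eval-congˡ p x≈y))

  -- Characteristic polynomials of tridiagonal matrices

  *ₚ-≈0ˡ : ∀ p q → p ≈ₚ [] → p *ₚ q ≈ₚ []
  *ₚ-≈0ˡ []      q p≈0 i = refl
  *ₚ-≈0ˡ (a ∷ p) q p≈0 i = begin
    coeff (map (a *_) q +ₚ (0# ∷ p *ₚ q)) i            ≈⟨ coeff-+ (map (a *_) q) _ i ⟩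
    coeff (map (a *_) q) i + coeff (0# ∷ p *ₚ q) i     ≈⟨ +-cong (coeff-scale a q i) (shifted i) ⟩
    a * coeff q i + 0#                                 ≈⟨ +-identityʳ _ ⟩
    a * coeff q i                                      ≈⟨ *-congʳ (p≈0 0) ⟩
    0# * coeff q i                                     ≈⟨ zeroˡ _ ⟩
    0#                                                 ∎
    where
    shifted : (0# ∷ p *ₚ q) ≈ₚ []
    shifted zero    = refl
    shifted (suc i) = *ₚ-≈0ˡ p q (λ j → p≈0 (suc j)) i

  *ₚ-congˡ : ∀ p {q r} → q ≈ₚ r → p *ₚ q ≈ₚ p *ₚ r
  *ₚ-congˡ []      q≈r i = refl
  *ₚ-congˡ (a ∷ p) {q} {r} q≈r i = begin
    coeff (map (a *_) q +ₚ (0# ∷ p *ₚ q)) i            ≈⟨ coeff-+ (map (a *_) q) _ i ⟩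
    coeff (map (a *_) q) i + coeff (0# ∷ p *ₚ q) i     ≈⟨ +-cong scaled (shifted i) ⟩
    coeff (map (a *_) r) i + coeff (0# ∷ p *ₚ r) i     ≈⟨ coeff-+ (map (a *_) r) _ i ⟨
    coeff (map (a *_) r +ₚ (0# ∷ p *ₚ r)) i            ∎
    where
    scaled : coeff (map (a *_) q) i ≈ coeff (map (a *_) r) i
    scaled = trans (coeff-scale a q i) (trans (*-congˡ (q≈r i)) (sym (coeff-scale a r i)))
    shifted : (0# ∷ p *ₚ q) ≈ₚ (0# ∷ p *ₚ r)
    shifted zero    = refl
    shifted (suc i) = *ₚ-congˡ p {q} {r} q≈r i

  +ₚ-neg-cong : ∀ p {q r} → q ≈ₚ r → p +ₚ -ₚ q ≈ₚ p +ₚ -ₚ r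
  +ₚ-neg-cong p {q} {r} q≈r i = begin
    coeff (p +ₚ -ₚ q) i               ≈⟨ coeff-+ p (-ₚ q) i ⟩
    coeff p i + coeff (-ₚ q) i        ≈⟨ +-congˡ (trans (coeff-neg q i) (trans (-‿cong (q≈r i)) (sym (coeff-neg r i)))) ⟩
    coeff p i + coeff (-ₚ r) i        ≈⟨ coeff-+ p (-ₚ r) i ⟨
    coeff (p +ₚ -ₚ r) i               ∎

  +ₚ-neg-identityʳ : ∀ p {q} → q ≈ₚ [] → p +ₚ -ₚ q ≈ₚ p
  +ₚ-neg-identityʳ p {q} q≈0 i = begin
    coeff (p +ₚ -ₚ q) i     ≈⟨ +ₚ-neg-cong p {q} {[]} q≈0 i ⟩
    coeff (p +ₚ []) i       ≈⟨ coeff-+ p [] i ⟩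
    coeff p i + 0#          ≈⟨ +-identityʳ _ ⟩
    coeff p i               ∎

  alternatingSum-≈0 : ∀ {n} (f : Fin n → Poly) → (∀ j → f j ≈ₚ []) → alternatingSum f ≈ₚ []
  alternatingSum-≈0 {zero}  f f≈0 i = refl
  alternatingSum-≈0 {suc n} f f≈0 i =
    trans (+ₚ-neg-identityʳ (f zero) {alternatingSum (f ∘ suc)}
            (alternatingSum-≈0 (f ∘ suc) (f≈0 ∘ suc)) i)
          (f≈0 zero i)

  *ₚ-≈0ʳ : ∀ p {q} → q ≈ₚ [] → p *ₚ q ≈ₚ []
  *ₚ-≈0ʳ p {q} q≈0 i = trans (*ₚ-congˡ p {q} {[]} q≈0 i) (annihilates p i)
    where
    annihilates : ∀ p → p *ₚ [] ≈ₚ []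
    annihilates []      i       = refl
    annihilates (a ∷ p) zero    = refl
    annihilates (a ∷ p) (suc i) = annihilates p i

  -- In the expansion along the first row, the entry in the zero column vanishes, and the minor of
  -- every other entry still contains that column.
  det-zeroColumn : ∀ {n} (B : Matrix Poly (suc n)) → (∀ i → B i zero ≈ₚ []) → det B ≈ₚ []
  det-zeroColumn {n} B B≈0 = alternatingSum-≈0 (λ j → B zero j *ₚ det (λ i k → B (suc i) (punchIn j k))) λ
    { zero    → *ₚ-≈0ˡ (B zero zero) (det (withoutFirst B)) (B≈0 zero)
    ; (suc j) → *ₚ-≈0ʳ (B zero (suc j)) {det (λ i k → B (suc i) (punchIn (suc j) k))} (minor B B≈0 j)
    }
    where
    minor : ∀ {n} (B : Matrix Poly (suc n)) → (∀ i → B i zero ≈ₚ []) → ∀ j →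
            det (λ i k → B (suc i) (punchIn (suc j) k)) ≈ₚ []
    minor {suc n} B B≈0 j = det-zeroColumn (λ i k → B (suc i) (punchIn (suc j) k)) (B≈0 ∘ suc)

  -- Two terms of the first row survive. The minor of the second one has first row `B 1 0`, `B 1 2`,
  -- ...; all its terms but the first have a minor whose first column is zero.
  det-tridiagonal : ∀ {n} (B : Matrix Poly (suc (suc n))) →
    (∀ j → B zero (suc (suc j)) ≈ₚ []) → (∀ i → B (suc (suc i)) zero ≈ₚ []) →
    det B ≈ₚ B zero zero *ₚ det (withoutFirst B) +ₚ
             -ₚ (B zero (suc zero) *ₚ (B (suc zero) zero *ₚ det (withoutFirst (withoutFirst B))))
  det-tridiagonal {n} B row≈0 column≈0 =
    +ₚ-neg-cong (B zero zero *ₚ det (withoutFirst B)) {alternatingSum (λ j → cofactor (suc j))} λ i →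
      trans (+ₚ-neg-identityʳ (cofactor (suc zero)) {alternatingSum (λ j → cofactor (suc (suc j)))}
               (alternatingSum-≈0 _ λ j → *ₚ-≈0ˡ (B zero (suc (suc j))) _ (row≈0 j)) i)
            (*ₚ-congˡ (B zero (suc zero))
               (+ₚ-neg-identityʳ (B (suc zero) zero *ₚ det (withoutFirst (withoutFirst B)))
                  (alternatingSum-≈0 _ λ j → *ₚ-≈0ʳ (B (suc zero) (suc (suc j)))
                     (minor B column≈0 j))) i)
    where
    cofactor : Fin (suc (suc n)) → Poly
    cofactor j = B zero j *ₚ det (λ i k → B (suc i) (punchIn j k))
    minor : ∀ {n} (B : Matrix Poly (suc (suc n))) → (∀ i → B (suc (suc i)) zero ≈ₚ []) → ∀ j →
      det (λ i k → B (suc (suc i)) (punchIn (suc zero) (punchIn (suc j) k))) ≈ₚ []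
    minor {suc n} B column≈0 j =
      det-zeroColumn (λ i k → B (suc (suc i)) (punchIn (suc zero) (punchIn (suc j) k))) column≈0

  -- The degree is bounded through the coefficients and not through the length of the list, which
  -- may end in zeros.
  LeadingTerm : Poly → ℕ → Carrier → Set ℓ
  LeadingTerm p d a = coeff p d ≈ a × (∀ i → d ℕ.< i → coeff p i ≈ 0#)

  -- The determinant of the m × m tridiagonal matrix with diagonal entries x
  -- whose products of opposite off-diagonal entries are p o, p (o + 1), ….
  continuant : (ℕ → Carrier) → Carrier → ℕ → ℕ → Carrier
  continuant p x 0             o = 1#
  continuant p x 1             o = x
  continuant p x (suc (suc m)) o =
    x * continuant p x (suc m) (suc o) - p o * continuant p x m (suc (suc o))

  module TridiagonalMatrix
    (t : ℕ → ℕ → Carrier)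
    (diagonal : ∀ i → t i i ≈ 0#)
    (above : ∀ i k → t i (2 ℕ.+ (i ℕ.+ k)) ≈ 0#)
    (below : ∀ i k → t (2 ℕ.+ (i ℕ.+ k)) i ≈ 0#)
    where

    -- All matrices are seen as diagonal blocks of one infinite matrix, beginning at the index o, so
    -- that removing the first row and column just increases o.
    Entries : ℕ → ∀ {m} → Matrix Carrier m → Set c
    Entries o A = ∀ i j → A i j ≡ t (o ℕ.+ toℕ i) (o ℕ.+ toℕ j)

    p : ℕ → Carrier
    p o = t o (suc o) * t (suc o) o

    private
      entries-withoutFirst : ∀ o {m} {A : Matrix Carrier (suc m)} → Entries o A → Entries (suc o) (withoutFirst A)
      entries-withoutFirst o entries i j =
        ≡.trans (entries (suc i) (suc j)) (≡.cong₂ t (ℕ.+-suc o (toℕ i)) (ℕ.+-suc o (toℕ j)))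

      corner : ∀ o {m} (A : Matrix Carrier (suc m)) → Entries o A → A zero zero ≈ 0#
      corner o A entries = trans (reflexive (≡.trans (entries zero zero)
        (≡.cong₂ t (ℕ.+-identityʳ o) (ℕ.+-identityʳ o)))) (diagonal o)

      offDiagonal : ∀ o {m} (A : Matrix Carrier (suc (suc m))) → Entries o A →
        A zero (suc zero) ≡ t o (suc o) × A (suc zero) zero ≡ t (suc o) o
      offDiagonal o A entries =
        ≡.trans (entries zero (suc zero)) (≡.cong₂ t (ℕ.+-identityʳ o) (ℕ.+-comm o 1)) ,
        ≡.trans (entries (suc zero) zero) (≡.cong₂ t (ℕ.+-comm o 1) (ℕ.+-identityʳ o))

      shift : ∀ o k → o ℕ.+ suc (suc k) ≡ 2 ℕ.+ (o ℕ.+ k)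
      shift o k = ≡.trans (ℕ.+-suc o (suc k)) (≡.cong suc (ℕ.+-suc o k))

      constₚ-neg-≈0 : ∀ a → a ≈ 0# → constₚ (- a) ≈ₚ []
      constₚ-neg-≈0 a a≈0 zero    = trans (-‿cong a≈0) -0#≈0#
      constₚ-neg-≈0 a a≈0 (suc i) = refl

    expansion : ∀ o {m} (A : Matrix Carrier (suc (suc m))) → Entries o A →
      charPoly A ≈ₚ (X +ₚ -ₚ constₚ (A zero zero)) *ₚ charPoly (withoutFirst A) +ₚ
        -ₚ (constₚ (- A zero (suc zero)) *ₚ
             (constₚ (- A (suc zero) zero) *ₚ charPoly (withoutFirst (withoutFirst A))))
    expansion o A entries = det-tridiagonal
      (λ i j → (if does (i Fin.≟ j) then X else []) +ₚ -ₚ constₚ (A i j))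
      (λ j → constₚ-neg-≈0 _ (trans (reflexive (≡.trans (entries zero (suc (suc j)))
        (≡.cong₂ t (ℕ.+-identityʳ o) (shift o (toℕ j))))) (above o (toℕ j))))
      (λ j → constₚ-neg-≈0 _ (trans (reflexive (≡.trans (entries (suc (suc j)) zero)
        (≡.cong₂ t (shift o (toℕ j)) (ℕ.+-identityʳ o)))) (below o (toℕ j))))

    eval-charPoly : ∀ m o (A : Matrix Carrier m) → Entries o A →
                    ∀ x → eval (charPoly A) x ≈ continuant p x m o
    eval-charPoly 0 o A entries x = trans (+-congˡ (zeroʳ x)) (+-identityʳ 1#)
    eval-charPoly 1 o A entries x = begin
      eval (charPoly A) x          ≡⟨⟩
      eval ((X +ₚ -ₚ constₚ (A zero zero)) *ₚ constₚ 1# +ₚ []) x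
        ≈⟨ eval-+ ((X +ₚ -ₚ constₚ (A zero zero)) *ₚ constₚ 1#) [] x ⟩
      eval ((X +ₚ -ₚ constₚ (A zero zero)) *ₚ constₚ 1#) x + 0#
        ≈⟨ +-congʳ (eval-* (X +ₚ -ₚ constₚ (A zero zero)) (constₚ 1#) x) ⟩
      ((0# + - A zero zero) + x * (1# + x * 0#)) * (1# + x * 0#) + 0#
        ≈⟨ +-congʳ (*-congʳ (+-congʳ (+-congˡ (-‿cong (corner o A entries))))) ⟩
      ((0# + - 0#) + x * (1# + x * 0#)) * (1# + x * 0#) + 0#
        ≈⟨ solve 1 (λ x → ((:0 :- :0) :+ x :* (:1 :+ x :* :0))
             :* (:1 :+ x :* :0) :+ :0 := x) refl x ⟩
      x                            ∎
    eval-charPoly (suc (suc m)) o A entries x = begin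
      eval (charPoly A) x
        ≈⟨ eval-cong (charPoly A) (q₀ *ₚ D₁ +ₚ -ₚ (constₚ (- b) *ₚ (constₚ (- c′) *ₚ D₂)))
             (expansion o A entries) x ⟩
      eval (q₀ *ₚ D₁ +ₚ -ₚ (constₚ (- b) *ₚ (constₚ (- c′) *ₚ D₂))) x
        ≈⟨ eval-+ (q₀ *ₚ D₁) _ x ⟩
      eval (q₀ *ₚ D₁) x + eval (-ₚ (constₚ (- b) *ₚ (constₚ (- c′) *ₚ D₂))) x
        ≈⟨ +-cong (eval-* q₀ D₁ x) (trans (eval-neg (constₚ (- b) *ₚ (constₚ (- c′) *ₚ D₂)) x)
             (-‿cong (trans (eval-* (constₚ (- b)) (constₚ (- c′) *ₚ D₂) x)
               (*-congˡ (eval-* (constₚ (- c′)) D₂ x))))) ⟩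
      ((0# + - a) + x * (1# + x * 0#)) * eval D₁ x +
        - ((- b + x * 0#) * ((- c′ + x * 0#) * eval D₂ x))
        ≈⟨ +-cong (*-cong (+-congʳ (+-congˡ (-‿cong (corner o A entries))))
                          (eval-charPoly (suc m) (suc o) _ entries₁ x))
                  (-‿cong (*-congˡ (*-congˡ (eval-charPoly m (suc (suc o)) _
                    (entries-withoutFirst (suc o) {A = withoutFirst A} entries₁) x)))) ⟩
      ((0# + - 0#) + x * (1# + x * 0#)) * d₁ + - ((- b + x * 0#) * ((- c′ + x * 0#) * d₂))
        ≈⟨ solve 5 (λ x d₁ b c d₂ →
             ((:0 :- :0) :+ x :* (:1 :+ x :* :0)) :* d₁ :+
             :- ((:- b :+ x :* :0) :* ((:- c :+ x :* :0) :* d₂))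
             := x :* d₁ :- (b :* c) :* d₂) refl x d₁ b c′ d₂ ⟩
      x * d₁ - (b * c′) * d₂
        ≡⟨ ≡.cong₂ (λ b c → x * d₁ - (b * c) * d₂)
             (proj₁ (offDiagonal o A entries)) (proj₂ (offDiagonal o A entries)) ⟩
      x * d₁ - p o * d₂   ∎
      where
      a = A zero zero
      b = A zero (suc zero)
      c′ = A (suc zero) zero
      q₀ = X +ₚ -ₚ constₚ a
      D₁ = charPoly (withoutFirst A)
      D₂ = charPoly (withoutFirst (withoutFirst A))
      d₁ = continuant p x (suc m) (suc o)
      d₂ = continuant p x m (suc (suc o))
      entries₁ : Entries (suc o) (withoutFirst A)
      entries₁ = entries-withoutFirst o {A = A} entries

    -- From index m + 2 on, the coefficients are those of X times the polynomial of the smaller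
    -- block: the diagonal term has degree at most m + 1 and the off-diagonal term degree at most m.
    charPoly-monic : ∀ m o (A : Matrix Carrier m) → Entries o A → LeadingTerm (charPoly A) m 1#
    charPoly-monic 0 o A entries = refl , λ { (suc i) _ → refl }
    charPoly-monic 1 o A entries =
      trans (+-identityʳ _) (*-identityʳ 1#) ,
      λ { (suc zero) (s≤s ()) ; (suc (suc i)) _ → refl }
    charPoly-monic (suc (suc m)) o A entries = step
      (charPoly-monic (suc m) (suc o) (withoutFirst A) entries₁)
      (charPoly-monic m (suc (suc o)) (withoutFirst (withoutFirst A))
        (entries-withoutFirst (suc o) {A = withoutFirst A} entries₁))
      where
      a = A zero zero
      b = A zero (suc zero)
      c′ = A (suc zero) zero
      D₁ = charPoly (withoutFirst A)
      D₂ = charPoly (withoutFirst (withoutFirst A))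
      entries₁ : Entries (suc o) (withoutFirst A)
      entries₁ = entries-withoutFirst o {A = A} entries
      coefficient : ∀ i → coeff (charPoly A) (suc i) ≈
        (coeff D₁ i - a * coeff D₁ (suc i)) + - (- b * (- c′ * coeff D₂ (suc i)))
      coefficient i = begin
        coeff (charPoly A) (suc i)
          ≈⟨ expansion o A entries (suc i) ⟩
        coeff ((X +ₚ -ₚ constₚ a) *ₚ D₁ +ₚ -ₚ (constₚ (- b) *ₚ (constₚ (- c′) *ₚ D₂))) (suc i)
          ≈⟨ coeff-+ ((X +ₚ -ₚ constₚ a) *ₚ D₁) _ (suc i) ⟩
        coeff ((X +ₚ -ₚ constₚ a) *ₚ D₁) (suc i) + coeff (-ₚ (constₚ (- b) *ₚ (constₚ (- c′) *ₚ D₂))) (suc i)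
          ≈⟨ +-cong (coeff-linear-*-suc a D₁ i)
               (trans (coeff-neg (constₚ (- b) *ₚ (constₚ (- c′) *ₚ D₂)) (suc i))
                 (-‿cong (trans (coeff-constₚ-* (- b) (constₚ (- c′) *ₚ D₂) (suc i))
                   (*-congˡ (coeff-constₚ-* (- c′) D₂ (suc i)))))) ⟩
        (coeff D₁ i - a * coeff D₁ (suc i)) + - (- b * (- c′ * coeff D₂ (suc i)))  ∎
      vanishing : ∀ x → (x - a * 0#) + - (- b * (- c′ * 0#)) ≈ x
      vanishing x = solve 4 (λ x a b c →
        (x :- a :* :0) :+ :- (:- b :* (:- c :* :0)) := x) refl x a b c′
      step : LeadingTerm D₁ (suc m) 1# → LeadingTerm D₂ m 1# → LeadingTerm (charPoly A) (suc (suc m)) 1#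
      step (leading₁ , higher₁) (_ , higher₂) =
        trans (reduce (suc m) ℕ.≤-refl) leading₁ ,
        λ { (suc i) (s≤s m<i) → trans (reduce i (ℕ.<⇒≤ m<i)) (higher₁ i m<i) }
        where
        reduce : ∀ i → suc m ℕ.≤ i → coeff (charPoly A) (suc i) ≈ coeff D₁ i
        reduce i m<i = trans (coefficient i) (trans
          (+-cong (+-congˡ (-‿cong (*-congˡ (higher₁ (suc i) (s≤s m<i)))))
                  (-‿cong (*-congˡ (*-congˡ (higher₂ (suc i) (ℕ.m≤n⇒m≤1+n m<i))))))
          (vanishing _))

  -- Synthetic division

  -- As in Horner's scheme, the entries are the values at a of the tails of p. The last tail is
  -- empty, so the list ends in a 0 and keeps the length of p.
  quotient : Carrier → Poly → Poly
  quotient a []      = []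
  quotient a (_ ∷ p) = eval p a ∷ quotient a p

  eval-quotient : ∀ a p x → eval p x ≈ eval p a + (x - a) * eval (quotient a p) x
  eval-quotient a []      x = sym (trans (+-identityˡ _) (zeroʳ _))
  eval-quotient a (b ∷ p) x = begin
    b + x * eval p x
      ≈⟨ +-congˡ (*-congˡ (eval-quotient a p x)) ⟩
    b + x * (eval p a + (x - a) * eval (quotient a p) x)
      ≈⟨ solve 5 (λ a b x s t → b :+ x :* (s :+ (x :- a) :* t)
           := (b :+ a :* s) :+ (x :- a) :* (s :+ x :* t)) refl a b x (eval p a) (eval (quotient a p) x) ⟩
    (b + a * eval p a) + (x - a) * (eval p a + x * eval (quotient a p) x) ∎

  eval-head : ∀ a p → eval p a ≈ coeff p 0 + a * coeff (quotient a p) 0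
  eval-head a []      = sym (trans (+-identityˡ _) (zeroʳ a))
  eval-head a (b ∷ p) = refl

  coeff-quotient : ∀ a p i → coeff p (suc i) ≈ coeff (quotient a p) i - a * coeff (quotient a p) (suc i)
  coeff-quotient a []      i       = solve 1 (λ a → :0 := :0 :- a :* :0) refl a
  coeff-quotient a (b ∷ p) zero    = begin
    coeff p 0
      ≈⟨ solve 2 (λ x y → x := (x :+ y) :- y) refl (coeff p 0) (a * coeff (quotient a p) 0) ⟩
    (coeff p 0 + a * coeff (quotient a p) 0) - a * coeff (quotient a p) 0
      ≈⟨ +-congʳ (eval-head a p) ⟨
    eval p a - a * coeff (quotient a p) 0    ∎
  coeff-quotient a (b ∷ p) (suc i) = coeff-quotient a p i

  root-factor : ∀ a p → IsRoot p a → p ≈ₚ (X +ₚ -ₚ constₚ a) *ₚ quotient a p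
  root-factor a p root zero = begin
    coeff p 0
      ≈⟨ solve 2 (λ x y → x := (x :+ y) :- y) refl (coeff p 0) (a * coeff (quotient a p) 0) ⟩
    (coeff p 0 + a * coeff (quotient a p) 0) - a * coeff (quotient a p) 0
      ≈⟨ +-congʳ (trans (sym (eval-head a p)) root) ⟩
    0# - a * coeff (quotient a p) 0
      ≈⟨ +-identityˡ _ ⟩
    - (a * coeff (quotient a p) 0)
      ≈⟨ coeff-linear-*-zero a (quotient a p) ⟨
    coeff ((X +ₚ -ₚ constₚ a) *ₚ quotient a p) 0  ∎
  root-factor a p root (suc i) =
    trans (coeff-quotient a p i) (sym (coeff-linear-*-suc a (quotient a p) i))

  quotient-≈0 : ∀ a p → p ≈ₚ [] → quotient a p ≈ₚ []
  quotient-≈0 a []      p≈0 i       = refl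
  quotient-≈0 a (b ∷ p) p≈0 zero    = eval-≈0 p (λ i → p≈0 (suc i)) a
  quotient-≈0 a (b ∷ p) p≈0 (suc i) = quotient-≈0 a p (λ i → p≈0 (suc i)) i

  constant-eval : ∀ p {b} → LeadingTerm p 0 b → ∀ x → eval p x ≈ b
  constant-eval []      (p₀ , _)      x = p₀
  constant-eval (a ∷ p) (p₀ , higher) x = begin
    a + x * eval p x   ≈⟨ +-cong p₀ (*-congˡ (eval-≈0 p (λ i → higher (suc i) (s≤s z≤n)) x)) ⟩
    _ + x * 0#         ≈⟨ trans (+-congˡ (zeroʳ x)) (+-identityʳ _) ⟩
    _                  ∎

  leadingTerm-quotient : ∀ a p d {b} → LeadingTerm p (suc d) b → LeadingTerm (quotient a p) d b
  leadingTerm-quotient a []      d       (p₀ , higher) = p₀ , λ i d<i → refl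
  leadingTerm-quotient a (_ ∷ p) zero    (p₀ , higher) =
    constant-eval p (p₀ , λ i 0<i → higher (suc i) (s≤s 0<i)) a ,
    λ { (suc i) _ → quotient-tail p (λ i 0<i → higher (suc i) (s≤s 0<i)) i }
    where
    quotient-tail : ∀ p → (∀ i → 0 ℕ.< i → coeff p i ≈ 0#) → quotient a p ≈ₚ []
    quotient-tail []      higher i       = refl
    quotient-tail (_ ∷ p) higher zero    = eval-≈0 p (λ i → higher (suc i) (s≤s z≤n)) a
    quotient-tail (_ ∷ p) higher (suc i) = quotient-≈0 a p (λ i → higher (suc i) (s≤s z≤n)) i
  leadingTerm-quotient a (_ ∷ p) (suc d) (p₀ , higher) =
    proj₁ tail , λ { (suc i) (s≤s d<i) → proj₂ tail i d<i }
    where tail = leadingTerm-quotient a p d (p₀ , λ i d<i → higher (suc i) (s≤s d<i))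

  -- Polynomials with as many roots as their degree

  Distinct : ∀ {d} → (Fin d → Carrier) → Set ℓ
  Distinct a = ∀ {i j} → i ≢ j → ¬ a i ≈ a j

  rootProduct : ∀ {d} → (Fin d → Carrier) → Carrier → Carrier
  rootProduct {zero}  a x = 1#
  rootProduct {suc d} a x = (x - a zero) * rootProduct (a ∘ suc) x

  module IntegralDomain
    (1≉0 : ¬ 1# ≈ 0#)
    (integral : ∀ {x y} → x * y ≈ 0# → x ≈ 0# ⊎ y ≈ 0#)
    where

    quotient-root : ∀ {a p x} → IsRoot p a → IsRoot p x → ¬ x ≈ a → IsRoot (quotient a p) x
    quotient-root {a} {p} {x} pa≈0 px≈0 x≉a with integral product≈0
      where
      product≈0 : (x - a) * eval (quotient a p) x ≈ 0#
      product≈0 = begin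
        (x - a) * eval (quotient a p) x             ≈⟨ +-identityˡ _ ⟨
        0# + (x - a) * eval (quotient a p) x        ≈⟨ +-congʳ pa≈0 ⟨
        eval p a + (x - a) * eval (quotient a p) x  ≈⟨ eval-quotient a p x ⟨
        eval p x                                    ≈⟨ px≈0 ⟩
        0#                                          ∎
    ... | inj₁ x-a≈0 = ⊥-elim (x≉a (x+-y≈0⇒x≈y x-a≈0))
      where
      x+-y≈0⇒x≈y : x - a ≈ 0# → x ≈ a
      x+-y≈0⇒x≈y x-a≈0 = begin
        x               ≈⟨ solve 2 (λ x a → x := (x :- a) :+ a) refl x a ⟩
        (x - a) + a     ≈⟨ +-congʳ x-a≈0 ⟩
        0# + a          ≈⟨ +-identityˡ a ⟩
        a               ∎
    ... | inj₂ q≈0   = q≈0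

    -- Division by `X - a₀` lowers the degree by one and, in the absence of zero divisors, keeps the
    -- other roots. After d divisions the constant 1 is left.
    eval-rootProduct : ∀ {d} p (a : Fin d → Carrier) → LeadingTerm p d 1# → Distinct a →
                       (∀ i → IsRoot p (a i)) → ∀ x → eval p x ≈ rootProduct a x
    eval-rootProduct {zero}  p a monic distinct roots x = constant-eval p monic x
    eval-rootProduct {suc d} p a monic distinct roots x = begin
      eval p x                                          ≈⟨ eval-quotient a₀ p x ⟩
      eval p a₀ + (x - a₀) * eval (quotient a₀ p) x     ≈⟨ +-congʳ (roots zero) ⟩
      0# + (x - a₀) * eval (quotient a₀ p) x            ≈⟨ +-identityˡ _ ⟩
      (x - a₀) * eval (quotient a₀ p) x
        ≈⟨ *-congˡ (eval-rootProduct (quotient a₀ p) (a ∘ suc) (leadingTerm-quotient a₀ p d monic)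
             (λ i≢j → distinct (i≢j ∘ Fin.suc-injective))
             (λ i → quotient-root {p = p} (roots zero) (roots (suc i)) (distinct λ ())) x) ⟩
      (x - a₀) * rootProduct (a ∘ suc) x                ∎
      where a₀ = a zero

    rootProduct-root : ∀ {d} (a : Fin d → Carrier) x → rootProduct a x ≈ 0# → ∃ λ i → x ≈ a i
    rootProduct-root {zero}  a x 1≈0 = ⊥-elim (1≉0 1≈0)
    rootProduct-root {suc d} a x product≈0 with integral product≈0
    ... | inj₁ x-a≈0 = zero , (begin
      x                    ≈⟨ solve 2 (λ x a → x := (x :- a) :+ a) refl x (a zero) ⟩
      (x - a zero) + a zero ≈⟨ +-congʳ x-a≈0 ⟩
      0# + a zero          ≈⟨ +-identityˡ _ ⟩
      a zero               ∎)
    ... | inj₂ rest≈0 with rootProduct-root (a ∘ suc) x rest≈0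
    ...   | i , x≈a = suc i , x≈a

    module AllRoots
      {d} (p : Poly) (a : Fin d → Carrier) (monic : LeadingTerm p d 1#) (distinct : Distinct a)
      (roots : ∀ i → IsRoot p (a i)) where

      roots-complete : ∀ x → IsRoot p x → ∃ λ i → x ≈ a i
      roots-complete x root =
        rootProduct-root a x (trans (sym (eval-rootProduct p a monic distinct roots x)) root)

    -- The quotient by the factor of the i-th root has the other roots as its full list of roots.
    -- Were x a root of it too, x would equal one of them, against distinctness.
    roots-simple : ∀ {d} p (a : Fin d → Carrier) → LeadingTerm p d 1# → Distinct a →
                   (∀ i → IsRoot p (a i)) → ∀ x → IsRoot p x → IsSimpleRoot p x
    roots-simple {zero}  p a monic distinct roots x root
      with () ← proj₁ (AllRoots.roots-complete p a monic distinct roots x root)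
    roots-simple {suc d} p a monic distinct roots x root =
      quotient x p , root-factor x p root , not-double
      where
      i = proj₁ (AllRoots.roots-complete p a monic distinct roots x root)
      x≈aᵢ = proj₂ (AllRoots.roots-complete p a monic distinct roots x root)
      others : Fin d → Carrier
      others j = a (punchIn i j)
      distinct′ : Distinct others
      distinct′ j≢k = distinct (j≢k ∘ Fin.punchIn-injective i _ _)
      not-double : ¬ IsRoot (quotient x p) x
      not-double root′ with rootProduct-root others x
        (trans (sym (eval-rootProduct (quotient x p) others (leadingTerm-quotient x p d monic) distinct′
          (λ j → quotient-root {p = p} root (roots (punchIn i j)) λ aⱼ≈x →
            distinct (Fin.punchInᵢ≢i i j) (trans aⱼ≈x x≈aᵢ)) x)) root′)
      ... | j , x≈aⱼ = distinct (Fin.punchInᵢ≢i i j) (trans (sym x≈aⱼ) x≈aᵢ)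

-- The ordered field of reals and the intermediate value theorem for polynomials

module OrderedField {ℓ} (ℝ : RealNumbers ℓ) where
  open RealNumbers ℝ hiding (zero)
  open RingProperties ring
  open IntegerSolver commutativeRing
  open Polynomials rawRing
  open PolynomialProperties commutativeRing
  open Spectra ℝ using (⟦_⟧)
  open Mult semiring using (×-homo-+)
  open SetoidReasoning setoid
  open IsStrictTotalOrder isStrictTotalOrder public
    using (compare; <-respˡ-≈; <-respʳ-≈) renaming (trans to <-trans; irrefl to <-irrefl; asym to <-asym)

  infix 4 _≈?_
  _≈?_ : Decidable _≈_
  x ≈? y with compare x y
  ... | tri< _ x≉y _ = no x≉y
  ... | tri≈ _ x≈y _ = yes x≈y
  ... | tri> _ x≉y _ = no x≉y

  <⇒≉ : ∀ {x y} → x < y → ¬ x ≈ y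
  <⇒≉ x<y x≈y = <-irrefl x≈y x<y

  >⇒≉ : ∀ {x y} → y < x → ¬ x ≈ y
  >⇒≉ y<x x≈y = <-irrefl (sym x≈y) y<x

  1≉0 : ¬ 1# ≈ 0#
  1≉0 = >⇒≉ 0<1

  -- Inequalities are proved by exhibiting the difference of their sides, so
  -- that the ring solver takes care of everything else.
  <-difference : ∀ {x y} d → 0# < d → y ≈ x + d → x < y
  <-difference {x} {y} d 0<d y≈x+d = <-respˡ-≈ (+-identityˡ x)
    (<-respʳ-≈ (trans (+-comm d x) (sym y≈x+d)) (+-monoˡ-< x 0<d))

  0<-difference : ∀ {x y} → x < y → 0# < y - x
  0<-difference {x} x<y = <-respˡ-≈ (-‿inverseʳ x) (+-monoˡ-< (- x) x<y)

  +-pos : ∀ {x y} → 0# < x → 0# < y → 0# < x + y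
  +-pos {x} {y} 0<x 0<y = <-trans 0<y (<-difference x 0<x (+-comm x y))

  neg-pos : ∀ {x} → x < 0# → 0# < - x
  neg-pos {x} x<0 = <-respʳ-≈ (+-identityˡ (- x)) (0<-difference x<0)

  neg-neg : ∀ {x} → 0# < x → - x < 0#
  neg-neg {x} 0<x = <-difference x 0<x (sym (-‿inverseˡ x))

  pos-*-neg : ∀ {x y} → 0# < x → y < 0# → x * y < 0#
  pos-*-neg {x} {y} 0<x y<0 = <-respˡ-≈
    (solve 2 (λ x y → :- (x :* :- y) := x :* y) refl x y) (neg-neg (*-pos 0<x (neg-pos y<0)))

  neg-*-neg : ∀ {x y} → x < 0# → y < 0# → 0# < x * y
  neg-*-neg {x} {y} x<0 y<0 = <-respʳ-≈
    (solve 2 (λ x y → :- x :* :- y := x :* y) refl x y) (*-pos (neg-pos x<0) (neg-pos y<0))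

  square-pos : ∀ {x} → ¬ x ≈ 0# → 0# < x * x
  square-pos {x} x≉0 with compare x 0#
  ... | tri< x<0 _ _ = neg-*-neg x<0 x<0
  ... | tri≈ _ x≈0 _ = ⊥-elim (x≉0 x≈0)
  ... | tri> _ _ 0<x = *-pos 0<x 0<x

  pos-cancelˡ : ∀ {x y} → 0# < x → 0# < x * y → 0# < y
  pos-cancelˡ {x} {y} 0<x 0<xy with compare y 0#
  ... | tri< y<0 _ _ = ⊥-elim (<-asym 0<xy (pos-*-neg 0<x y<0))
  ... | tri≈ _ y≈0 _ = ⊥-elim (<-irrefl (sym (trans (*-congˡ y≈0) (zeroʳ x))) 0<xy)
  ... | tri> _ _ 0<y = 0<y

  ≤-refl : ∀ {x} → x ≤ x
  ≤-refl = inj₂ refl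

  ≤-resp : ∀ {x x′ y y′} → x ≈ x′ → y ≈ y′ → x ≤ y → x′ ≤ y′
  ≤-resp x≈x′ y≈y′ (inj₁ x<y) = inj₁ (<-respˡ-≈ x≈x′ (<-respʳ-≈ y≈y′ x<y))
  ≤-resp x≈x′ y≈y′ (inj₂ x≈y) = inj₂ (trans (sym x≈x′) (trans x≈y y≈y′))

  <-≤-trans : ∀ {x y z} → x < y → y ≤ z → x < z
  <-≤-trans x<y (inj₁ y<z) = <-trans x<y y<z
  <-≤-trans x<y (inj₂ y≈z) = <-respʳ-≈ y≈z x<y

  ≤-<-trans : ∀ {x y z} → x ≤ y → y < z → x < z
  ≤-<-trans (inj₁ x<y) y<z = <-trans x<y y<z
  ≤-<-trans (inj₂ x≈y) y<z = <-respˡ-≈ (sym x≈y) y<z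

  ≤-trans : ∀ {x y z} → x ≤ y → y ≤ z → x ≤ z
  ≤-trans (inj₁ x<y) y≤z = inj₁ (<-≤-trans x<y y≤z)
  ≤-trans (inj₂ x≈y) y≤z = ≤-resp (sym x≈y) refl y≤z

  <⇒≱ : ∀ {x y} → x < y → ¬ y ≤ x
  <⇒≱ x<y y≤x = <-irrefl refl (<-≤-trans x<y y≤x)

  ≤-difference : ∀ {x y} d → 0# ≤ d → y ≈ x + d → x ≤ y
  ≤-difference d (inj₁ 0<d) y≈x+d = inj₁ (<-difference d 0<d y≈x+d)
  ≤-difference d (inj₂ 0≈d) y≈x+d =
    inj₂ (sym (trans y≈x+d (trans (+-congˡ (sym 0≈d)) (+-identityʳ _))))

  0≤-difference : ∀ {x y} → x ≤ y → 0# ≤ y - x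
  0≤-difference (inj₁ x<y) = inj₁ (0<-difference x<y)
  0≤-difference (inj₂ x≈y) = inj₂ (sym (trans (+-congʳ (sym x≈y)) (-‿inverseʳ _)))

  +-nonneg : ∀ {x y} → 0# ≤ x → 0# ≤ y → 0# ≤ x + y
  +-nonneg {x} {y} 0≤x 0≤y = ≤-trans 0≤x (≤-difference y 0≤y refl)

  +-pos-nonneg : ∀ {x y} → 0# < x → 0# ≤ y → 0# < x + y
  +-pos-nonneg {x} {y} 0<x 0≤y = <-≤-trans 0<x (≤-difference y 0≤y refl)

  *-nonneg : ∀ {x y} → 0# ≤ x → 0# ≤ y → 0# ≤ x * y
  *-nonneg (inj₁ 0<x) (inj₁ 0<y) = inj₁ (*-pos 0<x 0<y)
  *-nonneg (inj₁ _)   (inj₂ 0≈y) = inj₂ (sym (trans (*-congˡ (sym 0≈y)) (zeroʳ _)))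
  *-nonneg (inj₂ 0≈x) _          = inj₂ (sym (trans (*-congʳ (sym 0≈x)) (zeroˡ _)))

  double-nonneg : ∀ {x} → 0# ≤ x + x → 0# ≤ x
  double-nonneg {x} 0≤x+x with compare 0# x
  ... | tri< 0<x _ _ = inj₁ 0<x
  ... | tri≈ _ 0≈x _ = inj₂ 0≈x
  ... | tri> _ _ x<0 = ⊥-elim (<⇒≱ (<-trans
    (<-difference (- x) (neg-pos x<0) (solve 1 (λ x → x := (x :+ x) :+ :- x) refl x)) x<0) 0≤x+x)

  infix 9 _⁻¹
  -- 0 ⁻¹ = 0
  _⁻¹ : Carrier → Carrier
  x ⁻¹ with x ≈? 0#
  ... | yes _  = 0#
  ... | no x≉0 = proj₁ (inverse x≉0)

  ⁻¹-inverseʳ : ∀ {x} → ¬ x ≈ 0# → x * x ⁻¹ ≈ 1#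
  ⁻¹-inverseʳ {x} x≉0 with x ≈? 0#
  ... | yes x≈0 = ⊥-elim (x≉0 x≈0)
  ... | no x≉0′ = proj₂ (inverse x≉0′)

  ⁻¹-pos : ∀ {x} → 0# < x → 0# < x ⁻¹
  ⁻¹-pos 0<x = pos-cancelˡ 0<x (<-respʳ-≈ (sym (⁻¹-inverseʳ (>⇒≉ 0<x))) 0<1)

  *-cancelˡ : ∀ {x y z} → ¬ x ≈ 0# → x * y ≈ x * z → y ≈ z
  *-cancelˡ {x} {y} {z} x≉0 xy≈xz = begin
    y                 ≈⟨ unit y ⟩
    x ⁻¹ * (x * y)    ≈⟨ *-congˡ xy≈xz ⟩
    x ⁻¹ * (x * z)    ≈⟨ unit z ⟨
    z                 ∎
    where
    unit : ∀ y → y ≈ x ⁻¹ * (x * y)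
    unit y = begin
      y                 ≈⟨ *-identityˡ y ⟨
      1# * y            ≈⟨ *-congʳ (⁻¹-inverseʳ x≉0) ⟨
      (x * x ⁻¹) * y    ≈⟨ solve 3 (λ x i y → (x :* i) :* y := i :* (x :* y)) refl x (x ⁻¹) y ⟩
      x ⁻¹ * (x * y)    ∎

  *-≈0 : ∀ {x y} → ¬ x ≈ 0# → x * y ≈ 0# → y ≈ 0#
  *-≈0 x≉0 xy≈0 = *-cancelˡ x≉0 (trans xy≈0 (sym (zeroʳ _)))

  integral : ∀ {x y} → x * y ≈ 0# → x ≈ 0# ⊎ y ≈ 0#
  integral {x} xy≈0 with x ≈? 0#
  ... | yes x≈0 = inj₁ x≈0
  ... | no x≉0  = inj₂ (*-≈0 x≉0 xy≈0)

  *-≉0 : ∀ {x y} → ¬ x ≈ 0# → ¬ y ≈ 0# → ¬ x * y ≈ 0#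
  *-≉0 x≉0 y≉0 xy≈0 = y≉0 (*-≈0 x≉0 xy≈0)

  neg-⁻¹ : ∀ x → (- x) ⁻¹ ≈ - x ⁻¹
  neg-⁻¹ x with x ≈? 0#
  ... | yes x≈0 = at-zero
    where
    at-zero : (- x) ⁻¹ ≈ - 0#
    at-zero with - x ≈? 0#
    ... | yes _    = sym -0#≈0#
    ... | no -x≉0 = ⊥-elim (-x≉0 (trans (-‿cong x≈0) -0#≈0#))
  ... | no x≉0 = *-cancelˡ -x≉0 (begin
    - x * (- x) ⁻¹               ≈⟨ ⁻¹-inverseʳ -x≉0 ⟩
    1#                           ≈⟨ proj₂ (inverse x≉0) ⟨
    x * proj₁ (inverse x≉0)      ≈⟨ solve 2 (λ x y → x :* y := :- x :* :- y) refl x _ ⟩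
    - x * - proj₁ (inverse x≉0)  ∎)
    where
    -x≉0 : ¬ - x ≈ 0#
    -x≉0 -x≈0 = x≉0 (trans (sym (-‿involutive x)) (trans (-‿cong -x≈0) -0#≈0#))

  ⟦+⟧ : ∀ m n → ⟦ m ℕ.+ n ⟧ ≈ ⟦ m ⟧ + ⟦ n ⟧
  ⟦+⟧ = ×-homo-+ 1#

  ⟦⟧-nonneg : ∀ n → 0# ≤ ⟦ n ⟧
  ⟦⟧-nonneg zero    = ≤-refl
  ⟦⟧-nonneg (suc n) = +-nonneg (inj₁ 0<1) (⟦⟧-nonneg n)

  ⟦suc⟧-pos : ∀ n → 0# < ⟦ suc n ⟧
  ⟦suc⟧-pos n = +-pos-nonneg 0<1 (⟦⟧-nonneg n)

  ⟦⟧-mono-< : ∀ {m n} → m ℕ.< n → ⟦ m ⟧ < ⟦ n ⟧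
  ⟦⟧-mono-< {m} {n} m<n = <-difference ⟦ suc (n ∸ suc m) ⟧ (⟦suc⟧-pos (n ∸ suc m))
    (trans (reflexive (≡.cong ⟦_⟧ (≡.sym (≡.trans (ℕ.+-suc m _) (ℕ.m+[n∸m]≡n m<n))))) (⟦+⟧ m (suc (n ∸ suc m))))

  ⟦⟧-injective : ∀ {m n} → ⟦ m ⟧ ≈ ⟦ n ⟧ → m ≡ n
  ⟦⟧-injective {m} {n} m≈n with ℕ.<-cmp m n
  ... | tri< m<n _ _ = ⊥-elim (<⇒≉ (⟦⟧-mono-< m<n) m≈n)
  ... | tri≈ _ m≡n _ = m≡n
  ... | tri> _ _ n<m = ⊥-elim (>⇒≉ (⟦⟧-mono-< n<m) m≈n)

  -- The intermediate value theorem for polynomials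

  -- The condition |x| ≤ c, without an absolute value.
  Bounded : Carrier → Carrier → Set ℓ
  Bounded c x = - c ≤ x × x ≤ c

  bound : ∀ x → ∃ λ c → 0# ≤ c × Bounded c x
  bound x with compare 0# x
  ... | tri< 0<x _ _ = x , inj₁ 0<x , inj₁ (<-trans (neg-neg 0<x) 0<x) , ≤-refl
  ... | tri≈ _ 0≈x _ = x , inj₂ 0≈x , inj₂ (trans (-‿cong (sym 0≈x)) (trans -0#≈0# 0≈x)) , ≤-refl
  ... | tri> _ _ x<0 = - x , inj₁ (neg-pos x<0) , inj₂ (-‿involutive x) , inj₁ (<-trans x<0 (neg-pos x<0))

  private
    slack : ∀ {c x} → Bounded c x → 0# ≤ x + c × 0# ≤ c - x
    slack (-c≤x , x≤c) =
      ≤-resp refl (+-congˡ (-‿involutive _)) (0≤-difference -c≤x) , 0≤-difference x≤c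

    bounded-slack : ∀ {c x} → 0# ≤ x + c → 0# ≤ c - x → Bounded c x
    bounded-slack {c} {x} 0≤x+c 0≤c-x =
      ≤-difference (x + c) 0≤x+c (solve 2 (λ x c → x := :- c :+ (x :+ c)) refl x c) ,
      ≤-difference (c - x) 0≤c-x (solve 2 (λ x c → c := x :+ (c :- x)) refl x c)

  bounded-resp : ∀ {c d x y} → c ≈ d → x ≈ y → Bounded c x → Bounded d y
  bounded-resp c≈d x≈y (-c≤x , x≤c) = ≤-resp (-‿cong c≈d) x≈y -c≤x , ≤-resp x≈y c≈d x≤c

  bounded-weaken : ∀ {c d x} → c ≤ d → Bounded c x → Bounded d x
  bounded-weaken {c} {d} {x} c≤d (-c≤x , x≤c) =
    ≤-trans (≤-difference (d - c) (0≤-difference c≤d)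
      (solve 2 (λ c d → :- c := :- d :+ (d :- c)) refl c d)) -c≤x ,
    ≤-trans x≤c c≤d

  bounded-+ : ∀ {c d x y} → Bounded c x → Bounded d y → Bounded (c + d) (x + y)
  bounded-+ {c} {d} {x} {y} c-bound d-bound =
    bounded-slack
      (≤-resp refl (solve 4 (λ x c y d → (x :+ c) :+ (y :+ d) := (x :+ y) :+ (c :+ d)) refl x c y d)
        (+-nonneg (proj₁ (slack c-bound)) (proj₁ (slack d-bound))))
      (≤-resp refl (solve 4 (λ x c y d → (c :- x) :+ (d :- y) := (c :+ d) :- (x :+ y)) refl x c y d)
        (+-nonneg (proj₂ (slack c-bound)) (proj₂ (slack d-bound))))

  -- Twice cd + xy and twice cd - xy are sums of products of the nonnegative numbers c ± x and d ±
  -- y, which avoids a distinction of signs.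
  bounded-* : ∀ {c d x y} → Bounded c x → Bounded d y → Bounded (c * d) (x * y)
  bounded-* {c} {d} {x} {y} c-bound d-bound =
    bounded-slack
      (double-nonneg (≤-resp refl
        (solve 4 (λ x c y d → (x :+ c) :* (y :+ d) :+ (c :- x) :* (d :- y)
           := (x :* y :+ c :* d) :+ (x :* y :+ c :* d)) refl x c y d)
        (+-nonneg (*-nonneg (proj₁ sx) (proj₁ sy)) (*-nonneg (proj₂ sx) (proj₂ sy)))))
      (double-nonneg (≤-resp refl
        (solve 4 (λ x c y d → (x :+ c) :* (d :- y) :+ (c :- x) :* (y :+ d)
           := (c :* d :- x :* y) :+ (c :* d :- x :* y)) refl x c y d)
        (+-nonneg (*-nonneg (proj₁ sx) (proj₂ sy)) (*-nonneg (proj₂ sx) (proj₁ sy)))))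
    where
    sx = slack c-bound
    sy = slack d-bound

  -- For `a ∷ p` the difference of the values is x (p(x) - p(s)) + (x - s) p(s). The restriction δ ≤
  -- 1 bounds |x| by b + 1.
  lipschitz : ∀ p s → ∃ λ c → 0# ≤ c ×
    (∀ x δ → δ ≤ 1# → Bounded δ (x - s) → Bounded (c * δ) (eval p x - eval p s))
  lipschitz []      s = 0# , ≤-refl , λ x δ _ _ →
    inj₂ (solve 1 (λ δ → :- (:0 :* δ) := :0 :- :0) refl δ) ,
    inj₂ (solve 1 (λ δ → :0 :- :0 := :0 :* δ) refl δ)
  lipschitz (a ∷ p) s with lipschitz p s | bound s | bound (eval p s)
  ... | c , 0≤c , p-bound | b , 0≤b , s-bound | e , 0≤e , ps-bound =
    (b + 1#) * c + e ,
    +-nonneg (*-nonneg (+-nonneg 0≤b (inj₁ 0<1)) 0≤c) 0≤e ,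
    λ x δ δ≤1 x-bound → bounded-resp
      (solve 4 (λ b c δ e → (b :+ :1) :* (c :* δ) :+ δ :* e
         := ((b :+ :1) :* c :+ e) :* δ) refl b c δ e)
      (solve 5 (λ a x s u v → (s :+ (x :- s)) :* (u :- v) :+ (x :- s) :* v
         := (a :+ x :* u) :- (a :+ s :* v)) refl a x s (eval p x) (eval p s))
      (bounded-+ (bounded-* (bounded-+ s-bound (bounded-weaken δ≤1 x-bound)) (p-bound x δ δ≤1 x-bound))
                 (bounded-* x-bound ps-bound))

  -- With v = p(s) and Lipschitz constant c, the choice δ = v / (v + c) is at most 1 and gives v - c
  -- δ = v δ, a positive lower bound for p.
  positive-near : ∀ p s → 0# < eval p s →
    ∃ λ δ → 0# < δ × (∀ x → Bounded δ (x - s) → 0# < eval p x)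
  positive-near p s 0<v with lipschitz p s
  ... | c , 0≤c , p-bound = δ , *-pos 0<v 0<i , λ x x-bound →
    <-≤-trans (*-pos 0<v (*-pos 0<v 0<i)) (≤-difference _ (proj₁ (slack (p-bound x δ δ≤1 x-bound))) (gap x))
    where
    v = eval p s
    0<v+c : 0# < v + c
    0<v+c = +-pos-nonneg 0<v 0≤c
    i = (v + c) ⁻¹
    0<i = ⁻¹-pos 0<v+c
    unit : (v + c) * i ≈ 1#
    unit = ⁻¹-inverseʳ (>⇒≉ 0<v+c)
    δ = v * i
    δ≤1 : δ ≤ 1#
    δ≤1 = ≤-difference (c * i) (*-nonneg 0≤c (inj₁ 0<i)) (trans (sym unit) (distribʳ i v c))
    gap : ∀ x → eval p x ≈ v * (v * i) + ((eval p x - v) + c * δ)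
    gap x = begin
      eval p x
        ≈⟨ solve 2 (λ u v → u := v :* :1 :+ (u :- v)) refl (eval p x) v ⟩
      v * 1# + (eval p x - v)
        ≈⟨ +-congʳ (*-congˡ unit) ⟨
      v * ((v + c) * i) + (eval p x - v)
        ≈⟨ solve 4 (λ u v c i → v :* ((v :+ c) :* i) :+ (u :- v)
             := v :* (v :* i) :+ ((u :- v) :+ c :* (v :* i))) refl (eval p x) v c i ⟩
      v * (v * i) + ((eval p x - v) + c * δ)  ∎

  negative-near : ∀ p s → eval p s < 0# →
    ∃ λ δ → 0# < δ × (∀ x → Bounded δ (x - s) → eval p x < 0#)
  negative-near p s v<0 =
    let δ , 0<δ , near = positive-near (-ₚ p) s (<-respʳ-≈ (sym (eval-neg p s)) (neg-pos v<0))
    in δ , 0<δ , λ x x-bound →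
      <-respˡ-≈ (trans (-‿cong (eval-neg p x)) (-‿involutive _)) (neg-neg (near x x-bound))

  private
    module Crossing (p : Poly) {x y} (x<y : x < y) (px<0 : eval p x < 0#) (0<py : 0# < eval p y) where
      -- The root is the supremum s of this set. If p(s) were positive, a smaller upper bound would
      -- exist; if it were negative, the set would reach beyond s; trichotomy leaves p(s) = 0.
      S : Pred Carrier ℓ
      S z = x ≤ z × z ≤ y × eval p z ≤ 0#

      x∈S : x ∈ S
      x∈S = ≤-refl , inj₁ x<y , inj₁ px<0

      y-upper : IsUpperBound S y
      y-upper _ z∈S = proj₁ (proj₂ z∈S)

      module Supremum (s : Carrier) (upper : IsUpperBound S s) (least : ∀ b → IsUpperBound S b → s ≤ b) where

        not-positive : ¬ 0# < eval p s
        not-positive 0<ps = <⇒≱ s-δ<s (least (s - δ) below)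
          where
          δ = proj₁ (positive-near p s 0<ps)
          0<δ = proj₁ (proj₂ (positive-near p s 0<ps))
          near = proj₂ (proj₂ (positive-near p s 0<ps))
          s-δ<s : s - δ < s
          s-δ<s = <-difference δ 0<δ (solve 2 (λ s δ → s := (s :- δ) :+ δ) refl s δ)
          below : IsUpperBound S (s - δ)
          below z z∈S with compare z (s - δ)
          ... | tri< z<s-δ _ _ = inj₁ z<s-δ
          ... | tri≈ _ z≈s-δ _ = inj₂ z≈s-δ
          ... | tri> _ _ s-δ<z = ⊥-elim (<⇒≱ (near z (bounded-slack
            (inj₁ (<-respʳ-≈ (solve 3 (λ z s δ → z :- (s :- δ) := (z :- s) :+ δ) refl z s δ) (0<-difference s-δ<z)))
            (≤-resp refl (solve 3 (λ z s δ → (s :- z) :+ δ := δ :- (z :- s)) refl z s δ)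
              (+-nonneg (0≤-difference (upper z z∈S)) (inj₁ 0<δ))))) (proj₂ (proj₂ z∈S)))

        s<y : eval p s ≤ 0# → s < y
        s<y ps≤0 with least y y-upper
        ... | inj₁ s<y = s<y
        ... | inj₂ s≈y = ⊥-elim (<⇒≱ 0<py (≤-resp (eval-congˡ p s≈y) refl ps≤0))

        not-negative : ¬ eval p s < 0#
        not-negative ps<0 = <⇒≱ s<s+ε (upper (s + ε)
          (inj₁ (≤-<-trans (upper x x∈S) s<s+ε) , s+ε≤y , inj₁ (near (s + ε) close)))
          where
          δ = proj₁ (negative-near p s ps<0)
          0<δ = proj₁ (proj₂ (negative-near p s ps<0))
          near = proj₂ (proj₂ (negative-near p s ps<0))
          minimum : ∀ a b → 0# < a → 0# < b → ∃ λ c → 0# < c × c ≤ a × c ≤ b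
          minimum a b 0<a 0<b with compare a b
          ... | tri< a<b _ _ = a , 0<a , ≤-refl , inj₁ a<b
          ... | tri≈ _ a≈b _ = a , 0<a , ≤-refl , inj₂ a≈b
          ... | tri> _ _ b<a = b , 0<b , inj₁ b<a , ≤-refl
          -- The step to the right must keep p negative, whence ε ≤ δ, and must stay in the
          -- interval, whence ε ≤ y - s.
          choice : ∃ λ c → 0# < c × c ≤ δ × c ≤ y - s
          choice = minimum δ (y - s) 0<δ (0<-difference (s<y (inj₁ ps<0)))
          ε = proj₁ choice
          0<ε = proj₁ (proj₂ choice)
          s<s+ε : s < s + ε
          s<s+ε = <-difference ε 0<ε refl
          s+ε≤y : s + ε ≤ y
          s+ε≤y = ≤-difference _ (0≤-difference (proj₂ (proj₂ (proj₂ choice))))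
            (solve 3 (λ y s ε → y := (s :+ ε) :+ ((y :- s) :- ε)) refl y s ε)
          close : Bounded δ ((s + ε) - s)
          close = bounded-slack
            (≤-resp refl (solve 3 (λ s ε δ → ε :+ δ := ((s :+ ε) :- s) :+ δ) refl s ε δ)
              (+-nonneg (inj₁ 0<ε) (inj₁ 0<δ)))
            (≤-resp refl (solve 3 (λ s ε δ → δ :- ε := δ :- ((s :+ ε) :- s)) refl s ε δ)
              (0≤-difference (proj₁ (proj₂ (proj₂ choice)))))

        s-root : IsRoot p s
        s-root with compare (eval p s) 0#
        ... | tri< ps<0 _ _ = ⊥-elim (not-negative ps<0)
        ... | tri≈ _ ps≈0 _ = ps≈0
        ... | tri> _ _ 0<ps = ⊥-elim (not-positive 0<ps)

        x<s : x < s
        x<s with upper x x∈S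
        ... | inj₁ x<s = x<s
        ... | inj₂ x≈s = ⊥-elim (<⇒≉ px<0 (trans (eval-congˡ p x≈s) s-root))

  increasing-crossing : ∀ p {x y} → x < y → eval p x < 0# → 0# < eval p y →
                        ∃ λ z → (x < z × z < y) × IsRoot p z
  increasing-crossing p {x} {y} x<y px<0 0<py =
    let s , upper , least = supremum S (x , x∈S) (y , y-upper)
        open Supremum s upper least
    in s , (x<s , s<y (inj₂ s-root)) , s-root
    where open Crossing p x<y px<0 0<py

  opaque
    -- The product covers both directions of crossing; a decreasing one is an increasing one of -p.
    sign-change-root : ∀ p {x y} → x < y → eval p x * eval p y < 0# →
                       ∃ λ z → (x < z × z < y) × IsRoot p z
    sign-change-root p {x} {y} x<y pxpy<0 with compare (eval p x) 0# | compare (eval p y) 0#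
    ... | tri≈ _ px≈0 _ | _ = ⊥-elim (<-irrefl (trans (*-congʳ px≈0) (zeroˡ _)) pxpy<0)
    ... | tri< _ _ _ | tri≈ _ py≈0 _ = ⊥-elim (<-irrefl (trans (*-congˡ py≈0) (zeroʳ _)) pxpy<0)
    ... | tri> _ _ _ | tri≈ _ py≈0 _ = ⊥-elim (<-irrefl (trans (*-congˡ py≈0) (zeroʳ _)) pxpy<0)
    ... | tri< px<0 _ _ | tri< py<0 _ _ = ⊥-elim (<-asym pxpy<0 (neg-*-neg px<0 py<0))
    ... | tri> _ _ 0<px | tri> _ _ 0<py = ⊥-elim (<-asym pxpy<0 (*-pos 0<px 0<py))
    ... | tri< px<0 _ _ | tri> _ _ 0<py = increasing-crossing p x<y px<0 0<py
    ... | tri> _ _ 0<px | tri< py<0 _ _ =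
      let z , between , root = increasing-crossing (-ₚ p) x<y
            (<-respˡ-≈ (sym (eval-neg p x)) (neg-neg 0<px))
            (<-respʳ-≈ (sym (eval-neg p y)) (neg-pos py<0))
      in z , between ,
        trans (sym (-‿involutive _)) (trans (-‿cong (trans (sym (eval-neg p z)) root)) -0#≈0#)

-- The complex numbers, and real polynomials all of whose complex roots are real

module ComplexRoots {ℓ} (ℝ : RealNumbers ℓ) where
  open RealNumbers ℝ hiding (zero)
  open IntegerSolver commutativeRing
  open OrderedField ℝ
  open Spectra ℝ hiding (0#; _≈_)
  open Polynomials rawRing using (eval; coeff)
  open PolynomialProperties commutativeRing
  private
    module C = RawRing ℂ
    module C[X] = Polynomials ℂ

  ℂ-commutativeRing : CommutativeRing ℓ ℓ
  ℂ-commutativeRing = record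
    { Carrier = C.Carrier
    ; _≈_ = C._≈_
    ; _+_ = C._+_
    ; _*_ = C._*_
    ; -_ = C.-_
    ; 0# = C.0#
    ; 1# = C.1#
    ; isCommutativeRing = record
      { isRing = record
        { +-isAbelianGroup = record
          { isGroup = record
            { isMonoid = record
              { isSemigroup = record
                { isMagma = record
                  { isEquivalence = record
                    { refl  = refl , refl
                    ; sym   = λ (p , q) → sym p , sym q
                    ; trans = λ (p , q) (r , s) → trans p r , trans q s
                    }
                  ; ∙-cong = λ (p , q) (r , s) → +-cong p r , +-cong q s
                  }
                ; assoc = λ _ _ _ → +-assoc _ _ _ , +-assoc _ _ _
                }
              ; identity = (λ _ → +-identityˡ _ , +-identityˡ _) , (λ _ → +-identityʳ _ , +-identityʳ _)
              }
            ; inverse = (λ _ → -‿inverseˡ _ , -‿inverseˡ _) , (λ _ → -‿inverseʳ _ , -‿inverseʳ _)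
            ; ⁻¹-cong = λ (p , q) → -‿cong p , -‿cong q
            }
          ; comm = λ _ _ → +-comm _ _ , +-comm _ _
          }
        ; *-cong = λ (p , q) (r , s) →
            +-cong (*-cong p r) (-‿cong (*-cong q s)) , +-cong (*-cong p s) (*-cong q r)
        ; *-assoc = λ (a , b) (c , d) (e , f) →
            solve 6 (λ a b c d e f →
              (a :* c :- b :* d) :* e :- (a :* d :+ b :* c) :* f :=
              a :* (c :* e :- d :* f) :- b :* (c :* f :+ d :* e)) refl a b c d e f ,
            solve 6 (λ a b c d e f →
              (a :* c :- b :* d) :* f :+ (a :* d :+ b :* c) :* e :=
              a :* (c :* f :+ d :* e) :+ b :* (c :* e :- d :* f)) refl a b c d e f
        ; *-identity =
            (λ (a , b) →
              solve 2 (λ a b → :1 :* a :- :0 :* b := a) refl a b ,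
              solve 2 (λ a b → :1 :* b :+ :0 :* a := b) refl a b) ,
            (λ (a , b) →
              solve 2 (λ a b → a :* :1 :- b :* :0 := a) refl a b ,
              solve 2 (λ a b → a :* :0 :+ b :* :1 := b) refl a b)
        ; distrib =
            (λ (a , b) (c , d) (e , f) →
              solve 6 (λ a b c d e f →
                a :* (c :+ e) :- b :* (d :+ f) := (a :* c :- b :* d) :+ (a :* e :- b :* f)) refl a b c d e f ,
              solve 6 (λ a b c d e f →
                a :* (d :+ f) :+ b :* (c :+ e) := (a :* d :+ b :* c) :+ (a :* f :+ b :* e)) refl a b c d e f) ,
            (λ (a , b) (c , d) (e , f) →
              solve 6 (λ a b c d e f →
                (c :+ e) :* a :- (d :+ f) :* b := (c :* a :- d :* b) :+ (e :* a :- f :* b)) refl a b c d e f ,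
              solve 6 (λ a b c d e f →
                (c :+ e) :* b :+ (d :+ f) :* a := (c :* b :+ d :* a) :+ (e :* b :+ f :* a)) refl a b c d e f)
        }
      ; *-comm = λ (a , b) (c , d) →
          solve 4 (λ a b c d → a :* c :- b :* d := c :* a :- d :* b) refl a b c d ,
          solve 4 (λ a b c d → a :* d :+ b :* c := c :* b :+ d :* a) refl a b c d
      }
    }

  private module ℂ-Polynomials = PolynomialProperties ℂ-commutativeRing

  -- |z|² ≠ 0, and |z|² w = z̄ (z w).
  ℂ-integral : ∀ {z w} → z C.* w C.≈ C.0# → z C.≈ C.0# ⊎ w C.≈ C.0#
  ℂ-integral {a , b} {c , d} (re≈0 , im≈0) with a ≈? 0# | b ≈? 0#
  ... | yes a≈0 | yes b≈0 = inj₁ (a≈0 , b≈0)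
  ... | no a≉0  | _       = inj₂ (cancel (+-pos-nonneg (square-pos a≉0) (square-nonneg b)))
    where
    square-nonneg : ∀ x → 0# ≤ x * x
    square-nonneg x with x ≈? 0#
    ... | yes x≈0 = inj₂ (sym (trans (*-congʳ x≈0) (zeroˡ x)))
    ... | no x≉0  = inj₁ (square-pos x≉0)
    cancel : 0# < a * a + b * b → (c , d) C.≈ C.0#
    cancel 0<norm =
      *-≈0 (>⇒≉ 0<norm) (trans
        (solve 4 (λ a b c d → (a :* a :+ b :* b) :* c := a :* (a :* c :- b :* d) :+ b :* (a :* d :+ b :* c)) refl a b c d)
        (trans (+-cong (*-congˡ re≈0) (*-congˡ im≈0))
          (solve 2 (λ a b → a :* :0 :+ b :* :0 := :0) refl a b))) ,
      *-≈0 (>⇒≉ 0<norm) (trans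
        (solve 4 (λ a b c d → (a :* a :+ b :* b) :* d := a :* (a :* d :+ b :* c) :- b :* (a :* c :- b :* d)) refl a b c d)
        (trans (+-cong (*-congˡ im≈0) (-‿cong (*-congˡ re≈0)))
          (solve 2 (λ a b → a :* :0 :- b :* :0 := :0) refl a b)))
  ... | yes a≈0 | no b≉0  = inj₂ (
    *-≈0 b≉0 (trans (solve 4 (λ a b c d → b :* c := (a :* d :+ b :* c) :- a :* d) refl a b c d)
      (trans (+-cong im≈0 (-‿cong (*-congʳ a≈0)))
        (solve 1 (λ d → :0 :- :0 :* d := :0) refl d))) ,
    *-≈0 b≉0 (trans (solve 4 (λ a b c d → b :* d := a :* c :- (a :* c :- b :* d)) refl a b c d)
      (trans (+-cong (*-congʳ a≈0) (-‿cong re≈0))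
        (solve 1 (λ c → :0 :* c :- :0 := :0) refl c))))

  coeff-fromℝ : ∀ p i → C[X].coeff (fromℝ[X] p) i C.≈ (coeff p i , 0#)
  coeff-fromℝ []      i       = refl , refl
  coeff-fromℝ (a ∷ p) zero    = refl , refl
  coeff-fromℝ (a ∷ p) (suc i) = coeff-fromℝ p i

  eval-fromℝ : ∀ p x → C[X].eval (fromℝ[X] p) (x , 0#) C.≈ (eval p x , 0#)
  eval-fromℝ []      x = refl , refl
  eval-fromℝ (a ∷ p) x with eval-fromℝ p x
  ... | re≈ , im≈ =
    trans (+-congˡ (+-cong (*-congˡ re≈) (-‿cong (*-congˡ im≈))))
      (solve 3 (λ a x u → a :+ (x :* u :- :0 :* :0) := a :+ x :* u) refl a x (eval p x)) ,
    trans (+-congˡ (+-cong (*-congˡ im≈) (*-congˡ re≈)))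
      (solve 2 (λ x u → :0 :+ (x :* :0 :+ :0 :* u) := :0) refl x (eval p x))

  open IntegralDomain 1≉0 integral public

  module RealRoots
    {d} (p : Poly) (a : Fin d → Carrier) (monic : LeadingTerm p d 1#)
    (increasing : ∀ {i j} → i Fin.< j → a i < a j) (roots : ∀ i → IsRoot p (a i)) where

    distinct : Distinct a
    distinct {i} {j} i≢j aᵢ≈aⱼ with Fin.<-cmp i j
    ... | tri< i<j _ _ = <⇒≉ (increasing i<j) aᵢ≈aⱼ
    ... | tri≈ _ i≡j _ = i≢j i≡j
    ... | tri> _ _ j<i = >⇒≉ (increasing j<i) aᵢ≈aⱼ

    enumerates : Enumerates (IsRoot p) a
    enumerates = record
      { increasing = increasing
      ; sound      = roots
      ; complete   = AllRoots.roots-complete p a monic distinct roots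
      }

    private
      b : Fin d → C.Carrier
      b i = a i , 0#

      b-distinct : ℂ-Polynomials.Distinct b
      b-distinct i≢j (aᵢ≈aⱼ , _) = distinct i≢j aᵢ≈aⱼ

      b-roots : ∀ i → C[X].IsRoot (fromℝ[X] p) (b i)
      b-roots i =
        let re≈ , im≈ = eval-fromℝ p (a i) in trans re≈ (roots i) , im≈

      ℂ-monic : ℂ-Polynomials.LeadingTerm (fromℝ[X] p) d C.1#
      ℂ-monic =
        (let re≈ , im≈ = coeff-fromℝ p d in trans re≈ (proj₁ monic) , im≈) ,
        λ i d<i → let re≈ , im≈ = coeff-fromℝ p i in trans re≈ (proj₂ monic i d<i) , im≈

      open ℂ-Polynomials.IntegralDomain (1≉0 ∘ proj₁) ℂ-integral using ()
        renaming (roots-simple to ℂ-roots-simple; module AllRoots to ℂ-AllRoots)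

    -- The d real roots remain distinct in ℂ and so exhaust the complex roots of a monic polynomial
    -- of degree d.
    all-roots-simple : AllRootsSimple p
    all-roots-simple = ℂ-roots-simple (fromℝ[X] p) b ℂ-monic b-distinct b-roots

    all-roots-real : AllRootsReal p
    all-roots-real z root =
      proj₂ (proj₂ (ℂ-AllRoots.roots-complete (fromℝ[X] p) b ℂ-monic b-distinct b-roots z root))

-- Sums over the hypercube, characters, the Fourier transform and radial vectors

module HypercubeFourier {ℓ} (ℝ : RealNumbers ℓ) where
  open RealNumbers ℝ hiding (zero)
  open IntegerSolver commutativeRing
  open OrderedField ℝ
  open Spectra ℝ hiding (0#; _≈_)
  open SetoidReasoning setoid

  ∑ᵥ-cong : ∀ {n} {f g : V n} → f ≈ᴹ g → ∑ᵥ f ≈ ∑ᵥ g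
  ∑ᵥ-cong {zero}  f≈g = f≈g []
  ∑ᵥ-cong {suc n} f≈g = +-cong (∑ᵥ-cong (f≈g ∘ (0ℙ ∷_))) (∑ᵥ-cong (f≈g ∘ (1ℙ ∷_)))

  ∑ᵥ-+ : ∀ {n} (f g : V n) → ∑ᵥ (f +ᴹ g) ≈ ∑ᵥ f + ∑ᵥ g
  ∑ᵥ-+ {zero}  f g = refl
  ∑ᵥ-+ {suc n} f g = trans (+-cong (∑ᵥ-+ (f ∘ (0ℙ ∷_)) (g ∘ (0ℙ ∷_))) (∑ᵥ-+ (f ∘ (1ℙ ∷_)) (g ∘ (1ℙ ∷_))))
    (solve 4 (λ a b c d → (a :+ b) :+ (c :+ d) := (a :+ c) :+ (b :+ d)) refl _ _ _ _)

  ∑ᵥ-* : ∀ {n} c (f : V n) → ∑ᵥ (c *ₗ f) ≈ c * ∑ᵥ f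
  ∑ᵥ-* {zero}  c f = refl
  ∑ᵥ-* {suc n} c f = trans (+-cong (∑ᵥ-* c (f ∘ (0ℙ ∷_))) (∑ᵥ-* c (f ∘ (1ℙ ∷_)))) (sym (distribˡ c _ _))

  ∑ᵥ-≈0 : ∀ {n} {f : V n} → f ≈ᴹ 0ᴹ → ∑ᵥ f ≈ 0#
  ∑ᵥ-≈0 {zero}  f≈0 = f≈0 []
  ∑ᵥ-≈0 {suc n} f≈0 = trans (+-cong (∑ᵥ-≈0 (f≈0 ∘ (0ℙ ∷_))) (∑ᵥ-≈0 (f≈0 ∘ (1ℙ ∷_)))) (+-identityˡ 0#)

  ∑ᵥ-nonneg : ∀ {n} {f : V n} → (∀ u → 0# ≤ f u) → 0# ≤ ∑ᵥ f
  ∑ᵥ-nonneg {zero}  0≤f = 0≤f []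
  ∑ᵥ-nonneg {suc n} 0≤f = +-nonneg (∑ᵥ-nonneg (0≤f ∘ (0ℙ ∷_))) (∑ᵥ-nonneg (0≤f ∘ (1ℙ ∷_)))

  ∑ᵥ-pos : ∀ {n} {f : V n} → (∀ u → 0# ≤ f u) → ∀ u → 0# < f u → 0# < ∑ᵥ f
  ∑ᵥ-pos 0≤f []       0<fu = 0<fu
  ∑ᵥ-pos 0≤f (0ℙ ∷ u) 0<fu =
    +-pos-nonneg (∑ᵥ-pos (0≤f ∘ (0ℙ ∷_)) u 0<fu) (∑ᵥ-nonneg (0≤f ∘ (1ℙ ∷_)))
  ∑ᵥ-pos 0≤f (1ℙ ∷ u) 0<fu = <-respʳ-≈ (+-comm _ _)
    (+-pos-nonneg (∑ᵥ-pos (0≤f ∘ (1ℙ ∷_)) u 0<fu) (∑ᵥ-nonneg (0≤f ∘ (0ℙ ∷_))))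

  ∑ᵥ-single : ∀ {n} {f : V n} u → (∀ v → v ≢ u → f v ≈ 0#) → ∑ᵥ f ≈ f u
  ∑ᵥ-single []       f≈0 = refl
  ∑ᵥ-single (0ℙ ∷ u) f≈0 = trans
    (+-cong (∑ᵥ-single u λ v v≢u → f≈0 (0ℙ ∷ v) (v≢u ∘ Vec.∷-injectiveʳ)) (∑ᵥ-≈0 λ v → f≈0 (1ℙ ∷ v) λ ()))
    (+-identityʳ _)
  ∑ᵥ-single (1ℙ ∷ u) f≈0 = trans
    (+-cong (∑ᵥ-≈0 λ v → f≈0 (0ℙ ∷ v) λ ()) (∑ᵥ-single u λ v v≢u → f≈0 (1ℙ ∷ v) (v≢u ∘ Vec.∷-injectiveʳ)))
    (+-identityˡ _)

  -- In positive dimension the poles lie in different halves of the cube, so each half has a single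
  -- contribution.
  ∑ᵥ-poles : ∀ {n} {f : V (suc n)} → (∀ v → v ≢ 𝟎 → v ≢ 𝟏 → f v ≈ 0#) → ∑ᵥ f ≈ f 𝟎 + f 𝟏
  ∑ᵥ-poles f≈0 = +-cong
    (∑ᵥ-single 𝟎 λ v v≢𝟎 → f≈0 (0ℙ ∷ v) (v≢𝟎 ∘ Vec.∷-injectiveʳ) λ ())
    (∑ᵥ-single 𝟏 λ v v≢𝟏 → f≈0 (1ℙ ∷ v) (λ ()) (v≢𝟏 ∘ Vec.∷-injectiveʳ))

  zero-or-support : ∀ {n} (f : V n) → f ≈ᴹ 0ᴹ ⊎ ∃ λ u → ¬ f u ≈ 0#
  zero-or-support {zero} f with f [] ≈? 0#
  ... | yes f≈0 = inj₁ λ { [] → f≈0 }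
  ... | no f≉0  = inj₂ ([] , f≉0)
  zero-or-support {suc n} f with zero-or-support (f ∘ (0ℙ ∷_)) | zero-or-support (f ∘ (1ℙ ∷_))
  ... | inj₂ (u , f≉0) | _              = inj₂ (_ , f≉0)
  ... | inj₁ _         | inj₂ (u , f≉0) = inj₂ (_ , f≉0)
  ... | inj₁ f₀≈0      | inj₁ f₁≈0      = inj₁ λ { (0ℙ ∷ u) → f₀≈0 u ; (1ℙ ∷ u) → f₁≈0 u }

  sign-+ : ∀ p q → sign (p Parity.+ q) ≈ sign p * sign q
  sign-+ 0ℙ q  = sym (*-identityˡ _)
  sign-+ 1ℙ 0ℙ = sym (*-identityʳ _)
  sign-+ 1ℙ 1ℙ = solve 0 (:1 := :- :1 :* :- :1) refl

  E-cons : ∀ {n} a b (u v : Vertex n) → E (a ∷ u) (b ∷ v) ≈ sign (a Parity.* b) * E u v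
  E-cons a b u v = sign-+ (a Parity.* b) (u ∙ v)

  E-sym : ∀ {n} (u v : Vertex n) → E u v ≈ E v u
  E-sym []      []      = refl
  E-sym (a ∷ u) (b ∷ v) = trans (E-cons a b u v)
    (trans (*-cong (reflexive (≡.cong sign (Parity.*-comm a b))) (E-sym u v)) (sym (E-cons b a v u)))

  -- The sign (-1)ᵏ.
  ε : ℕ → Carrier
  ε zero    = 1#
  ε (suc k) = - ε k

  ε-square : ∀ k → ε k * ε k ≈ 1#
  ε-square zero    = *-identityˡ 1#
  ε-square (suc k) = trans (solve 1 (λ x → :- x :* :- x := x :* x) refl (ε k)) (ε-square k)

  E-𝟎 : ∀ {n} (u : Vertex n) → E 𝟎 u ≈ 1#
  E-𝟎 []      = refl
  E-𝟎 (a ∷ u) = trans (E-cons 0ℙ a 𝟎 u) (trans (*-identityˡ _) (E-𝟎 u))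

  E-𝟏 : ∀ {n} (u : Vertex n) → E 𝟏 u ≈ ε (ω u)
  E-𝟏 []       = refl
  E-𝟏 (0ℙ ∷ u) = trans (E-cons 1ℙ 0ℙ 𝟏 u) (trans (*-identityˡ _) (E-𝟏 u))
  E-𝟏 (1ℙ ∷ u) = trans (E-cons 1ℙ 1ℙ 𝟏 u) (trans (*-congˡ (E-𝟏 u))
    (solve 1 (λ x → :- :1 :* x := :- x) refl (ε (ω u))))

  ω≤n : ∀ {n} (u : Vertex n) → ω u ℕ.≤ n
  ω≤n = Vec.count≤n (Parity._≟ 1ℙ)

  -- A vertex of each weight k ≤ n, used to pass from identities at vertices to identities at
  -- weights.
  leadingOnes : ∀ n → ℕ → Vertex n
  leadingOnes zero    k       = []
  leadingOnes (suc n) zero    = 0ℙ ∷ leadingOnes n zero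
  leadingOnes (suc n) (suc k) = 1ℙ ∷ leadingOnes n k

  ω-leadingOnes : ∀ n {k} → k ℕ.≤ n → ω (leadingOnes n k) ≡ k
  ω-leadingOnes zero    {zero}  k≤n       = ≡.refl
  ω-leadingOnes (suc n) {zero}  k≤n       = ω-leadingOnes n z≤n
  ω-leadingOnes (suc n) {suc k} (s≤s k≤n) = ≡.cong suc (ω-leadingOnes n k≤n)

  ω-𝟎 : ∀ n → ω (𝟎 {n}) ≡ 0
  ω-𝟎 zero    = ≡.refl
  ω-𝟎 (suc n) = ω-𝟎 n

  ω-𝟏 : ∀ n → ω (𝟏 {n}) ≡ n
  ω-𝟏 zero    = ≡.refl
  ω-𝟏 (suc n) = ≡.cong suc (ω-𝟏 n)

  ω≡0⇒𝟎 : ∀ {n} (u : Vertex n) → ω u ≡ 0 → u ≡ 𝟎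
  ω≡0⇒𝟎 []       eq = ≡.refl
  ω≡0⇒𝟎 (0ℙ ∷ u) eq = ≡.cong (0ℙ ∷_) (ω≡0⇒𝟎 u eq)

  ω≡n⇒𝟏 : ∀ {n} (u : Vertex n) → ω u ≡ n → u ≡ 𝟏
  ω≡n⇒𝟏 []       eq = ≡.refl
  ω≡n⇒𝟏 (0ℙ ∷ u) eq = ⊥-elim (ℕ.<-irrefl eq (s≤s (ω≤n u)))
  ω≡n⇒𝟏 (1ℙ ∷ u) eq = ≡.cong (1ℙ ∷_) (ω≡n⇒𝟏 u (ℕ.suc-injective eq))

  -- The Fourier transform

  infix 10 _^
  _^ : ∀ {n} → V n → V n
  (f ^) u = ∑ᵥ λ v → f v * E u v

  ^-cong : ∀ {n} {f g : V n} → f ≈ᴹ g → f ^ ≈ᴹ g ^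
  ^-cong f≈g u = ∑ᵥ-cong λ v → *-congʳ (f≈g v)

  ^-+ : ∀ {n} (f g : V n) → (f +ᴹ g) ^ ≈ᴹ f ^ +ᴹ g ^
  ^-+ f g u = trans (∑ᵥ-cong λ v → distribʳ (E u v) (f v) (g v)) (∑ᵥ-+ (λ v → f v * E u v) (λ v → g v * E u v))

  ^-* : ∀ {n} c (f : V n) → (c *ₗ f) ^ ≈ᴹ c *ₗ f ^
  ^-* c f u = trans (∑ᵥ-cong λ v → *-assoc c (f v) (E u v)) (∑ᵥ-* c (λ v → f v * E u v))

  ^-0 : ∀ {n} → (0ᴹ {n}) ^ ≈ᴹ 0ᴹ
  ^-0 u = ∑ᵥ-≈0 λ v → zeroˡ (E u v)

  ^-neg : ∀ {n} (f : V n) → (-ᴹ f) ^ ≈ᴹ -ᴹ f ^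
  ^-neg f u = begin
    ((-ᴹ f) ^) u         ≈⟨ ^-cong (λ v → solve 1 (λ x → :- x := :- :1 :* x) refl (f v)) u ⟩
    ((- 1# *ₗ f) ^) u    ≈⟨ ^-* (- 1#) f u ⟩
    - 1# * (f ^) u       ≈⟨ solve 1 (λ x → :- :1 :* x := :- x) refl _ ⟩
    - (f ^) u            ∎

  -- One step of the fast Walsh-Hadamard transform; inversion and the diagonalisation of N are
  -- inductions along it.
  ^-cons : ∀ {n} (f : V (suc n)) a u →
           (f ^) (a ∷ u) ≈ ((f ∘ (0ℙ ∷_)) ^) u + sign a * ((f ∘ (1ℙ ∷_)) ^) u
  ^-cons f a u = +-cong
    (∑ᵥ-cong λ v → *-congˡ (trans (E-cons a 0ℙ u v)
      (trans (*-congʳ (reflexive (≡.cong sign (Parity.*-comm a 0ℙ)))) (*-identityˡ _))))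
    (trans (∑ᵥ-cong λ v → trans (*-congˡ (trans (E-cons a 1ℙ u v)
        (*-congʳ (reflexive (≡.cong sign (Parity.*-identityʳ a))))))
        (solve 3 (λ x s e → x :* (s :* e) := s :* (x :* e)) refl (f (1ℙ ∷ v)) (sign a) (E u v)))
      (∑ᵥ-* (sign a) (λ v → f (1ℙ ∷ v) * E u v)))

  2^_ : ℕ → Carrier
  2^ zero  = 1#
  2^ suc n = 2^ n + 2^ n

  2^-pos : ∀ n → 0# < 2^ n
  2^-pos zero    = 0<1
  2^-pos (suc n) = +-pos (2^-pos n) (2^-pos n)

  2^≉0 : ∀ n → ¬ 2^ n ≈ 0#
  2^≉0 n = >⇒≉ (2^-pos n)

  ^-involutive : ∀ {n} (f : V n) u → ((f ^) ^) u ≈ 2^ n * f u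
  ^-involutive f []      = trans (*-identityʳ _) (*-comm (f []) 1#)
  ^-involutive {suc n} f (b ∷ u) = begin
    ((f ^) ^) (b ∷ u)
      ≈⟨ ^-cons (f ^) b u ⟩
    (((f ^) ∘ (0ℙ ∷_)) ^) u + sign b * (((f ^) ∘ (1ℙ ∷_)) ^) u
      ≈⟨ +-cong (part 0ℙ) (*-congˡ (part 1ℙ)) ⟩
    (2^ n * f₀ u + 1# * (2^ n * f₁ u)) + sign b * (2^ n * f₀ u + - 1# * (2^ n * f₁ u))
      ≈⟨ last b ⟩
    2^ (suc n) * f (b ∷ u)  ∎
    where
    f₀ f₁ : V n
    f₀ = f ∘ (0ℙ ∷_)
    f₁ = f ∘ (1ℙ ∷_)
    part : ∀ a → (((f ^) ∘ (a ∷_)) ^) u ≈ 2^ n * f₀ u + sign a * (2^ n * f₁ u)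
    part a = begin
      (((f ^) ∘ (a ∷_)) ^) u                       ≈⟨ ^-cong (^-cons f a) u ⟩
      ((f₀ ^ +ᴹ (sign a *ₗ f₁ ^)) ^) u             ≈⟨ ^-+ (f₀ ^) (sign a *ₗ f₁ ^) u ⟩
      ((f₀ ^) ^) u + ((sign a *ₗ f₁ ^) ^) u        ≈⟨ +-cong (^-involutive f₀ u)
                                                     (trans (^-* (sign a) (f₁ ^) u) (*-congˡ (^-involutive f₁ u))) ⟩
      2^ n * f₀ u + sign a * (2^ n * f₁ u)         ∎
    last : ∀ b → (2^ n * f₀ u + 1# * (2^ n * f₁ u)) + sign b * (2^ n * f₀ u + - 1# * (2^ n * f₁ u))
                 ≈ 2^ (suc n) * f (b ∷ u)
    last 0ℙ = solve 3 (λ t x y → (t :* x :+ :1 :* (t :* y)) :+ :1 :* (t :* x :+ :- :1 :* (t :* y))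
      := (t :+ t) :* x) refl (2^ n) (f₀ u) (f₁ u)
    last 1ℙ = solve 3 (λ t x y → (t :* x :+ :1 :* (t :* y)) :+ :- :1 :* (t :* x :+ :- :1 :* (t :* y))
      := (t :+ t) :* y) refl (2^ n) (f₀ u) (f₁ u)

  ^-injective : ∀ {n} (f g : V n) → f ^ ≈ᴹ g ^ → f ≈ᴹ g
  ^-injective {n} f g f^≈g^ u = *-cancelˡ (2^≉0 n)
    (trans (sym (^-involutive f u)) (trans (^-cong f^≈g^ u) (^-involutive g u)))

  E^-diagonal : ∀ {n} (u : Vertex n) → (E u ^) u ≈ 2^ n
  E^-off-diagonal : ∀ {n} (u v : Vertex n) → u ≢ v → (E u ^) v ≈ 0#

  private
    E^-cons : ∀ {n} a b (u v : Vertex n) →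
      (E (a ∷ u) ^) (b ∷ v) ≈ (E u ^) v + (sign a * sign b) * (E u ^) v
    E^-cons a b u v = begin
      (E (a ∷ u) ^) (b ∷ v)
        ≈⟨ ^-cons (E (a ∷ u)) b v ⟩
      ((E (a ∷ u) ∘ (0ℙ ∷_)) ^) v + sign b * ((E (a ∷ u) ∘ (1ℙ ∷_)) ^) v
        ≈⟨ +-cong
             (^-cong (λ w → trans (E-cons a 0ℙ u w)
               (trans (*-congʳ (reflexive (≡.cong sign (Parity.*-comm a 0ℙ)))) (*-identityˡ _))) v)
             (*-congˡ (trans (^-cong (λ w → trans (E-cons a 1ℙ u w)
               (*-congʳ (reflexive (≡.cong sign (Parity.*-identityʳ a))))) v) (^-* (sign a) (E u) v))) ⟩
      (E u ^) v + sign b * (sign a * (E u ^) v)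
        ≈⟨ solve 3 (λ x a b → x :+ b :* (a :* x) := x :+ (a :* b) :* x) refl _ (sign a) (sign b) ⟩
      (E u ^) v + (sign a * sign b) * (E u ^) v  ∎

    sign-square : ∀ a → sign a * sign a ≈ 1#
    sign-square 0ℙ = *-identityˡ 1#
    sign-square 1ℙ = solve 0 (:- :1 :* :- :1 := :1) refl

    sign-distinct : ∀ a b → a ≢ b → sign a * sign b ≈ - 1#
    sign-distinct 0ℙ 0ℙ a≢b = ⊥-elim (a≢b ≡.refl)
    sign-distinct 0ℙ 1ℙ a≢b = *-identityˡ _
    sign-distinct 1ℙ 0ℙ a≢b = *-identityʳ _
    sign-distinct 1ℙ 1ℙ a≢b = ⊥-elim (a≢b ≡.refl)

  E^-diagonal []      = *-identityˡ 1#
  E^-diagonal {suc n} (a ∷ u) = begin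
    (E (a ∷ u) ^) (a ∷ u)                            ≈⟨ E^-cons a a u u ⟩
    (E u ^) u + (sign a * sign a) * (E u ^) u        ≈⟨ +-congˡ (*-congʳ (sign-square a)) ⟩
    (E u ^) u + 1# * (E u ^) u                       ≈⟨ +-cong (E^-diagonal u) (trans (*-identityˡ _) (E^-diagonal u)) ⟩
    2^ n + 2^ n                                      ∎

  E^-off-diagonal []      []      u≢v = ⊥-elim (u≢v ≡.refl)
  E^-off-diagonal (a ∷ u) (b ∷ v) u≢v with a Parity.≟ b
  ... | yes ≡.refl = trans (E^-cons a b u v)
    (trans (+-cong u^v≈0 (*-congˡ u^v≈0)) (trans (+-identityˡ _) (zeroʳ _)))
    where u^v≈0 = E^-off-diagonal u v (u≢v ∘ ≡.cong (a ∷_))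
  ... | no a≢b = trans (E^-cons a b u v) (trans (+-congˡ (*-congʳ (sign-distinct a b a≢b)))
    (solve 1 (λ x → x :+ :- :1 :* x := :0) refl ((E u ^) v)))

  -- The adjacency operator of the hypercube

  N : ∀ {n} → V n → V n
  N = A Q?

  private
    evaluation : ∀ {n} (f : V n) w →
      ∑ᵥ (λ u → f u * (if does (hamming u w ℕ.≟ 0) then 1# else 0#)) ≈ f w
    evaluation f []       = *-identityʳ _
    evaluation f (0ℙ ∷ w) = trans (+-cong (evaluation (f ∘ (0ℙ ∷_)) w) (∑ᵥ-≈0 λ u → zeroʳ (f (1ℙ ∷ u)))) (+-identityʳ _)
    evaluation f (1ℙ ∷ w) = trans (+-cong (∑ᵥ-≈0 λ u → zeroʳ (f (0ℙ ∷ u))) (evaluation (f ∘ (1ℙ ∷_)) w)) (+-identityˡ _)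

  -- A neighbour with another first digit agrees in all the remaining ones, so the opposite half
  -- contributes a single value.
  N-0∷ : ∀ {n} (f : V (suc n)) w → N f (0ℙ ∷ w) ≈ N (f ∘ (0ℙ ∷_)) w + f (1ℙ ∷ w)
  N-0∷ f w = +-congˡ (evaluation (f ∘ (1ℙ ∷_)) w)

  N-1∷ : ∀ {n} (f : V (suc n)) w → N f (1ℙ ∷ w) ≈ N (f ∘ (1ℙ ∷_)) w + f (0ℙ ∷ w)
  N-1∷ f w = trans (+-congʳ (evaluation (f ∘ (0ℙ ∷_)) w)) (+-comm _ _)

  κ-def : ∀ n k → κ n k ≈ ⟦ n ⟧ - (⟦ k ⟧ + ⟦ k ⟧)
  κ-def n k = +-congˡ (-‿cong (trans (⟦+⟧ k (k ℕ.+ 0)) (+-congˡ (reflexive (≡.cong ⟦_⟧ (ℕ.+-identityʳ k))))))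

  -- Exchanging the two halves acts on f₀ + f₁ as 1 and on f₀ - f₁ as -1, so a digit 0 of u raises
  -- the eigenvalue by 1 and a digit 1 lowers it by 1.
  ^-N : ∀ {n} (f : V n) u → (N f ^) u ≈ κ n (ω u) * (f ^) u
  ^-N f [] = trans (trans (*-congʳ (zeroʳ _)) (zeroˡ _))
    (sym (trans (*-congʳ (-‿inverseʳ 0#)) (zeroˡ _)))
  ^-N {suc n} f (a ∷ u) = begin
    (N f ^) (a ∷ u)
      ≈⟨ ^-cons (N f) a u ⟩
    ((N f ∘ (0ℙ ∷_)) ^) u + sign a * ((N f ∘ (1ℙ ∷_)) ^) u
      ≈⟨ +-cong (half (N-0∷ f)) (*-congˡ (half (N-1∷ f))) ⟩
    (k * (f₀ ^) u + (f₁ ^) u) + sign a * (k * (f₁ ^) u + (f₀ ^) u)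
      ≈⟨ last a ⟩
    κ (suc n) (ω (a ∷ u)) * ((f₀ ^) u + sign a * (f₁ ^) u)
      ≈⟨ *-congˡ (^-cons f a u) ⟨
    κ (suc n) (ω (a ∷ u)) * (f ^) (a ∷ u)  ∎
    where
    f₀ f₁ : V n
    f₀ = f ∘ (0ℙ ∷_)
    f₁ = f ∘ (1ℙ ∷_)
    k = κ n (ω u)
    half : ∀ {g h k : V n} → g ≈ᴹ N h +ᴹ k → (g ^) u ≈ κ n (ω u) * (h ^) u + (k ^) u
    half {h = h} {k} g≈ = trans (^-cong g≈ u) (trans (^-+ (N h) k u) (+-congʳ (^-N h u)))
    last : ∀ a → (k * (f₀ ^) u + (f₁ ^) u) + sign a * (k * (f₁ ^) u + (f₀ ^) u)
                 ≈ κ (suc n) (ω (a ∷ u)) * ((f₀ ^) u + sign a * (f₁ ^) u)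
    last 0ℙ = solve 4 (λ n w x y →
      ((n :- w) :* x :+ y) :+ :1 :* ((n :- w) :* y :+ x)
      := ((:1 :+ n) :- w) :* (x :+ :1 :* y)) refl ⟦ n ⟧ ⟦ 2 ℕ.* ω u ⟧ ((f₀ ^) u) ((f₁ ^) u)
    last 1ℙ = trans (+-cong (+-congʳ (*-congʳ (κ-def n (ω u)))) (*-congˡ (+-congʳ (*-congʳ (κ-def n (ω u))))))
      (trans (solve 4 (λ n w x y →
        ((n :- (w :+ w)) :* x :+ y) :+ :- :1 :* ((n :- (w :+ w)) :* y :+ x)
        := ((:1 :+ n) :- ((:1 :+ w) :+ (:1 :+ w))) :* (x :+ :- :1 :* y))
        refl ⟦ n ⟧ ⟦ ω u ⟧ ((f₀ ^) u) ((f₁ ^) u))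
      (*-congʳ (sym (κ-def (suc n) (suc (ω u))))))

  -- The transform of `E u` is concentrated at u, where the multiplier of N is the constant
  -- `κ n (ω u)`.
  E-eigenvector : ∀ {n} (u : Vertex n) → N (E u) ≈ᴹ κ n (ω u) *ₗ E u
  E-eigenvector {n} u = ^-injective _ _ λ v → begin
    (N (E u) ^) v                    ≈⟨ ^-N (E u) v ⟩
    κ n (ω v) * (E u ^) v            ≈⟨ same v ⟩
    κ n (ω u) * (E u ^) v            ≈⟨ ^-* (κ n (ω u)) (E u) v ⟨
    ((κ n (ω u) *ₗ E u) ^) v         ∎
    where
    same : ∀ v → κ n (ω v) * (E u ^) v ≈ κ n (ω u) * (E u ^) v
    same v with u ≟ᵥ v
    ... | yes ≡.refl = refl
    ... | no u≢v     = trans (*-congˡ u^v≈0) (trans (zeroʳ _) (sym (trans (*-congˡ u^v≈0) (zeroʳ _))))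
      where u^v≈0 = E^-off-diagonal u v u≢v

  N-cong : ∀ {n} {f g : V n} → f ≈ᴹ g → N f ≈ᴹ N g
  N-cong f≈g w = ∑ᵥ-cong λ u → *-congʳ (f≈g u)

  module _ {n} {G : Pred (Vertex n) 0ℓ} (G? : ∀ u → Dec (G u)) {f : V n}
           (supported : ∀ u → ¬ G u → f u ≈ 0#) where

    -- The neighbours that the induced subgraph lacks carry the value 0.
    A-inside : ∀ w → G w → A G? f w ≈ N f w
    A-inside w Gw = ∑ᵥ-cong pointwise
      where
      pointwise : ∀ u → f u * adjacency G? u w ≈ f u * adjacency Q? u w
      pointwise u with G? u | G? w
      ... | yes _  | yes _  = refl
      ... | _      | no ¬Gw = ⊥-elim (¬Gw Gw)
      ... | no ¬Gu | yes _  = trans (*-congʳ (supported u ¬Gu))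
        (trans (zeroˡ _) (sym (trans (*-congʳ (supported u ¬Gu)) (zeroˡ _))))

  A-outside : ∀ {n} {G : Pred (Vertex n) 0ℓ} (G? : ∀ u → Dec (G u)) (f : V n) w → ¬ G w → A G? f w ≈ 0#
  A-outside G? f w ¬Gw = ∑ᵥ-≈0 pointwise
    where
    pointwise : ∀ u → f u * adjacency G? u w ≈ 0#
    pointwise u with G? u | G? w
    ... | _     | yes Gw = ⊥-elim (¬Gw Gw)
    ... | yes _ | no _   = zeroʳ _
    ... | no _  | no _   = zeroʳ _

  -- Some Fourier coefficient of the eigenvector is nonzero; N multiplies it by `κ n (ω u)` on the
  -- one hand and by μ on the other.
  eigenvalue⇒κ : ∀ {n} μ → IsEigenvalue (Q? {n}) μ → ∃ λ k → k ℕ.≤ n × μ ≈ κ n k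
  eigenvalue⇒κ {n} μ (f , f≉0 , Nf≈μf) with zero-or-support (f ^)
  ... | inj₁ f^≈0 = ⊥-elim (f≉0 (^-injective f 0ᴹ λ u → trans (f^≈0 u) (sym (^-0 u))))
  ... | inj₂ (u , f^u≉0) = ω u , ω≤n u , *-cancelˡ f^u≉0 (begin
    (f ^) u * μ             ≈⟨ *-comm _ _ ⟩
    μ * (f ^) u             ≈⟨ ^-* μ f u ⟨
    ((μ *ₗ f) ^) u          ≈⟨ ^-cong Nf≈μf u ⟨
    (N f ^) u               ≈⟨ ^-N f u ⟩
    κ n (ω u) * (f ^) u     ≈⟨ *-comm _ _ ⟩
    (f ^) u * κ n (ω u)     ∎)

  κ⇒eigenvalue : ∀ {n} μ → (∃ λ k → k ℕ.≤ n × μ ≈ κ n k) → IsEigenvalue (Q? {n}) μ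
  κ⇒eigenvalue {n} μ (k , k≤n , μ≈κ) =
    E u , (λ E≈0 → 1≉0 (trans (sym (trans (E-sym u 𝟎) (E-𝟎 u))) (E≈0 𝟎))) ,
    λ v → trans (E-eigenvector u v) (*-congʳ (trans (reflexive (≡.cong (κ n) (ω-leadingOnes n k≤n))) (sym μ≈κ)))
    where u = leadingOnes n k

  -- Vectors depending only on the Hamming weight

  Radial : ∀ {n} → V n → Set ℓ
  Radial f = ∃ λ (φ : ℕ → Carrier) → ∀ u → f u ≈ φ (ω u)

  radial⇒invariant : ∀ {n} {f : V n} → Radial f → ∀ σ → act σ f ≈ᴹ f
  radial⇒invariant (φ , f≈) σ u = trans (f≈ _)
    (trans (reflexive (≡.cong φ (count-permute _ (Perm.flip σ) u))) (sym (f≈ u)))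

  -- A vertex has ω w neighbours of the next lower weight and n - ω w of the next higher. At weight
  -- 0 the truncated `ω w ∸ 1` comes with the coefficient 0.
  N-radial : ∀ {n} (φ : ℕ → Carrier) (w : Vertex n) →
    N (φ ∘ ω) w ≈ ⟦ ω w ⟧ * φ (ω w ∸ 1) + ⟦ n ∸ ω w ⟧ * φ (suc (ω w))
  N-radial φ [] = trans (zeroʳ _) (sym (trans (+-cong (zeroˡ _) (zeroˡ _)) (+-identityˡ 0#)))
  N-radial {suc n} φ (0ℙ ∷ w) = begin
    N (φ ∘ ω) (0ℙ ∷ w)
      ≈⟨ N-0∷ (φ ∘ ω) w ⟩
    N (φ ∘ ω) w + φ (suc (ω w))
      ≈⟨ +-congʳ (N-radial φ w) ⟩
    (⟦ ω w ⟧ * φ (ω w ∸ 1) + ⟦ n ∸ ω w ⟧ * φ (suc (ω w))) + φ (suc (ω w))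
      ≈⟨ solve 3 (λ x m y → (x :+ m :* y) :+ y := x :+ (:1 :+ m) :* y) refl _ _ _ ⟩
    ⟦ ω w ⟧ * φ (ω w ∸ 1) + ⟦ suc (n ∸ ω w) ⟧ * φ (suc (ω w))
      ≡⟨ ≡.cong (λ m → ⟦ ω w ⟧ * φ (ω w ∸ 1) + ⟦ m ⟧ * φ (suc (ω w))) (ℕ.+-∸-assoc 1 (ω≤n w)) ⟨
    ⟦ ω w ⟧ * φ (ω w ∸ 1) + ⟦ suc n ∸ ω w ⟧ * φ (suc (ω w))  ∎
  N-radial {suc n} φ (1ℙ ∷ w) = begin
    N (φ ∘ ω) (1ℙ ∷ w)
      ≈⟨ N-1∷ (φ ∘ ω) w ⟩
    N (φ ∘ suc ∘ ω) w + φ (ω w)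
      ≈⟨ +-congʳ (N-radial (φ ∘ suc) w) ⟩
    (⟦ ω w ⟧ * φ (suc (ω w ∸ 1)) + ⟦ n ∸ ω w ⟧ * φ (suc (suc (ω w)))) + φ (ω w)
      ≈⟨ +-congʳ (+-congʳ (predecessor (ω w))) ⟩
    (⟦ ω w ⟧ * φ (ω w) + ⟦ n ∸ ω w ⟧ * φ (suc (suc (ω w)))) + φ (ω w)
      ≈⟨ solve 3 (λ m x y → (m :* x :+ y) :+ x := (:1 :+ m) :* x :+ y) refl _ _ _ ⟩
    ⟦ suc (ω w) ⟧ * φ (ω w) + ⟦ n ∸ ω w ⟧ * φ (suc (suc (ω w)))  ∎
    where
    predecessor : ∀ k → ⟦ k ⟧ * φ (suc (k ∸ 1)) ≈ ⟦ k ⟧ * φ k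
    predecessor zero    = trans (zeroˡ _) (sym (zeroˡ _))
    predecessor (suc k) = refl

  -- The coefficient of index 0 of (1 - S)ᵃ(1 + S)ᵇ φ, with S the shift.
  krawtchouk : ℕ → ℕ → (ℕ → Carrier) → Carrier
  krawtchouk zero    zero    φ = φ 0
  krawtchouk zero    (suc b) φ = krawtchouk zero b λ i → φ i + φ (suc i)
  krawtchouk (suc a) b       φ = krawtchouk a b λ i → φ i + - 1# * φ (suc i)

  krawtchouk-cong : ∀ a b {φ ψ} → (∀ i → φ i ≈ ψ i) → krawtchouk a b φ ≈ krawtchouk a b ψ
  krawtchouk-cong zero    zero    φ≈ψ = φ≈ψ 0
  krawtchouk-cong zero    (suc b) φ≈ψ = krawtchouk-cong zero b λ i → +-cong (φ≈ψ i) (φ≈ψ (suc i))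
  krawtchouk-cong (suc a) b       φ≈ψ = krawtchouk-cong a b λ i → +-cong (φ≈ψ i) (*-congˡ (φ≈ψ (suc i)))

  -- The operators 1 + S and 1 - S commute.
  krawtchouk-sucʳ : ∀ a b φ → krawtchouk a (suc b) φ ≈ krawtchouk a b λ i → φ i + φ (suc i)
  krawtchouk-sucʳ zero    b φ = refl
  krawtchouk-sucʳ (suc a) b φ = trans (krawtchouk-sucʳ a b _) (krawtchouk-cong a b λ i →
    solve 3 (λ x y z → (x :+ :- :1 :* y) :+ (y :+ :- :1 :* z)
      := (x :+ y) :+ :- :1 :* (y :+ z)) refl _ _ _)

  -- A digit 0 of u contributes the factor 1 + S and a digit 1 the factor 1 - S, so only the number
  -- of each is left.
  ^-krawtchouk : ∀ {n} φ (u : Vertex n) → ((φ ∘ ω) ^) u ≈ krawtchouk (ω u) (n ∸ ω u) φ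
  ^-krawtchouk φ []      = *-identityʳ _
  ^-krawtchouk {suc n} φ (a ∷ u) = trans (^-cons (φ ∘ ω) a u)
    (trans (trans (+-congˡ (sym (^-* (sign a) (φ ∘ suc ∘ ω) u))) (sym (^-+ (φ ∘ ω) (sign a *ₗ (φ ∘ suc ∘ ω)) u)))
    (trans (^-krawtchouk (λ i → φ i + sign a * φ (suc i)) u) (last a)))
    where
    last : ∀ a → krawtchouk (ω u) (n ∸ ω u) (λ i → φ i + sign a * φ (suc i))
                 ≈ krawtchouk (ω (a ∷ u)) (suc n ∸ ω (a ∷ u)) φ
    last 0ℙ = begin
      krawtchouk (ω u) (n ∸ ω u) (λ i → φ i + 1# * φ (suc i))
        ≈⟨ krawtchouk-cong (ω u) (n ∸ ω u) (λ i → +-congˡ (*-identityˡ _)) ⟩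
      krawtchouk (ω u) (n ∸ ω u) (λ i → φ i + φ (suc i))
        ≈⟨ krawtchouk-sucʳ (ω u) (n ∸ ω u) φ ⟨
      krawtchouk (ω u) (suc (n ∸ ω u)) φ
        ≡⟨ ≡.cong (λ b → krawtchouk (ω u) b φ) (ℕ.+-∸-assoc 1 (ω≤n u)) ⟨
      krawtchouk (ω u) (suc n ∸ ω u) φ  ∎
    last 1ℙ = refl

  ^-radial : ∀ {n} {f : V n} → Radial f → Radial (f ^)
  ^-radial {n} (φ , f≈) = (λ k → krawtchouk k (n ∸ k) φ) , λ u → trans (^-cong f≈ u) (^-krawtchouk φ u)

  -- By inversion f is, up to the factor 2ⁿ, the transform of a radial vector.
  ^-radial⁻¹ : ∀ {n} (f : V n) → Radial (f ^) → Radial f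
  ^-radial⁻¹ {n} f f^-radial = let ψ , f^^≈ = ^-radial f^-radial in
    (λ k → (2^ n) ⁻¹ * ψ k) , λ u → begin
      f u                           ≈⟨ *-identityˡ _ ⟨
      1# * f u                      ≈⟨ *-congʳ (⁻¹-inverseʳ (2^≉0 n)) ⟨
      (2^ n * (2^ n) ⁻¹) * f u      ≈⟨ solve 3 (λ t i x → (t :* i) :* x := i :* (t :* x)) refl _ _ _ ⟩
      (2^ n) ⁻¹ * (2^ n * f u)      ≈⟨ *-congˡ (trans (sym (^-involutive f u)) (f^^≈ u)) ⟩
      (2^ n) ⁻¹ * ψ (ω u)           ∎

  e-value : ∀ {n} k (u : Vertex n) → ω u ≡ k → e k u ≈ 1#
  e-value k u ωu≡k rewrite dec-true (ω u ℕ.≟ k) ωu≡k = refl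

  e-elsewhere : ∀ {n} k (u : Vertex n) → ω u ≢ k → e k u ≈ 0#
  e-elsewhere k u ωu≢k rewrite dec-false (ω u ℕ.≟ k) ωu≢k = refl

  e-weighted : ∀ {n} k (u : Vertex n) (φ : ℕ → Carrier) → e k u * φ (ω u) ≈ e k u * φ k
  e-weighted k u φ with ω u ℕ.≟ k
  ... | yes ≡.refl = refl
  ... | no ωu≢k    = trans (annihilate (φ (ω u))) (sym (annihilate (φ k)))
    where
    annihilate : ∀ c → e k u * c ≈ 0#
    annihilate c = trans (*-congʳ (e-elsewhere k u ωu≢k)) (zeroˡ c)

  -- The binomial coefficient C(n,k), later a divisor.
  levelSize : ∀ n → ℕ → Carrier
  levelSize n k = ∑ᵥ {n} (e k)

  levelSize-pos : ∀ {n k} → k ℕ.≤ n → 0# < levelSize n k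
  levelSize-pos {n} {k} k≤n = ∑ᵥ-pos nonneg u (<-respʳ-≈ (sym (e-value k u (ω-leadingOnes n k≤n))) 0<1)
    where
    u = leadingOnes n k
    nonneg : ∀ u → 0# ≤ e k u
    nonneg u with does (ω u ℕ.≟ k)
    ... | true  = inj₁ 0<1
    ... | false = ≤-refl

  levelSize≉0 : ∀ {n k} → k ℕ.≤ n → ¬ levelSize n k ≈ 0#
  levelSize≉0 k≤n = >⇒≉ (levelSize-pos k≤n)

  e-radial : ∀ {n} k → Radial {n} (e k)
  e-radial k = (λ j → if does (j ℕ.≟ k) then 1# else 0#) , λ u → refl

  -- The transform of `e k` is the sum of the `E v` with ω(v) = k, a radial eigenvector whose values
  -- are those of a Krawtchouk polynomial.
  e^-eigenvector : ∀ {n} k → N {n} (e k ^) ≈ᴹ κ n k *ₗ e k ^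
  e^-eigenvector {n} k = ^-injective _ _ λ u → begin
    (N (e k ^) ^) u                    ≈⟨ ^-N (e k ^) u ⟩
    κ n (ω u) * ((e k ^) ^) u          ≈⟨ *-congˡ (^-involutive (e k) u) ⟩
    κ n (ω u) * (2^ n * e k u)         ≈⟨ solve 3 (λ a b c → a :* (b :* c) := b :* (c :* a)) refl _ _ _ ⟩
    2^ n * (e k u * κ n (ω u))         ≈⟨ *-congˡ (e-weighted k u (κ n)) ⟩
    2^ n * (e k u * κ n k)             ≈⟨ solve 3 (λ a b c → b :* (c :* a) := a :* (b :* c)) refl _ _ _ ⟩
    κ n k * (2^ n * e k u)             ≈⟨ *-congˡ (^-involutive (e k) u) ⟨
    κ n k * ((e k ^) ^) u              ≈⟨ ^-* (κ n k) (e k ^) u ⟨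
    ((κ n k *ₗ e k ^) ^) u             ∎

  ∑ᵥ-*ʳ : ∀ {n} (f : V n) c → ∑ᵥ (λ u → f u * c) ≈ ∑ᵥ f * c
  ∑ᵥ-*ʳ f c = trans (∑ᵥ-cong λ u → *-comm (f u) c) (trans (∑ᵥ-* c f) (*-comm c _))

  ^-𝟎 : ∀ {n} (f : V n) → (f ^) 𝟎 ≈ ∑ᵥ f
  ^-𝟎 {n} f = ∑ᵥ-cong {n} λ v → trans (*-congˡ (E-𝟎 v)) (*-identityʳ (f v))

  ^-𝟏 : ∀ {n} (f : V n) → (f ^) 𝟏 ≈ ∑ᵥ λ v → f v * ε (ω v)
  ^-𝟏 {n} f = ∑ᵥ-cong {n} λ v → *-congˡ (E-𝟏 v)

  e^-𝟏 : ∀ n k → (e {n} k ^) 𝟏 ≈ levelSize n k * ε k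
  e^-𝟏 n k = trans (^-𝟏 (e {n} k)) (trans (∑ᵥ-cong {n} λ v → e-weighted k v ε) (∑ᵥ-*ʳ {n} (e k) (ε k)))

-- The tridiagonal matrices, their continuants, and the row equations of radial eigenvectors

module Spectrum {ℓ} (ℝ : RealNumbers ℓ) (n′ : ℕ) where
  open RealNumbers ℝ hiding (zero)
  open RingProperties ring
  open IntegerSolver commutativeRing
  open OrderedField ℝ
  open Spectra ℝ hiding (0#; _≈_)
  open Polynomials rawRing using (eval)
  open PolynomialProperties commutativeRing
  open HypercubeFourier ℝ
  open SetoidReasoning setoid

  n : ℕ
  n = suc n′

  private
    entry : ℕ → ℕ → Carrier
    entry i j =
      if does (j ℕ.≟ suc i) then ⟦ n ∸ i ⟧ else
      if does (i ℕ.≟ suc j) then ⟦ suc j ⟧ else 0#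

    entry-else : ∀ i j → j ≢ suc i → i ≢ suc j → entry i j ≈ 0#
    entry-else i j j≢1+i i≢1+j
      rewrite dec-false (j ℕ.≟ suc i) j≢1+i | dec-false (i ℕ.≟ suc j) i≢1+j = refl

    m<1+m+k : ∀ m k → m ℕ.< suc (m ℕ.+ k)
    m<1+m+k m k = s≤s (ℕ.m≤m+n m k)

  open TridiagonalMatrix entry
    (λ i → entry-else i i (ℕ.<⇒≢ ℕ.≤-refl) (ℕ.<⇒≢ ℕ.≤-refl))
    (λ i k → entry-else i (2 ℕ.+ (i ℕ.+ k)) (ℕ.>⇒≢ (s≤s (m<1+m+k i k)))
      (ℕ.<⇒≢ (ℕ.m≤n⇒m≤1+n (ℕ.m≤n⇒m≤1+n (m<1+m+k i k)))))
    (λ i k → entry-else (2 ℕ.+ (i ℕ.+ k)) i (ℕ.<⇒≢ (ℕ.m≤n⇒m≤1+n (ℕ.m≤n⇒m≤1+n (m<1+m+k i k))))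
      (ℕ.>⇒≢ (s≤s (m<1+m+k i k))))

  -- The product of the entries of K at (k, k + 1) and (k + 1, k).
  q : ℕ → Carrier
  q k = ⟦ n ∸ k ⟧ * ⟦ suc k ⟧

  private
    p≈q : ∀ k → p k ≈ q k
    p≈q k rewrite dec-true (suc k ℕ.≟ suc k) ≡.refl
                | dec-false (k ℕ.≟ suc (suc k)) (ℕ.<⇒≢ (ℕ.m≤n⇒m≤1+n ℕ.≤-refl)) = refl

    continuant-cong : ∀ {p q : ℕ → Carrier} → (∀ k → p k ≈ q k) →
                      ∀ x m o → continuant p x m o ≈ continuant q x m o
    continuant-cong p≈q x 0             o = refl
    continuant-cong p≈q x 1             o = refl
    continuant-cong p≈q x (suc (suc m)) o = +-cong (*-congˡ (continuant-cong p≈q x (suc m) (suc o)))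
      (-‿cong (*-cong (p≈q o) (continuant-cong p≈q x m (suc (suc o)))))

  D : Carrier → ℕ → ℕ → Carrier
  D = continuant q

  private
    K-entries : Entries 0 (K n)
    K-entries i j = ≡.refl

    L-entries : Entries 1 (L n)
    L-entries i j = ≡.refl

    M-entries : Entries 1 (M n)
    M-entries i j = ≡.cong₂ (λ i j → entry (suc i) (suc j)) (Fin.toℕ-inject₁ i) (Fin.toℕ-inject₁ j)

  eval-K : ∀ x → eval (charPoly (K n)) x ≈ D x (suc n) 0
  eval-K x = trans (eval-charPoly (suc n) 0 (K n) K-entries x) (continuant-cong p≈q x (suc n) 0)

  eval-L : ∀ x → eval (charPoly (L n)) x ≈ D x n 1
  eval-L x = trans (eval-charPoly n 1 (L n) L-entries x) (continuant-cong p≈q x n 1)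

  eval-M : ∀ x → eval (charPoly (M n)) x ≈ D x n′ 1
  eval-M x = trans (eval-charPoly n′ 1 (M n) M-entries x) (continuant-cong p≈q x n′ 1)

  K-monic : LeadingTerm (charPoly (K n)) (suc n) 1#
  K-monic = charPoly-monic (suc n) 0 (K n) K-entries

  L-monic : LeadingTerm (charPoly (L n)) n 1#
  L-monic = charPoly-monic n 1 (L n) L-entries

  M-monic : LeadingTerm (charPoly (M n)) n′ 1#
  M-monic = charPoly-monic n′ 1 (M n) M-entries

  D-neg : ∀ x m o → D (- x) m o ≈ ε m * D x m o
  D-neg x 0             o = sym (*-identityˡ 1#)
  D-neg x 1             o = solve 1 (λ x → :- x := :- :1 :* x) refl x
  D-neg x (suc (suc m)) o = trans
    (+-cong (*-congˡ (D-neg x (suc m) (suc o))) (-‿cong (*-congˡ (D-neg x m (suc (suc o))))))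
    (solve 5 (λ x e d₁ d₂ q → :- x :* (:- e :* d₁) :- q :* (e :* d₂) := :- :- e :* (x :* d₁ :- q :* d₂))
      refl x (ε m) _ _ (q o))

  D-cong : ∀ {x y} → x ≈ y → ∀ m o → D x m o ≈ D y m o
  D-cong x≈y 0             o = refl
  D-cong x≈y 1             o = x≈y
  D-cong x≈y (suc (suc m)) o =
    +-cong (*-cong x≈y (D-cong x≈y (suc m) (suc o))) (-‿cong (*-congˡ (D-cong x≈y m (suc (suc o)))))

  -- The m + 1 factors q o, ..., q (o + m), as many as a block of size m + 2 has pairs of
  -- off-diagonal entries.
  q-product : ℕ → ℕ → Carrier
  q-product zero    o = q o
  q-product (suc m) o = q o * q-product m (suc o)

  -- The Desnanot-Jacobi identity for a block of size m + 2: the two mixed corner minors are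
  -- triangular, and their product is the product of all q. The recurrence reduces it to the block
  -- beginning at o + 1, with a factor q o.
  D-determinant : ∀ x m o →
    D x (suc (suc m)) o * D x m (suc o) - D x (suc m) o * D x (suc m) (suc o) ≈ - q-product m o
  D-determinant x zero    o =
    solve 2 (λ x q → (x :* x :- q :* :1) :* :1 :- x :* x := :- q) refl x (q o)
  D-determinant x (suc m) o = begin
    (x * D x (suc (suc m)) (suc o) - q o * d₁) * d₂ - (x * d₂ - q o * d₃) * D x (suc (suc m)) (suc o)
      ≈⟨ solve 6 (λ x d₀ d₁ d₂ d₃ q → (x :* d₀ :- q :* d₁) :* d₂ :- (x :* d₂ :- q :* d₃) :* d₀
           := q :* (d₀ :* d₃ :- d₂ :* d₁)) refl x (D x (suc (suc m)) (suc o)) d₁ d₂ d₃ (q o) ⟩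
    q o * (D x (suc (suc m)) (suc o) * d₃ - d₂ * d₁)
      ≈⟨ *-congˡ (D-determinant x m (suc o)) ⟩
    q o * - q-product m (suc o)
      ≈⟨ -‿distribʳ-* _ _ ⟨
    - (q o * q-product m (suc o))  ∎
    where
    d₁ = D x (suc m) (suc (suc o))
    d₂ = D x (suc m) (suc o)
    d₃ = D x m (suc (suc o))

  q-product-pos : ∀ m o → m ℕ.+ o ℕ.< n → 0# < q-product m o
  q-product-pos zero    o o<n = *-pos (⟦⟧-mono-< (ℕ.m<n⇒0<n∸m o<n)) (⟦suc⟧-pos o)
  q-product-pos (suc m) o m+o<n = *-pos
    (*-pos (⟦⟧-mono-< (ℕ.m<n⇒0<n∸m (ℕ.≤-<-trans (ℕ.m≤n+m o (suc m)) m+o<n))) (⟦suc⟧-pos o))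
    (q-product-pos m (suc o) (≡.subst (ℕ._< n) (≡.sym (ℕ.+-suc m o)) m+o<n))

  -- Radial eigenvectors and continuants

  -- Row k of the equation K a = x a; for k = 0 the coefficient 0 removes the meaningless entry
  -- before the first.
  Row : Carrier → (ℕ → Carrier) → ℕ → Set ℓ
  Row x a k = ⟦ k ⟧ * a (k ∸ 1) + ⟦ n ∸ k ⟧ * a (suc k) ≈ x * a k

  row⇒eigen : ∀ {x a} (w : Vertex n) → Row x a (ω w) → N (a ∘ ω) w ≈ x * a (ω w)
  row⇒eigen {x} {a} w row = trans (N-radial a w) row

  eigen⇒row : ∀ {x} {f : V n} ((φ , _) : Radial f) w → N f w ≈ x * f w → Row x φ (ω w)
  eigen⇒row (φ , f≈) w eigen =
    trans (sym (N-radial φ w)) (trans (sym (N-cong f≈ w)) (trans eigen (*-congˡ (f≈ w))))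

  -- (k + 1) ⋯ (k + m)
  rising : ℕ → ℕ → Carrier
  rising zero    k = 1#
  rising (suc m) k = ⟦ suc k ⟧ * rising m (suc k)

  rising-pos : ∀ m k → 0# < rising m k
  rising-pos zero    k = 0<1
  rising-pos (suc m) k = *-pos (⟦suc⟧-pos k) (rising-pos m (suc k))

  -- Read from t downwards, the rows are the recurrence of the continuants, and the condition at t
  -- closes the last of them. The factor `rising m k` = (k + 1) ⋯ t collects the lower off-diagonal
  -- entries by which one would divide.
  rows⇒continuant : ∀ {x a t} → (∀ k → 1 ℕ.≤ k → k ℕ.≤ t → Row x a k) → ⟦ n ∸ t ⟧ * a (suc t) ≈ 0# →
                    ∀ m k → m ℕ.+ k ≡ t → a k * rising m k ≈ a t * D x m (suc k)
  rows⇒continuant rows top 0 k ≡.refl = refl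
  rows⇒continuant {x} {a} rows top 1 k ≡.refl = begin
    a k * (⟦ suc k ⟧ * 1#)
      ≈⟨ solve 2 (λ a s → a :* (s :* :1) := s :* a :+ :0) refl (a k) ⟦ suc k ⟧ ⟩
    ⟦ suc k ⟧ * a k + 0#
      ≈⟨ +-congˡ top ⟨
    ⟦ suc k ⟧ * a k + ⟦ n ∸ suc k ⟧ * a (suc (suc k))
      ≈⟨ rows (suc k) (s≤s z≤n) ℕ.≤-refl ⟩
    x * a (suc k)
      ≈⟨ *-comm _ _ ⟩
    a (suc k) * x  ∎
  rows⇒continuant {x} {a} {t} rows top (suc (suc m)) k eq = begin
    a k * (⟦ suc k ⟧ * (s * r))
      ≈⟨ solve 5 (λ a₀ k s r y → a₀ :* (k :* (s :* r)) := ((k :* a₀ :+ y) :- y) :* (s :* r)) refl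
           (a k) ⟦ suc k ⟧ s r (⟦ n ∸ suc k ⟧ * a (suc (suc k))) ⟩
    ((⟦ suc k ⟧ * a k + ⟦ n ∸ suc k ⟧ * a (suc (suc k))) - ⟦ n ∸ suc k ⟧ * a (suc (suc k))) * (s * r)
      ≈⟨ *-congʳ (+-congʳ (rows (suc k) (s≤s z≤n) 1+k≤t)) ⟩
    (x * a (suc k) - ⟦ n ∸ suc k ⟧ * a (suc (suc k))) * (s * r)
      ≈⟨ solve 6 (λ x a₁ c a₂ s r → (x :* a₁ :- c :* a₂) :* (s :* r) := x :* (a₁ :* (s :* r)) :- (c :* s) :* (a₂ :* r))
           refl x (a (suc k)) ⟦ n ∸ suc k ⟧ (a (suc (suc k))) s r ⟩
    x * (a (suc k) * (s * r)) - q (suc k) * (a (suc (suc k)) * r)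
      ≈⟨ +-cong (*-congˡ (rows⇒continuant {x} {a} rows top (suc m) (suc k) (≡.trans (ℕ.+-suc (suc m) k) eq)))
           (-‿cong (*-congˡ (rows⇒continuant {x} {a} rows top m (suc (suc k))
             (≡.trans (ℕ.+-suc m (suc k)) (≡.trans (≡.cong suc (ℕ.+-suc m k)) eq))))) ⟩
    x * (a t * d₁) - q (suc k) * (a t * d₂)
      ≈⟨ solve 5 (λ x a d₁ q d₂ → x :* (a :* d₁) :- q :* (a :* d₂) := a :* (x :* d₁ :- q :* d₂)) refl
           x (a t) d₁ (q (suc k)) d₂ ⟩
    a t * D x (suc (suc m)) (suc k)  ∎
    where
    s = ⟦ suc (suc k) ⟧
    r = rising m (suc (suc k))
    d₁ = D x (suc m) (suc (suc k))
    d₂ = D x m (suc (suc (suc k)))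
    1+k≤t : suc k ℕ.≤ t
    1+k≤t = ≡.subst (suc k ℕ.≤_) eq (s≤s (ℕ.m≤n+m k (suc m)))

  factorial : ℕ → Carrier
  factorial zero    = 1#
  factorial (suc k) = ⟦ suc k ⟧ * factorial k

  factorial-pos : ∀ k → 0# < factorial k
  factorial-pos zero    = 0<1
  factorial-pos (suc k) = *-pos (⟦suc⟧-pos k) (factorial-pos k)

  private
    -- trailing x (m + 1) k = D x m (k + 1), extended by 0 so that the
    -- recurrence also holds at its end.
    trailing : Carrier → ℕ → ℕ → Carrier
    trailing x zero    k = 0#
    trailing x (suc m) k = D x m (suc k)

    trailing-step : ∀ x m k → trailing x (suc (suc m)) k + q (suc k) * trailing x m (suc (suc k)) ≈ x * trailing x (suc m) (suc k)
    trailing-step x zero    k = trans (+-congˡ (zeroʳ _)) (trans (+-identityʳ x) (sym (*-identityʳ x)))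
    trailing-step x (suc m) k =
      solve 4 (λ x d₁ q d₂ → (x :* d₁ :- q :* d₂) :+ q :* d₂ := x :* d₁) refl x _ (q (suc k)) _

  -- The solution of the rows 1, …, t that vanishes beyond t.
  solution : Carrier → ℕ → ℕ → Carrier
  solution x t k = factorial k * trailing x (suc t ∸ k) k

  solution-row : ∀ x t k → 1 ℕ.≤ k → k ℕ.≤ t → Row x (solution x t) k
  solution-row x t (suc k) _ k<t = begin
    ⟦ suc k ⟧ * (factorial k * trailing x (suc t ∸ k) k) + ⟦ n ∸ suc k ⟧ * (factorial (suc (suc k)) * trailing x (t ∸ suc k) (suc (suc k)))
      ≡⟨ ≡.cong (λ m → ⟦ suc k ⟧ * (factorial k * trailing x m k) +
           ⟦ n ∸ suc k ⟧ * (factorial (suc (suc k)) * trailing x (t ∸ suc k) (suc (suc k)))) first ⟩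
    ⟦ suc k ⟧ * (factorial k * trailing x (suc (suc m)) k) + ⟦ n ∸ suc k ⟧ * (factorial (suc (suc k)) * trailing x m (suc (suc k)))
      ≈⟨ solve 6 (λ s f d c s′ e → s :* (f :* d) :+ c :* ((s′ :* (s :* f)) :* e) := (s :* f) :* (d :+ (c :* s′) :* e))
           refl ⟦ suc k ⟧ (factorial k) (trailing x (suc (suc m)) k) ⟦ n ∸ suc k ⟧ ⟦ suc (suc k) ⟧ (trailing x m (suc (suc k))) ⟩
    factorial (suc k) * (D x (suc m) (suc k) + q (suc k) * trailing x m (suc (suc k)))
      ≈⟨ *-congˡ (trailing-step x m k) ⟩
    factorial (suc k) * (x * trailing x (suc m) (suc k))
      ≈⟨ solve 3 (λ f x d → f :* (x :* d) := x :* (f :* d)) refl _ _ _ ⟩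
    x * (factorial (suc k) * trailing x (suc m) (suc k))
      ≡⟨ ≡.cong (λ m → x * (factorial (suc k) * trailing x m (suc k))) second ⟨
    x * (factorial (suc k) * trailing x (t ∸ k) (suc k))  ∎
    where
    m = t ∸ suc k
    second : t ∸ k ≡ suc m
    second = ≡.sym (≡.trans (≡.sym (ℕ.+-∸-assoc 1 k<t)) ≡.refl)
    first : suc t ∸ k ≡ suc (suc m)
    first = ≡.trans (ℕ.+-∸-assoc 1 (ℕ.<⇒≤ k<t)) (≡.cong suc second)

  solution-first : ∀ x t → solution x t 0 ≈ D x t 1
  solution-first x t = *-identityˡ _

  solution-last : ∀ x t → solution x t t ≈ factorial t
  solution-last x t = trans (*-congˡ (reflexive (≡.cong (λ m → trailing x m t) 1+t∸t≡1))) (*-identityʳ _)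
    where
    1+t∸t≡1 : suc t ∸ t ≡ 1
    1+t∸t≡1 = ≡.trans (ℕ.+-∸-assoc 1 (ℕ.≤-refl {t})) (≡.cong suc (ℕ.n∸n≡0 t))

  solution-beyond : ∀ x t k → t ℕ.< k → solution x t k ≈ 0#
  solution-beyond x t k t<k =
    trans (*-congˡ (reflexive (≡.cong (λ m → trailing x m k) (ℕ.m≤n⇒m∸n≡0 t<k)))) (zeroʳ _)

-- Positivity of sums over the hypercube of functions of the weight

module WeightSums {ℓ} (ℝ : RealNumbers ℓ) where
  open RealNumbers ℝ hiding (zero)
  open RingProperties ring
  open IntegerSolver commutativeRing
  open OrderedField ℝ
  open Spectra ℝ hiding (0#; _≈_)
  open HypercubeFourier ℝ

  ε-+ : ∀ i j → ε (i ℕ.+ j) ≈ ε i * ε j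
  ε-+ zero    j = sym (*-identityˡ _)
  ε-+ (suc i) j = trans (-‿cong (ε-+ i j)) (-‿distribˡ-* _ _)

  ε≤1 : ∀ k → 0# ≤ 1# - ε k
  ε≤1 zero          = inj₂ (sym (-‿inverseʳ 1#))
  ε≤1 (suc zero)    = inj₁ (<-respʳ-≈ (+-congˡ (sym (-‿involutive 1#))) (+-pos 0<1 0<1))
  ε≤1 (suc (suc k)) = ≤-resp refl (+-congˡ (-‿cong (sym (-‿involutive _)))) (ε≤1 k)

  ∑ᵥ-reverse : ∀ n (h : ℕ → Carrier) → ∑ᵥ {n} (h ∘ ω) ≈ ∑ᵥ {n} (λ u → h (n ∸ ω u))
  ∑ᵥ-reverse zero    h = refl
  ∑ᵥ-reverse (suc n) h = trans (+-comm _ _) (+-cong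
    (trans (∑ᵥ-reverse n (h ∘ suc)) (∑ᵥ-cong {n} λ u → reflexive (≡.cong h (≡.sym (ℕ.+-∸-assoc 1 (ω≤n u))))))
    (∑ᵥ-reverse n h))

  -- Negative values occur only below j, and each is compensated by the value at its mirror image in
  -- j. The index i stands for j - d.
  record Dominated (j : ℕ) (h : ℕ → Carrier) : Set ℓ where
    field
      upper    : ∀ d → 0# ≤ h (j ℕ.+ d)
      balanced : ∀ i d → i ℕ.+ d ≡ j → 0# ≤ h (j ℕ.+ d) + h i
  open Dominated

  dominated-suc : ∀ {j h} → Dominated (suc j) h → Dominated j (h ∘ suc)
  dominated-suc dom .upper d          = dom .upper d
  dominated-suc dom .balanced i d i+d = dom .balanced (suc i) d (≡.cong suc i+d)

  dominated-zero : ∀ {h} → Dominated 0 h → Dominated 0 (h ∘ suc)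
  dominated-zero dom .upper d                = dom .upper (suc d)
  dominated-zero dom .balanced zero zero _   = +-nonneg (dom .upper 1) (dom .upper 1)

  -- For 2j ≤ n at least as many vertices have weight j + d as have weight j - d.
  weightSum-nonneg : ∀ n j {h} → j ℕ.+ j ℕ.≤ n → Dominated j h → 0# ≤ ∑ᵥ {n} (h ∘ ω)
  weightSum-nonneg zero    zero    2j≤n dom = dom .upper 0
  weightSum-nonneg (suc n) j {h}   2j≤n dom with ℕ.m≤n⇒m<n∨m≡n 2j≤n
  weightSum-nonneg (suc n) zero        2j≤n dom | inj₁ _ =
    +-nonneg (weightSum-nonneg n 0 z≤n dom) (weightSum-nonneg n 0 z≤n (dominated-zero dom))
  weightSum-nonneg (suc n) (suc j)     2j≤n dom | inj₁ (s≤s 2j≤n′) =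
    +-nonneg (weightSum-nonneg n (suc j) 2j≤n′ dom)
      (weightSum-nonneg n j (ℕ.≤-trans (ℕ.m≤n⇒m≤1+n (ℕ.+-monoʳ-≤ j (ℕ.n≤1+n j))) 2j≤n′) (dominated-suc dom))
  -- In the remaining case twice j is the dimension, and splitting off a digit would leave a cube
  -- too small for j. Here complementing a vertex maps weight j + d to j - d, so the sum is averaged
  -- with its mirror image.
  weightSum-nonneg (suc n) j {h}       2j≤n dom | inj₂ 2j≡n =
    double-nonneg (≤-resp refl (trans (∑ᵥ-+ {suc n} (h ∘ ω) (λ u → h (suc n ∸ ω u)))
        (+-congˡ (sym (∑ᵥ-reverse (suc n) h))))
      (∑ᵥ-nonneg {suc n} λ u → paired (ω u) (ω≤n u)))
    where
    paired : ∀ i → i ℕ.≤ suc n → 0# ≤ h i + h (suc n ∸ i)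
    paired i i≤n with ℕ.≤-total i j
    ... | inj₁ i≤j = ≤-resp refl (trans (+-comm _ _) (+-congˡ (reflexive (≡.cong h (≡.sym reflect)))))
      (dom .balanced i (j ∸ i) (ℕ.m+[n∸m]≡n i≤j))
      where
      reflect : suc n ∸ i ≡ j ℕ.+ (j ∸ i)
      reflect = ≡.trans (≡.cong (_∸ i) (≡.sym 2j≡n)) (ℕ.+-∸-assoc j i≤j)
    ... | inj₂ j≤i = ≤-resp refl (+-congʳ (reflexive (≡.cong h (ℕ.m+[n∸m]≡n j≤i))))
      (dom .balanced (suc n ∸ i) (i ∸ j) reflect)
      where
      reflect : (suc n ∸ i) ℕ.+ (i ∸ j) ≡ j
      reflect = ≡.trans (≡.sym (ℕ.+-∸-assoc (suc n ∸ i) j≤i))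
        (≡.trans (≡.cong (_∸ j) (ℕ.m∸n+n≡m i≤n)) (≡.trans (≡.cong (_∸ j) (≡.sym 2j≡n)) (ℕ.m+n∸n≡m j j)))

  -- The half with first digit 1 keeps the positive value, now just above j - 1, until j = 0, where
  -- it is met at a vertex of weight 1. The strict bound 2j < n excludes the symmetric case, in
  -- which everything may cancel.
  weightSum-pos : ∀ n j {h} → j ℕ.+ j ℕ.< n → Dominated j h → 0# < h (suc j) → 0# < ∑ᵥ {n} (h ∘ ω)
  weightSum-pos (suc n) zero {h} _ dom 0<h = <-respʳ-≈ (+-comm _ _) (+-pos-nonneg
    (∑ᵥ-pos {n} {h ∘ suc ∘ ω} (λ u → dom .upper (suc (ω u))) 𝟎
      (<-respʳ-≈ (reflexive (≡.cong (h ∘ suc) (≡.sym (ω-𝟎 n)))) 0<h))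
    (∑ᵥ-nonneg {n} λ u → dom .upper (ω u)))
  weightSum-pos (suc n) (suc j) (s≤s 2j<n) dom 0<h = <-respʳ-≈ (+-comm _ _) (+-pos-nonneg
    (weightSum-pos n j (ℕ.≤-trans (s≤s (ℕ.+-monoʳ-≤ j (ℕ.n≤1+n j))) 2j<n) (dominated-suc dom) 0<h)
    (weightSum-nonneg n (suc j) 2j<n dom))

  ⁻¹-≈0 : ∀ {x} → x ≈ 0# → x ⁻¹ ≈ 0#
  ⁻¹-≈0 {x} x≈0 with x ≈? 0#
  ... | yes _  = refl
  ... | no x≉0 = ⊥-elim (x≉0 x≈0)

  ⁻¹-cong : ∀ {x y} → x ≈ y → x ⁻¹ ≈ y ⁻¹
  ⁻¹-cong {x} {y} x≈y = by-cases (x ≈? 0#)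
    where
    by-cases : Dec (x ≈ 0#) → x ⁻¹ ≈ y ⁻¹
    by-cases (yes x≈0) = trans (⁻¹-≈0 x≈0) (sym (⁻¹-≈0 (trans (sym x≈y) x≈0)))
    by-cases (no x≉0)  = *-cancelˡ x≉0 (trans (⁻¹-inverseʳ x≉0)
      (sym (trans (*-congʳ x≈y) (⁻¹-inverseʳ (x≉0 ∘ trans x≈y)))))

  -- 2/(i - j) if i and j have different parities and 0 otherwise.
  oddInverse : ℕ → ℕ → Carrier
  oddInverse j i = (1# - ε j * ε i) * (⟦ i ⟧ - ⟦ j ⟧) ⁻¹

  private
    oddInverse-above : ∀ j d → oddInverse j (j ℕ.+ d) ≈ (1# - ε d) * ⟦ d ⟧ ⁻¹
    oddInverse-above j d = *-cong
      (+-congˡ (-‿cong (trans (*-congˡ (ε-+ j d)) (trans (sym (*-assoc _ _ _))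
        (trans (*-congʳ (ε-square j)) (*-identityˡ _))))))
      (⁻¹-cong (trans (+-congʳ (⟦+⟧ j d)) (solve 2 (λ j d → (j :+ d) :- j := d) refl ⟦ j ⟧ ⟦ d ⟧)))

    oddInverse-below : ∀ i d → oddInverse (i ℕ.+ d) i ≈ - ((1# - ε d) * ⟦ d ⟧ ⁻¹)
    oddInverse-below i d = trans (*-cong
      (+-congˡ (-‿cong (trans (*-congʳ (ε-+ i d)) (trans
        (solve 2 (λ a b → (a :* b) :* a := (a :* a) :* b) refl (ε i) (ε d))
        (trans (*-congʳ (ε-square i)) (*-identityˡ _))))))
      (trans (⁻¹-cong (trans (+-congˡ (-‿cong (⟦+⟧ i d)))
        (solve 2 (λ i d → i :- (i :+ d) := :- d) refl ⟦ i ⟧ ⟦ d ⟧))) (neg-⁻¹ ⟦ d ⟧)))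
      (sym (-‿distribʳ-* _ _))

  -- The function is odd about j, so mirror images cancel exactly; above j it is nonnegative.
  oddInverse-dominated : ∀ j → Dominated j (oddInverse j)
  oddInverse-dominated j .upper d = ≤-resp refl (sym (oddInverse-above j d)) (*-nonneg (ε≤1 d) (0≤⁻¹ d))
    where
    0≤⁻¹ : ∀ d → 0# ≤ ⟦ d ⟧ ⁻¹
    0≤⁻¹ zero    = inj₂ (sym (⁻¹-≈0 refl))
    0≤⁻¹ (suc d) = inj₁ (⁻¹-pos (⟦suc⟧-pos d))
  oddInverse-dominated j .balanced i d ≡.refl =
    inj₂ (sym (trans (+-cong (oddInverse-above (i ℕ.+ d) d) (oddInverse-below i d)) (-‿inverseʳ _)))

  oddInverse-suc-pos : ∀ j → 0# < oddInverse j (suc j)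
  oddInverse-suc-pos j = <-respʳ-≈
    (trans (sym (oddInverse-above j 1)) (reflexive (≡.cong (oddInverse j) (ℕ.+-comm j 1))))
    (*-pos (<-respʳ-≈ (+-congˡ (sym (-‿involutive 1#))) (+-pos 0<1 0<1)) (⁻¹-pos (⟦suc⟧-pos 0)))

  ^-poles : ∀ {n} (f : V (suc n)) → (∀ v → v ≢ 𝟎 → v ≢ 𝟏 → f v ≈ 0#) →
            ∀ u → (f ^) u ≈ f 𝟎 + f 𝟏 * ε (ω u)
  ^-poles {n} f f≈0 u = trans
    (∑ᵥ-poles {n} {λ v → f v * E u v} λ v v≢𝟎 v≢𝟏 → trans (*-congʳ (f≈0 v v≢𝟎 v≢𝟏)) (zeroˡ _))
    (+-cong (trans (*-congˡ (trans (E-sym u 𝟎) (E-𝟎 u))) (*-identityʳ _))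
            (*-congˡ (trans (E-sym u 𝟏) (E-𝟏 u))))

-- The sign of M at the numbers n - 2j

module SignAtEigenvalues {ℓ} (ℝ : RealNumbers ℓ) (n′ : ℕ) where
  open RealNumbers ℝ hiding (zero)
  open IntegerSolver commutativeRing
  open OrderedField ℝ
  open Spectra ℝ hiding (0#; _≈_)
  open HypercubeFourier ℝ
  open WeightSums ℝ
  open Spectrum ℝ n′
  open SetoidReasoning setoid

  -- The solution of the rows 1, …, n - 1 has the values D x n′ 1 and 0 at the
  -- poles, so that (N - x) maps it to a combination of e_𝟎 and e_𝟏.  The
  -- Fourier transform turns this into a formula for D x n′ 1.
  module _ (j : ℕ) (2j<n : j ℕ.+ j ℕ.< n) where
    private
      x s F : Carrier
      x = κ n j
      s = ε j
      F = factorial n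
      a : ℕ → Carrier
      a = solution x n′
      g residue : V n
      g = a ∘ ω
      residue = N g +ᴹ (- x *ₗ g)
      G : V n
      G = g ^

      residue-interior : ∀ v → v ≢ 𝟎 → v ≢ 𝟏 → residue v ≈ 0#
      residue-interior v v≢𝟎 v≢𝟏 = trans
        (+-congʳ (row⇒eigen {x} {a} v (solution-row x n′ (ω v) 1≤ωv ωv≤n′)))
        (solve 2 (λ x y → x :* y :+ :- x :* y := :0) refl x (a (ω v)))
        where
        1≤ωv : 1 ℕ.≤ ω v
        1≤ωv = ℕ.n≢0⇒n>0 (v≢𝟎 ∘ ω≡0⇒𝟎 v)
        ωv≤n′ : ω v ℕ.≤ n′
        ωv≤n′ = ℕ.s≤s⁻¹ (ℕ.≤∧≢⇒< (ω≤n v) (v≢𝟏 ∘ ω≡n⇒𝟏 v))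

      g-𝟎 : g 𝟎 ≈ D x n′ 1
      g-𝟎 = trans (reflexive (≡.cong a (ω-𝟎 n))) (solution-first x n′)

      g-𝟏 : g 𝟏 ≈ 0#
      g-𝟏 = trans (reflexive (≡.cong a (ω-𝟏 n))) (solution-beyond x n′ n ℕ.≤-refl)

      -- The n neighbours of 𝟏 carry the value (n - 1)!, and `g` vanishes at 𝟏 itself.
      residue-𝟏 : residue 𝟏 ≈ F
      residue-𝟏 = begin
        N g 𝟏 + - x * g 𝟏
          ≈⟨ +-cong (N-radial {n} a 𝟏) (*-congˡ g-𝟏) ⟩
        (⟦ ω (𝟏 {n}) ⟧ * a (ω (𝟏 {n}) ∸ 1) + ⟦ n ∸ ω (𝟏 {n}) ⟧ * a (suc (ω (𝟏 {n})))) + - x * 0#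
          ≡⟨ ≡.cong (λ k → (⟦ k ⟧ * a (k ∸ 1) + ⟦ n ∸ k ⟧ * a (suc k)) + - x * 0#) (ω-𝟏 n) ⟩
        (⟦ n ⟧ * a n′ + ⟦ n ∸ n ⟧ * a (suc n)) + - x * 0#
          ≈⟨ +-congʳ (+-cong (*-congˡ (solution-last x n′)) (*-congˡ (solution-beyond x n′ (suc n) (ℕ.n≤1+n n)))) ⟩
        (⟦ n ⟧ * factorial n′ + ⟦ n ∸ n ⟧ * 0#) + - x * 0#
          ≈⟨ solve 3 (λ f c x → (f :+ c :* :0) :+ :- x :* :0 := f) refl _ _ _ ⟩
        F  ∎

      transformed : ∀ u → (κ n (ω u) - x) * G u ≈ residue 𝟎 + F * ε (ω u)
      transformed u = begin
        (κ n (ω u) - x) * G u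
          ≈⟨ solve 3 (λ k x y → (k :- x) :* y := k :* y :+ :- x :* y) refl (κ n (ω u)) x (G u) ⟩
        κ n (ω u) * G u + - x * G u
          ≈⟨ +-cong (^-N g u) (^-* (- x) g u) ⟨
        (N g ^) u + ((- x *ₗ g) ^) u
          ≈⟨ ^-+ (N g) (- x *ₗ g) u ⟨
        (residue ^) u
          ≈⟨ ^-poles residue residue-interior u ⟩
        residue 𝟎 + residue 𝟏 * ε (ω u)
          ≈⟨ +-congˡ (*-congʳ residue-𝟏) ⟩
        residue 𝟎 + F * ε (ω u)  ∎

      -- At a vertex of weight j the factor on the left of `transformed` is 0, which determines the
      -- residue at 𝟎.
      residue-𝟎 : residue 𝟎 ≈ - (F * s)
      residue-𝟎 = begin
        residue 𝟎
          ≈⟨ solve 2 (λ r y → r := (r :+ y) :- y) refl (residue 𝟎) (F * s) ⟩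
        (residue 𝟎 + F * s) - F * s
          ≈⟨ +-congʳ (≡.subst (λ k → (κ n k - x) * G u ≈ residue 𝟎 + F * ε k) (ω-leadingOnes n j≤n) (transformed u)) ⟨
        (κ n j - x) * G u - F * s
          ≈⟨ solve 3 (λ x y z → (x :- x) :* y :- z := :- z) refl x (G u) (F * s) ⟩
        - (F * s)  ∎
        where
        j≤n : j ℕ.≤ n
        j≤n = ℕ.≤-trans (ℕ.m≤m+n j j) (ℕ.<⇒≤ 2j<n)
        u = leadingOnes n j

      relation : ∀ u → ((⟦ ω u ⟧ - ⟦ j ⟧) + (⟦ ω u ⟧ - ⟦ j ⟧)) * G u ≈ F * (s - ε (ω u))
      relation u = begin
        ((i - ⟦ j ⟧) + (i - ⟦ j ⟧)) * G u
          ≈⟨ solve 4 (λ i j n y → ((i :- j) :+ (i :- j)) :* y := :- (((n :- (i :+ i)) :- (n :- (j :+ j))) :* y))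
               refl i ⟦ j ⟧ ⟦ n ⟧ (G u) ⟩
        - (((⟦ n ⟧ - (i + i)) - (⟦ n ⟧ - (⟦ j ⟧ + ⟦ j ⟧))) * G u)
          ≈⟨ -‿cong (*-congʳ (+-cong (κ-def n (ω u)) (-‿cong (κ-def n j)))) ⟨
        - ((κ n (ω u) - x) * G u)
          ≈⟨ -‿cong (trans (transformed u) (+-congʳ residue-𝟎)) ⟩
        - (- (F * s) + F * ε (ω u))
          ≈⟨ solve 3 (λ f s e → :- (:- (f :* s) :+ f :* e) := f :* (s :- e)) refl F s (ε (ω u)) ⟩
        F * (s - ε (ω u))  ∎
        where i = ⟦ ω u ⟧

      -- The right-hand side is s (1 - s εᵢ) y. For i of the parity of j the bracket is 0, which
      -- settles i = j, where the hypothesis says nothing about y. For i ≠ j the hypothesis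
      -- determines y.
      pointwise : ∀ i y → ((⟦ i ⟧ - ⟦ j ⟧) + (⟦ i ⟧ - ⟦ j ⟧)) * y ≈ F * (s - ε i) →
                  F * oddInverse j i ≈ s * y + - (s * s) * (y * ε i)
      pointwise i y rel with i ℕ.≟ j
      ... | yes ≡.refl = trans
        (*-congˡ (*-congʳ (trans (+-congˡ (-‿cong (ε-square i))) (-‿inverseʳ 1#))))
        (trans (trans (*-congˡ (zeroˡ _)) (zeroʳ F)) (sym (begin
          s * y + - (s * s) * (y * s)   ≈⟨ +-congˡ (*-congʳ (-‿cong (ε-square i))) ⟩
          s * y + - 1# * (y * s)        ≈⟨ solve 2 (λ s y → s :* y :+ :- :1 :* (y :* s) := :0) refl s y ⟩
          0#                            ∎)))
      ... | no i≢j = *-cancelˡ 2d≉0 (begin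
        (d + d) * (F * ((1# - s * t) * d ⁻¹))
          ≈⟨ solve 4 (λ d f c i → (d :+ d) :* (f :* (c :* i)) := (f :* (c :+ c)) :* (d :* i)) refl d F (1# - s * t) (d ⁻¹) ⟩
        (F * ((1# - s * t) + (1# - s * t))) * (d * d ⁻¹)
          ≈⟨ trans (*-congˡ (⁻¹-inverseʳ d≉0)) (*-identityʳ _) ⟩
        F * ((1# - s * t) + (1# - s * t))
          ≈⟨ solve 3 (λ f s t → f :* ((:1 :- s :* t) :+ (:1 :- s :* t))
               := f :* ((:1 :- s :* t) :+ :1 :* (:1 :- s :* t))) refl F s t ⟩
        F * ((1# - s * t) + 1# * (1# - s * t))
          ≈⟨ *-congˡ (+-cong (+-congʳ (ε-square j)) (*-cong (ε-square j) (+-congʳ (ε-square i)))) ⟨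
        F * ((s * s - s * t) + (s * s) * (t * t - s * t))
          ≈⟨ solve 3 (λ f s t → f :* ((s :* s :- s :* t) :+ (s :* s) :* (t :* t :- s :* t))
               := (s :- (s :* s) :* t) :* (f :* (s :- t))) refl F s t ⟩
        (s - (s * s) * t) * (F * (s - t))
          ≈⟨ *-congˡ rel ⟨
        (s - (s * s) * t) * ((d + d) * y)
          ≈⟨ solve 4 (λ s t d y → (s :- (s :* s) :* t) :* ((d :+ d) :* y)
               := (d :+ d) :* (s :* y :+ :- (s :* s) :* (y :* t))) refl s t d y ⟩
        (d + d) * (s * y + - (s * s) * (y * t))  ∎)
        where
        t d : Carrier
        t = ε i
        d = ⟦ i ⟧ - ⟦ j ⟧
        d≉0 : ¬ d ≈ 0#
        d≉0 d≈0 = i≢j (⟦⟧-injective (trans (solve 2 (λ i j → i := (i :- j) :+ j) refl ⟦ i ⟧ ⟦ j ⟧)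
          (trans (+-congʳ d≈0) (+-identityˡ _))))
        2d≉0 : ¬ d + d ≈ 0#
        2d≉0 2d≈0 = *-≉0 (>⇒≉ (+-pos 0<1 0<1)) d≉0
          (trans (solve 1 (λ d → (:1 :+ :1) :* d := d :+ d) refl d) 2d≈0)

      -- The sums of `G` with the weights 1 and (-1) to the power ω(u) are the inverse transforms at
      -- 𝟎 and 𝟏, so the second is a multiple of g(𝟏) = 0.
      total : F * ∑ᵥ {n} (oddInverse j ∘ ω) ≈ 2^ n * (s * D x n′ 1)
      total = begin
        F * ∑ᵥ {n} (oddInverse j ∘ ω)
          ≈⟨ ∑ᵥ-* {n} F (oddInverse j ∘ ω) ⟨
        ∑ᵥ {n} (F *ₗ (oddInverse j ∘ ω))
          ≈⟨ ∑ᵥ-cong {n} (λ u → pointwise (ω u) (G u) (relation u)) ⟩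
        ∑ᵥ {n} ((s *ₗ G) +ᴹ (- (s * s) *ₗ (λ u → G u * ε (ω u))))
          ≈⟨ ∑ᵥ-+ {n} (s *ₗ G) (- (s * s) *ₗ (λ u → G u * ε (ω u))) ⟩
        ∑ᵥ {n} (s *ₗ G) + ∑ᵥ {n} (- (s * s) *ₗ (λ u → G u * ε (ω u)))
          ≈⟨ +-cong (∑ᵥ-* {n} s G) (∑ᵥ-* {n} (- (s * s)) (λ u → G u * ε (ω u))) ⟩
        s * ∑ᵥ {n} G + - (s * s) * ∑ᵥ {n} (λ u → G u * ε (ω u))
          ≈⟨ +-cong (*-congˡ (^-𝟎 {n} G)) (*-congˡ (^-𝟏 {n} G)) ⟨
        s * (G ^) 𝟎 + - (s * s) * (G ^) 𝟏
          ≈⟨ +-cong (*-congˡ (trans (^-involutive g 𝟎) (*-congˡ g-𝟎)))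
               (*-congˡ (trans (^-involutive g 𝟏) (*-congˡ g-𝟏))) ⟩
        s * (2^ n * D x n′ 1) + - (s * s) * (2^ n * 0#)
          ≈⟨ solve 3 (λ s t m → s :* (t :* m) :+ :- (s :* s) :* (t :* :0) := t :* (s :* m)) refl s (2^ n) (D x n′ 1) ⟩
        2^ n * (s * D x n′ 1)  ∎

    D-sign-at-κ : 0# < ε j * D (κ n j) n′ 1
    D-sign-at-κ = pos-cancelˡ (2^-pos n) (<-respʳ-≈ total
      (*-pos (factorial-pos n) (weightSum-pos n j 2j<n (oddInverse-dominated j) (oddInverse-suc-pos j))))

-- Location, interlacing and symmetry of the roots of K, L and M

module RootLocation {ℓ} (ℝ : RealNumbers ℓ) (n′ : ℕ) where
  open RealNumbers ℝ hiding (zero)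
  open RingProperties ring
  open IntegerSolver commutativeRing
  open OrderedField ℝ
  open Spectra ℝ hiding (0#; _≈_)
  open Polynomials rawRing using (eval)
  open PolynomialProperties commutativeRing
  open ComplexRoots ℝ
  open HypercubeFourier ℝ
  open WeightSums ℝ using (ε-+)
  open SignAtEigenvalues ℝ n′
  open Spectrum ℝ n′ hiding (eval-K; eval-L; eval-M; K-monic; L-monic; M-monic)
  open SetoidReasoning setoid

  -- The three polynomials enter only through their values and their leading terms.
  module CharacteristicRoots
    (K[x] L[x] M[x] : Poly)
    (eval-K : ∀ x → eval K[x] x ≈ D x (suc n) 0)
    (eval-L : ∀ x → eval L[x] x ≈ D x n 1)
    (eval-M : ∀ x → eval M[x] x ≈ D x n′ 1)
    (K-monic : LeadingTerm K[x] (suc n) 1#)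
    (L-monic : LeadingTerm L[x] n 1#)
    (M-monic : LeadingTerm M[x] n′ 1#)
    where

    module KrawtchoukVector (k : ℕ) (k≤n : k ℕ.≤ n) where
      private
        radial : Radial (e {n} k ^)
        radial = ^-radial (e-radial k)
        a : ℕ → Carrier
        a = proj₁ radial
        μ : Carrier
        μ = κ n k
        rows : ∀ i → i ℕ.≤ n → Row μ a i
        rows i i≤n = ≡.subst (Row μ a) (ω-leadingOnes n i≤n)
          (eigen⇒row {μ} radial (leadingOnes n i) (e^-eigenvector k (leadingOnes n i)))
        a₀ : a 0 ≈ levelSize n k
        a₀ = trans (reflexive (≡.cong a (≡.sym (ω-𝟎 n)))) (trans (sym (proj₂ radial 𝟎)) (^-𝟎 {n} (e k)))
        aₙ : a n ≈ levelSize n k * ε k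
        aₙ = trans (reflexive (≡.cong a (≡.sym (ω-𝟏 n)))) (trans (sym (proj₂ radial 𝟏)) (e^-𝟏 n k))
        continuants : ∀ m i → m ℕ.+ i ≡ n → a i * rising m i ≈ a n * D μ m (suc i)
        continuants = rows⇒continuant {μ} {a} (λ i _ → rows i)
          (trans (*-congʳ (reflexive (≡.cong ⟦_⟧ (ℕ.n∸n≡0 n)))) (zeroˡ _))

      -- The rows 1, ..., n of the Krawtchouk eigenvector give a₀ n! = aₙ L(μ), where a₀ = C(n,k),
      -- aₙ = (-1)ᵏ C(n,k), and `rising n 0` is n!.
      L-at-κ : D μ n 1 ≈ ε k * rising n 0
      L-at-κ = *-cancelˡ (levelSize≉0 k≤n) (begin
        levelSize n k * D μ n 1
          ≈⟨ *-congʳ (*-identityʳ _) ⟨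
        (levelSize n k * 1#) * D μ n 1
          ≈⟨ *-congʳ (*-congˡ (ε-square k)) ⟨
        (levelSize n k * (ε k * ε k)) * D μ n 1
          ≈⟨ solve 3 (λ s e d → (s :* (e :* e)) :* d := e :* ((s :* e) :* d)) refl (levelSize n k) (ε k) (D μ n 1) ⟩
        ε k * ((levelSize n k * ε k) * D μ n 1)
          ≈⟨ *-congˡ (*-congʳ aₙ) ⟨
        ε k * (a n * D μ n 1)
          ≈⟨ *-congˡ (continuants n 0 (ℕ.+-identityʳ n)) ⟨
        ε k * (a 0 * rising n 0)
          ≈⟨ *-congˡ (*-congʳ a₀) ⟩
        ε k * (levelSize n k * rising n 0)
          ≈⟨ solve 3 (λ e s r → e :* (s :* r) := s :* (e :* r)) refl _ _ _ ⟩
        levelSize n k * (ε k * rising n 0)  ∎)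

      K-at-κ : IsRoot K[x] μ
      K-at-κ = trans (eval-K μ) (*-≈0 aₙ≉0 (begin
        a n * (μ * D μ n 1 - (⟦ n ⟧ * ⟦ 1 ⟧) * D μ n′ 2)
          ≈⟨ solve 5 (λ a x d c d′ → a :* (x :* d :- c :* d′) := x :* (a :* d) :- c :* (a :* d′)) refl
               (a n) μ (D μ n 1) (⟦ n ⟧ * ⟦ 1 ⟧) (D μ n′ 2) ⟩
        μ * (a n * D μ n 1) - (⟦ n ⟧ * ⟦ 1 ⟧) * (a n * D μ n′ 2)
          ≈⟨ +-cong (*-congˡ (continuants n 0 (ℕ.+-identityʳ n)))
               (-‿cong (*-congˡ (continuants n′ 1 (ℕ.+-comm n′ 1)))) ⟨
        μ * (a 0 * (⟦ 1 ⟧ * r)) - (⟦ n ⟧ * ⟦ 1 ⟧) * (a 1 * r)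
          ≈⟨ solve 6 (λ x a₀ s r n a₁ → x :* (a₀ :* (s :* r)) :- (n :* s) :* (a₁ :* r)
               := (x :* a₀ :- (:0 :* a₀ :+ n :* a₁)) :* (s :* r)) refl μ (a 0) ⟦ 1 ⟧ r ⟦ n ⟧ (a 1) ⟩
        (μ * a 0 - (0# * a 0 + ⟦ n ⟧ * a 1)) * (⟦ 1 ⟧ * r)
          ≈⟨ *-congʳ (trans (+-congˡ (-‿cong (rows 0 z≤n))) (-‿inverseʳ _)) ⟩
        0# * (⟦ 1 ⟧ * r)
          ≈⟨ zeroˡ _ ⟩
        0#  ∎))
        where
        r = rising n′ 1
        aₙ≉0 : ¬ a n ≈ 0#
        aₙ≉0 aₙ≈0 = *-≉0 (levelSize≉0 k≤n) (λ εk≈0 → 1≉0 (trans (sym (ε-square k)) (trans (*-congʳ εk≈0) (zeroˡ _))))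
          (trans (sym aₙ) aₙ≈0)

    -- The roots of K

    opaque
      -- The numbers `κ n k` decrease with k; this lists them in increasing order, with α i = κ n (n
      -- - i) for i ≤ n.
      α : ℕ → Carrier
      α i = (⟦ i ⟧ + ⟦ i ⟧) - ⟦ n ⟧

      α-mono : ∀ {i j} → i ℕ.< j → α i < α j
      α-mono {i} {j} i<j = <-difference (d + d) (+-pos 0<d 0<d)
        (solve 3 (λ i j n → (j :+ j) :- n := ((i :+ i) :- n) :+ ((j :- i) :+ (j :- i))) refl ⟦ i ⟧ ⟦ j ⟧ ⟦ n ⟧)
        where
        d : Carrier
        d = ⟦ j ⟧ - ⟦ i ⟧
        0<d : 0# < d
        0<d = 0<-difference (⟦⟧-mono-< i<j)

      α-mono-≤ : ∀ {i j} → i ℕ.≤ j → α i ≤ α j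
      α-mono-≤ i≤j with ℕ.m≤n⇒m<n∨m≡n i≤j
      ... | inj₁ i<j    = inj₁ (α-mono i<j)
      ... | inj₂ ≡.refl = ≤-refl

      α≈κ : ∀ i j → i ℕ.+ j ≡ n → α i ≈ κ n j
      α≈κ i j i+j≡n = begin
        (⟦ i ⟧ + ⟦ i ⟧) - ⟦ n ⟧
          ≈⟨ +-congˡ (-‿cong n≈i+j) ⟩
        (⟦ i ⟧ + ⟦ i ⟧) - (⟦ i ⟧ + ⟦ j ⟧)
          ≈⟨ solve 2 (λ i j → (i :+ i) :- (i :+ j) := (i :+ j) :- (j :+ j)) refl ⟦ i ⟧ ⟦ j ⟧ ⟩
        (⟦ i ⟧ + ⟦ j ⟧) - (⟦ j ⟧ + ⟦ j ⟧)
          ≈⟨ +-congʳ n≈i+j ⟨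
        ⟦ n ⟧ - (⟦ j ⟧ + ⟦ j ⟧)
          ≈⟨ κ-def n j ⟨
        κ n j  ∎
        where
        n≈i+j : ⟦ n ⟧ ≈ ⟦ i ⟧ + ⟦ j ⟧
        n≈i+j = trans (reflexive (≡.cong ⟦_⟧ (≡.sym i+j≡n))) (⟦+⟧ i j)

      α≈-κ : ∀ i → α i ≈ - κ n i
      α≈-κ i = trans (solve 2 (λ i n → (i :+ i) :- n := :- (n :- (i :+ i))) refl ⟦ i ⟧ ⟦ n ⟧) (-‿cong (sym (κ-def n i)))

      α≈κ-complement : ∀ {i} → i ℕ.≤ n → α i ≈ κ n (n ∸ i)
      α≈κ-complement {i} i≤n = α≈κ i (n ∸ i) (ℕ.m+[n∸m]≡n i≤n)

      α-pos : ∀ {i} → n ℕ.< i ℕ.+ i → 0# < α i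
      α-pos {i} n<2i = <-respʳ-≈ (+-congʳ (⟦+⟧ i i)) (0<-difference (⟦⟧-mono-< n<2i))

      α-neg : ∀ {i} → i ℕ.+ i ℕ.< n → α i < 0#
      α-neg {i} 2i<n = <-difference (⟦ n ⟧ - ⟦ i ℕ.+ i ⟧) (0<-difference (⟦⟧-mono-< 2i<n))
        (trans (solve 2 (λ s n → :0 := (s :- n) :+ (n :- s)) refl ⟦ i ℕ.+ i ⟧ ⟦ n ⟧)
          (+-congʳ (+-congʳ (⟦+⟧ i i))))

      α-zero : ∀ {i} → i ℕ.+ i ≡ n → α i ≈ 0#
      α-zero {i} 2i≡n = trans (+-congʳ (trans (sym (⟦+⟧ i i)) (reflexive (≡.cong ⟦_⟧ 2i≡n)))) (-‿inverseʳ _)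

    α-Fin : Fin (suc n) → Carrier
    α-Fin i = α (toℕ i)

    α-root : ∀ {i} → i ℕ.≤ n → IsRoot K[x] (α i)
    α-root {i} i≤n = trans (eval-congˡ K[x] (α≈κ-complement i≤n)) (KrawtchoukVector.K-at-κ (n ∸ i) (ℕ.m∸n≤m n i))

    module K-roots = RealRoots K[x] α-Fin K-monic α-mono (λ i → α-root (ℕ.s≤s⁻¹ (Fin.toℕ<n i)))

    K-root⇒κ : ∀ {μ} → IsRoot K[x] μ → ∃ λ k → k ℕ.≤ n × μ ≈ κ n k
    K-root⇒κ {μ} root = n ∸ toℕ i , ℕ.m∸n≤m n (toℕ i) , trans μ≈αᵢ (α≈κ-complement {toℕ i} i≤n)
      where
      index : ∃ λ i → μ ≈ α-Fin i
      index = Enumerates.complete K-roots.enumerates μ root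
      i = proj₁ index
      μ≈αᵢ : μ ≈ α (toℕ i)
      μ≈αᵢ = proj₂ index
      i≤n : toℕ i ℕ.≤ n
      i≤n = ℕ.s≤s⁻¹ (Fin.toℕ<n i)

    κ⇒K-root : ∀ {μ} → (∃ λ k → k ℕ.≤ n × μ ≈ κ n k) → IsRoot K[x] μ
    κ⇒K-root {μ} (k , k≤n , μ≈κ) =
      trans (eval-congˡ K[x] {μ} {κ n k} μ≈κ) (KrawtchoukVector.K-at-κ k k≤n)

    -- Each of the d - j roots above x contributes one negative factor.
    rootProduct-sign : ∀ {d} (a : Fin d → Carrier) x j → j ℕ.≤ d →
      (∀ i → toℕ i ℕ.< j → a i < x) → (∀ i → j ℕ.≤ toℕ i → x < a i) → 0# < ε (d ∸ j) * rootProduct a x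
    rootProduct-sign {zero}  a x zero    j≤d       below above = <-respʳ-≈ (sym (*-identityˡ 1#)) 0<1
    rootProduct-sign {suc d} a x zero    j≤d       below above = <-respʳ-≈
      (solve 4 (λ x a e r → (a :- x) :* (e :* r) := :- e :* ((x :- a) :* r)) refl x (a zero) (ε d) _)
      (*-pos (0<-difference (above zero z≤n))
        (rootProduct-sign (a ∘ suc) x zero z≤n (λ _ ()) (λ i _ → above (suc i) z≤n)))
    rootProduct-sign {suc d} a x (suc j) (s≤s j≤d) below above = <-respʳ-≈
      (solve 4 (λ x a e r → (x :- a) :* (e :* r) := e :* ((x :- a) :* r)) refl x (a zero) (ε (d ∸ j)) _)
      (*-pos (0<-difference (below zero (s≤s z≤n)))
        (rootProduct-sign (a ∘ suc) x j j≤d (λ i i<j → below (suc i) (s≤s i<j)) (λ i j≤i → above (suc i) (s≤s j≤i))))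

    K-sign : ∀ {k x} → k ℕ.< n → α k < x → x < α (suc k) → 0# < ε (n ∸ k) * eval K[x] x
    K-sign {k} {x} k<n αk<x x<αk+1 = <-respʳ-≈
      (*-congˡ (sym (eval-rootProduct K[x] α-Fin K-monic K-roots.distinct
        (λ i → α-root (ℕ.s≤s⁻¹ (Fin.toℕ<n i))) x)))
      (rootProduct-sign α-Fin x (suc k) (s≤s (ℕ.<⇒≤ k<n))
        (λ i i<1+k → ≤-<-trans (α-mono-≤ (ℕ.s≤s⁻¹ i<1+k)) αk<x)
        (λ i k<i → <-≤-trans x<αk+1 (α-mono-≤ k<i)))

    -- The roots of L

    L-at-α : ∀ {i} → i ℕ.≤ n → eval L[x] (α i) ≈ ε (n ∸ i) * rising n 0
    L-at-α {i} i≤n = trans (eval-L (α i))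
      (trans (D-cong (α≈κ-complement i≤n) n 1) (KrawtchoukVector.L-at-κ (n ∸ i) (ℕ.m∸n≤m n i)))

    private
      ∸-suc : ∀ {i} → i ℕ.< n → n ∸ i ≡ suc (n ∸ suc i)
      ∸-suc i<n = ℕ.+-∸-assoc 1 i<n

    opaque
      L-root : ∀ i → i ℕ.< n → ∃ λ z → (α i < z × z < α (suc i)) × IsRoot L[x] z
      L-root i i<n = sign-change-root L[x] {α i} {α (suc i)} (α-mono {i} {suc i} ℕ.≤-refl) (<-respˡ-≈ (sym (begin
        eval L[x] (α i) * eval L[x] (α (suc i))
          ≈⟨ *-cong (L-at-α (ℕ.<⇒≤ i<n)) (L-at-α i<n) ⟩
        (ε (n ∸ i) * r) * (ε (n ∸ suc i) * r)
          ≡⟨ ≡.cong (λ m → (ε m * r) * (ε (n ∸ suc i) * r)) (∸-suc i<n) ⟩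
        (- ε (n ∸ suc i) * r) * (ε (n ∸ suc i) * r)
          ≈⟨ solve 2 (λ e r → (:- e :* r) :* (e :* r) := :- ((e :* e) :* (r :* r))) refl (ε (n ∸ suc i)) r ⟩
        - ((ε (n ∸ suc i) * ε (n ∸ suc i)) * (r * r))
          ≈⟨ -‿cong (trans (*-congʳ (ε-square (n ∸ suc i))) (*-identityˡ _)) ⟩
        - (r * r)  ∎))
        (neg-neg (*-pos (rising-pos n 0) (rising-pos n 0))))
        where
        r : Carrier
        r = rising n 0

    -- The roots of M

    M-neg : ∀ x → eval M[x] (- x) ≈ ε n′ * eval M[x] x
    M-neg x = trans (eval-M (- x)) (trans (D-neg x n′ 1) (*-congˡ (sym (eval-M x))))

    private
      ≈neg⇒≈0 : ∀ {x} → x ≈ - x → x ≈ 0#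
      ≈neg⇒≈0 {x} x≈-x = *-≈0 (>⇒≉ (+-pos 0<1 0<1)) (begin
        (1# + 1#) * x   ≈⟨ solve 1 (λ x → (:1 :+ :1) :* x := x :+ x) refl x ⟩
        x + x           ≈⟨ +-congˡ x≈-x ⟩
        x + - x         ≈⟨ -‿inverseʳ x ⟩
        0#              ∎)

    -- For even n the degree n - 1 is odd, so M is an odd function.
    M-root-zero : ∀ {k} → k ℕ.+ k ≡ n → IsRoot M[x] 0#
    M-root-zero {k} 2k≡n = ≈neg⇒≈0 (begin
      eval M[x] 0#                  ≈⟨ eval-congˡ M[x] -0#≈0# ⟨
      eval M[x] (- 0#)              ≈⟨ M-neg 0# ⟩
      ε n′ * eval M[x] 0#           ≈⟨ *-congʳ (-‿involutive (ε n′)) ⟨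
      - ε n * eval M[x] 0#          ≈⟨ *-congʳ (-‿cong εn≈1) ⟩
      - 1# * eval M[x] 0#           ≈⟨ solve 1 (λ x → :- :1 :* x := :- x) refl _ ⟩
      - eval M[x] 0#                ∎)
      where
      εn≈1 : ε n ≈ 1#
      εn≈1 = trans (reflexive (≡.cong ε (≡.sym 2k≡n))) (trans (ε-+ k k) (ε-square k))

    M-sign-above : ∀ {k} → n ℕ.< k ℕ.+ k → k ℕ.≤ n → 0# < ε (n ∸ k) * eval M[x] (α k)
    M-sign-above {k} n<2k k≤n = <-respʳ-≈
      (*-congˡ (trans (sym (eval-M (κ n (n ∸ k)))) (eval-congˡ M[x] {κ n (n ∸ k)} {α k} (sym (α≈κ-complement {k} k≤n)))))
      (D-sign-at-κ j (≡.subst (j ℕ.+ j ℕ.<_) j+k≡n (ℕ.+-monoʳ-< j j<k)))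
      where
      j = n ∸ k
      j+k≡n : j ℕ.+ k ≡ n
      j+k≡n = ℕ.m∸n+n≡m k≤n
      j<k : j ℕ.< k
      j<k = ℕ.+-cancelʳ-< k j k (≡.subst (ℕ._< k ℕ.+ k) (≡.sym j+k≡n) n<2k)

    -- Reflection at 0, as α k = - κ n k. The parity of M turns the sign (-1)ᵏ at κ n k into minus
    -- the sign (-1)ⁿ⁻ᵏ at α k.
    M-sign-below : ∀ {k} → k ℕ.+ k ℕ.< n → k ℕ.≤ n → ε (n ∸ k) * eval M[x] (α k) < 0#
    M-sign-below {k} 2k<n k≤n = <-respˡ-≈ (begin
      - (ε k * m)                       ≈⟨ solve 2 (λ e m → :- (e :* m) := :- ((e :* :1) :* m)) refl (ε k) m ⟩
      - ((ε k * 1#) * m)                ≈⟨ -‿cong (*-congʳ (*-congˡ (ε-square j))) ⟨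
      - ((ε k * (ε j * ε j)) * m)       ≈⟨ solve 3 (λ e t m → :- ((e :* (t :* t)) :* m) := t :* (:- (e :* t) :* m)) refl (ε k) (ε j) m ⟩
      ε j * (- (ε k * ε j) * m)         ≈⟨ *-congˡ (*-congʳ (-‿cong (trans (sym (ε-+ k j)) (reflexive (≡.cong ε (ℕ.m+[n∸m]≡n k≤n)))))) ⟩
      ε j * (- - ε n′ * m)              ≈⟨ *-congˡ (*-congʳ (-‿involutive _)) ⟩
      ε j * (ε n′ * m)                  ≈⟨ *-congˡ (M-neg (κ n k)) ⟨
      ε j * eval M[x] (- κ n k)         ≈⟨ *-congˡ (eval-congˡ M[x] {α k} { - κ n k} (α≈-κ k)) ⟨
      ε j * eval M[x] (α k)             ∎)
      (neg-neg (<-respʳ-≈ (*-congˡ (sym (eval-M (κ n k)))) (D-sign-at-κ k 2k<n)))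
      where
      j = n ∸ k
      m = eval M[x] (κ n k)

    Interlacings : Set ℓ
    Interlacings =
      (AllRootsSimple K[x] × AllRootsReal K[x]) ×
      (AllRootsSimple L[x] × AllRootsReal L[x]) ×
      (AllRootsSimple M[x] × AllRootsReal M[x]) ×
      IsRoot L[x] StrictlyInterlaces IsRoot K[x] ×
      IsRoot M[x] StrictlyInterlaces IsRoot L[x] ×
      (IsRoot M[x] ∩ Positive) StrictlyInterlaces (IsRoot K[x] ∩ Positive) ×
      (IsRoot M[x] ∩ Negative) StrictlyInterlaces (IsRoot K[x] ∩ Negative)

    module RootsOfL
      (ν : Fin n → Carrier)
      (α<ν : ∀ i → α (toℕ i) < ν i)
      (ν<α : ∀ i → ν i < α (suc (toℕ i)))
      (ν-root : ∀ i → IsRoot L[x] (ν i))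
      where

      ν-mono : ∀ {i j} → i Fin.< j → ν i < ν j
      ν-mono {i} {j} i<j = <-trans (ν<α i) (≤-<-trans (α-mono-≤ i<j) (α<ν j))

      module L-roots = RealRoots L[x] ν L-monic ν-mono ν-root

      L-interlaces-K : IsRoot L[x] StrictlyInterlaces IsRoot K[x]
      L-interlaces-K = n , α-Fin , ν , K-roots.enumerates , L-roots.enumerates , λ i →
        <-respˡ-≈ (reflexive (≡.cong α (≡.sym (Fin.toℕ-inject₁ i)))) (α<ν i) , ν<α i

      -- At a root of L the determinant identity reads K M = - ∏ q.
      M-sign-at-ν : ∀ i → ε (n ∸ toℕ i) * eval M[x] (ν i) < 0#
      M-sign-at-ν i = <-respˡ-≈ (-‿involutive _) (neg-neg (pos-cancelˡ
        (K-sign (Fin.toℕ<n i) (α<ν i) (ν<α i))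
        (<-respʳ-≈ (begin
          q-product n′ 0
            ≈⟨ -‿involutive _ ⟨
          - - q-product n′ 0
            ≈⟨ -‿cong (D-determinant x n′ 0) ⟨
          - (D x (suc n) 0 * D x n′ 1 - D x n 0 * D x n 1)
            ≈⟨ -‿cong (+-cong (*-cong (eval-K x) (eval-M x)) (-‿cong (*-congˡ (trans (sym (ν-root i)) (eval-L x))))) ⟨
          - (eval K[x] x * eval M[x] x - D x n 0 * 0#)
            ≈⟨ solve 3 (λ k m d → :- (k :* m :- d :* :0) := :1 :* (k :* :- m)) refl _ _ _ ⟩
          1# * (eval K[x] x * - eval M[x] x)
            ≈⟨ *-congʳ (ε-square (n ∸ toℕ i)) ⟨
          (s * s) * (eval K[x] x * - eval M[x] x)
            ≈⟨ solve 3 (λ s k m → (s :* s) :* (k :* :- m) := (s :* k) :* :- (s :* m)) refl s (eval K[x] x) (eval M[x] x) ⟩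
          (s * eval K[x] x) * - (s * eval M[x] x)  ∎)
          (q-product-pos n′ 0 (≡.subst (ℕ._< n) (≡.sym (ℕ.+-identityʳ n′)) ℕ.≤-refl)))))
        where
        x = ν i
        s = ε (n ∸ toℕ i)

      -- The root of M next to α k lies on the side away from 0.
      data Location (x : Carrier) (k : ℕ) : Set ℓ where
        above : n ℕ.< k ℕ.+ k → α k < x → Location x k
        at-0  : k ℕ.+ k ≡ n → x ≈ 0# → Location x k
        below : k ℕ.+ k ℕ.< n → x < α k → Location x k

      private
        opposite-signs : ∀ {e x y} → e * e ≈ 1# → 0# < e * x → e * y < 0# → x * y < 0#
        opposite-signs {e} {x} {y} e²≈1 0<ex ey<0 = <-respˡ-≈
          (trans (solve 3 (λ e x y → (e :* x) :* (e :* y) := (e :* e) :* (x :* y)) refl e x y)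
            (trans (*-congʳ e²≈1) (*-identityˡ _)))
          (pos-*-neg 0<ex ey<0)

        ν-inject₁<α : ∀ i → ν (inject₁ i) < α (suc (toℕ i))
        ν-inject₁<α i = <-respʳ-≈ (reflexive (≡.cong (λ j → α (suc j)) (Fin.toℕ-inject₁ i))) (ν<α (inject₁ i))

        M-sign-at-ν-inject₁ : ∀ i → 0# < ε (n′ ∸ toℕ i) * eval M[x] (ν (inject₁ i))
        M-sign-at-ν-inject₁ i = <-respʳ-≈
          (trans (-‿distribˡ-* _ _) (*-congʳ (trans (-‿cong (reflexive (≡.cong ε index))) (-‿involutive _))))
          (neg-pos (M-sign-at-ν (inject₁ i)))
          where
          index : n ∸ toℕ (inject₁ i) ≡ suc (n′ ∸ toℕ i)
          index = ≡.trans (≡.cong (n ∸_) (Fin.toℕ-inject₁ i)) (ℕ.+-∸-assoc 1 (ℕ.<⇒≤ (Fin.toℕ<n i)))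

      opaque
        -- The gap from ν i to ν (i + 1) contains α (i + 1), hence k = i + 1. At nonzero α k, the
        -- sign of M agrees with that at the end of the gap nearer to 0 and differs from that at the
        -- other end.
        M-root : ∀ i → ∃ λ x → (ν (inject₁ i) < x × x < ν (suc i)) × IsRoot M[x] x × Location x (suc (toℕ i))
        M-root i with ℕ.<-cmp (suc (toℕ i) ℕ.+ suc (toℕ i)) n
        ... | tri< 2k<n _ _ =
          let x , (ν<x , x<α) , root = sign-change-root M[x] {ν (inject₁ i)} {α k} (ν-inject₁<α i)
                (opposite-signs (ε-square (n ∸ k)) (M-sign-at-ν-inject₁ i) (M-sign-below {k} 2k<n k≤n))
          in x , (ν<x , <-trans x<α (α<ν (suc i))) , root , below 2k<n x<α
          where
          k : ℕ
          k = suc (toℕ i)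
          k≤n : k ℕ.≤ n
          k≤n = s≤s (ℕ.<⇒≤ (Fin.toℕ<n i))
        ... | tri≈ _ 2k≡n _ =
          0# , (<-respʳ-≈ (α-zero {k} 2k≡n) (ν-inject₁<α i) , <-respˡ-≈ (α-zero {k} 2k≡n) (α<ν (suc i))) ,
          M-root-zero {k} 2k≡n , at-0 2k≡n refl
          where
          k : ℕ
          k = suc (toℕ i)
        ... | tri> _ _ n<2k =
          let x , (α<x , x<ν) , root = sign-change-root M[x] {α k} {ν (suc i)} (α<ν (suc i))
                (opposite-signs (ε-square (n ∸ k)) (M-sign-above {k} n<2k k≤n) (M-sign-at-ν (suc i)))
          in x , (<-trans (ν-inject₁<α i) α<x , x<ν) , root , above n<2k α<x
          where
          k : ℕ
          k = suc (toℕ i)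
          k≤n : k ℕ.≤ n
          k≤n = s≤s (ℕ.<⇒≤ (Fin.toℕ<n i))

      module RootsOfM
        (μ : Fin n′ → Carrier)
        (ν<μ : ∀ i → ν (inject₁ i) < μ i)
        (μ<ν : ∀ i → μ i < ν (suc i))
        (μ-root : ∀ i → IsRoot M[x] (μ i))
        (μ-location : ∀ i → Location (μ i) (suc (toℕ i)))
        where

        μ-mono : ∀ {i j} → i Fin.< j → μ i < μ j
        μ-mono {i} {j} i<j = <-trans (μ<ν i) (≤-<-trans ν≤ν (ν<μ j))
          where
          ν≤ν : ν (suc i) ≤ ν (inject₁ j)
          ν≤ν with ℕ.m≤n⇒m<n∨m≡n (≡.subst (suc (toℕ i) ℕ.≤_) (≡.sym (Fin.toℕ-inject₁ j)) i<j)
          ... | inj₁ i<j′ = inj₁ (ν-mono {suc i} {inject₁ j} i<j′)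
          ... | inj₂ i≡j  = inj₂ (reflexive (≡.cong ν (Fin.toℕ-injective i≡j)))

        module M-roots = RealRoots M[x] μ M-monic μ-mono μ-root

        M-interlaces-L : IsRoot M[x] StrictlyInterlaces IsRoot L[x]
        M-interlaces-L = n′ , ν , μ , L-roots.enumerates , M-roots.enumerates , λ i → ν<μ i , μ<ν i

        private
          -- Indices in ℕ, with the bound irrelevant, leave the arithmetic of the two halves to the
          -- natural numbers.
          β : ∀ i → .(i ℕ.< n′) → Carrier
          β i i<n′ = μ (fromℕ< i<n′)

          β-location : ∀ i .(i<n′ : i ℕ.< n′) → Location (β i i<n′) (suc i)
          β-location i i<n′ = ≡.subst (Location (β i i<n′) ∘ suc) (Fin.toℕ-fromℕ< i<n′) (μ-location (fromℕ< i<n′))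

          β-mono : ∀ {i j} .(i<n′ : i ℕ.< n′) .(j<n′ : j ℕ.< n′) → i ℕ.< j → β i i<n′ < β j j<n′
          β-mono i<n′ j<n′ i<j = μ-mono {fromℕ< i<n′} {fromℕ< j<n′}
            (≡.subst₂ ℕ._<_ (≡.sym (Fin.toℕ-fromℕ< i<n′)) (≡.sym (Fin.toℕ-fromℕ< j<n′)) i<j)

          α<β : ∀ i .(i<n′ : i ℕ.< n′) → α i < β i i<n′
          α<β i i<n′ = <-respˡ-≈
            (reflexive (≡.cong α (≡.trans (Fin.toℕ-inject₁ (fromℕ< i<n′)) (Fin.toℕ-fromℕ< i<n′))))
            (<-trans (α<ν (inject₁ (fromℕ< i<n′))) (ν<μ (fromℕ< i<n′)))

          β<α : ∀ i .(i<n′ : i ℕ.< n′) → β i i<n′ < α (2 ℕ.+ i)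
          β<α i i<n′ = <-respʳ-≈ (reflexive (≡.cong (λ j → α (suc (suc j))) (Fin.toℕ-fromℕ< i<n′)))
            (<-trans (μ<ν (fromℕ< i<n′)) (ν<α (suc (fromℕ< i<n′))))

          opaque
            β-complete : ∀ x → IsRoot M[x] x → ∃ λ i → Σ (i ℕ.< n′) λ i<n′ → x ≈ β i i<n′
            β-complete x root = toℕ j , Fin.toℕ<n j , trans x≈μ (reflexive (≡.cong μ (≡.sym (Fin.fromℕ<-toℕ j (Fin.toℕ<n j)))))
              where
              index : ∃ λ j → x ≈ μ j
              index = Enumerates.complete M-roots.enumerates x root
              j : Fin n′
              j = proj₁ index
              x≈μ : x ≈ μ j
              x≈μ = proj₂ index

            α-complete : ∀ x → IsRoot K[x] x → ∃ λ i → i ℕ.≤ n × x ≈ α i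
            α-complete x root = toℕ (proj₁ index) , ℕ.s≤s⁻¹ (Fin.toℕ<n (proj₁ index)) , proj₂ index
              where
              index : ∃ λ j → x ≈ α-Fin j
              index = Enumerates.complete K-roots.enumerates x root

          α-nonpos : ∀ {i} → i ℕ.+ i ℕ.≤ n → α i ≤ 0#
          α-nonpos {i} 2i≤n with ℕ.m≤n⇒m<n∨m≡n 2i≤n
          ... | inj₁ 2i<n = inj₁ (α-neg {i} 2i<n)
          ... | inj₂ 2i≡n = inj₂ (α-zero {i} 2i≡n)

          α-nonneg : ∀ {i} → n ℕ.≤ i ℕ.+ i → 0# ≤ α i
          α-nonneg {i} n≤2i with ℕ.m≤n⇒m<n∨m≡n n≤2i
          ... | inj₁ n<2i = inj₁ (α-pos {i} n<2i)
          ... | inj₂ n≡2i = inj₂ (sym (α-zero {i} (≡.sym n≡2i)))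

          α-pos⁻¹ : ∀ {i} → 0# < α i → n ℕ.< i ℕ.+ i
          α-pos⁻¹ {i} 0<α with ℕ.<-≤-connex n (i ℕ.+ i)
          ... | inj₁ n<2i = n<2i
          ... | inj₂ 2i≤n = ⊥-elim (<⇒≱ 0<α (α-nonpos {i} 2i≤n))

          α-neg⁻¹ : ∀ {i} → α i < 0# → i ℕ.+ i ℕ.< n
          α-neg⁻¹ {i} α<0 with ℕ.<-≤-connex (i ℕ.+ i) n
          ... | inj₁ 2i<n = 2i<n
          ... | inj₂ n≤2i = ⊥-elim (<⇒≱ α<0 (α-nonneg {i} n≤2i))

          double-mono : ∀ {i j} → i ℕ.≤ j → i ℕ.+ i ℕ.≤ j ℕ.+ j
          double-mono i≤j = ℕ.+-mono-≤ i≤j i≤j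

          half : ∀ {i j} → i ℕ.+ i ℕ.≤ n → n ℕ.< suc j ℕ.+ suc j → i ℕ.≤ j
          half {i} {j} 2i≤n n<2j+2 with ℕ.<-≤-connex j i
          ... | inj₂ i≤j = i≤j
          ... | inj₁ j<i = ⊥-elim (ℕ.<⇒≱ (ℕ.<-≤-trans n<2j+2 (double-mono j<i)) 2i≤n)

        -- The negative roots of K are α 0, ..., α r and the positive ones α (m + 1), ..., α n;
        -- those of M are the first r and the last r. For odd n this is everything, with m = r. For
        -- even n, m = r + 1, and the roots α m of K and `μ` of index r of M, both 0, are left out.
        module HalfInterlacing (m r : ℕ) (m+r≡n′ : m ℕ.+ r ≡ n′) (r≤m : r ℕ.≤ m) (m≤1+r : m ℕ.≤ suc r) where
          private
            2m≤n : m ℕ.+ m ℕ.≤ n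
            2m≤n = ℕ.≤-trans (ℕ.+-monoʳ-≤ m m≤1+r) (ℕ.≤-reflexive (≡.trans (ℕ.+-suc m r) (≡.cong suc m+r≡n′)))

            n<2m+2 : n ℕ.< suc m ℕ.+ suc m
            n<2m+2 = s≤s (≡.subst₂ ℕ._≤_ (≡.trans (ℕ.+-suc m r) (≡.cong suc m+r≡n′)) ≡.refl (ℕ.+-monoʳ-≤ m (s≤s r≤m)))

            2r<n : r ℕ.+ r ℕ.< n
            2r<n = s≤s (≡.subst (r ℕ.+ r ℕ.≤_) m+r≡n′ (ℕ.+-monoˡ-≤ r r≤m))

            n≤2r+2 : n ℕ.≤ suc r ℕ.+ suc r
            n≤2r+2 = s≤s (≡.subst (ℕ._≤ r ℕ.+ suc r) (≡.trans (ℕ.+-comm r m) m+r≡n′) (ℕ.+-monoʳ-≤ r m≤1+r))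

            m+i<n′ : ∀ {i} → i ℕ.< r → m ℕ.+ i ℕ.< n′
            m+i<n′ i<r = ≡.subst (m ℕ.+ _ ℕ.<_) m+r≡n′ (ℕ.+-monoʳ-< m i<r)

            i<n′ : ∀ {i} → i ℕ.< r → i ℕ.< n′
            i<n′ i<r = ℕ.<-≤-trans i<r (≡.subst (r ℕ.≤_) m+r≡n′ (ℕ.m≤n+m r m))

            above-half : ∀ i → n ℕ.< suc (m ℕ.+ i) ℕ.+ suc (m ℕ.+ i)
            above-half i = ℕ.<-≤-trans n<2m+2 (double-mono (s≤s (ℕ.m≤m+n m i)))

            below-half : ∀ {i} → i ℕ.≤ r → i ℕ.+ i ℕ.< n
            below-half i≤r = ℕ.≤-<-trans (double-mono i≤r) 2r<n

          α⁺ : Fin (suc r) → Carrier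
          α⁺ i = α (suc (m ℕ.+ toℕ i))

          μ⁺ : Fin r → Carrier
          μ⁺ i = β (m ℕ.+ toℕ i) (m+i<n′ (Fin.toℕ<n i))

          α⁺-enumerates : Enumerates (IsRoot K[x] ∩ Positive) α⁺
          α⁺-enumerates = record
            { increasing = λ {i} {j} i<j → α-mono {suc (m ℕ.+ toℕ i)} {suc (m ℕ.+ toℕ j)} (s≤s (ℕ.+-monoʳ-< m i<j))
            ; sound      = λ i →
                α-root {suc (m ℕ.+ toℕ i)} (s≤s (≡.subst (m ℕ.+ toℕ i ℕ.≤_) m+r≡n′ (ℕ.+-monoʳ-≤ m (ℕ.s≤s⁻¹ (Fin.toℕ<n i))))) ,
                α-pos {suc (m ℕ.+ toℕ i)} (above-half (toℕ i))
            ; complete   = complete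
            }
            where
            complete : ∀ x → x ∈ IsRoot K[x] ∩ Positive → ∃ λ i → x ≈ α⁺ i
            complete x (root , 0<x) with α-complete x root
            ... | k , k≤n , x≈α = fromℕ< d<1+r ,
              trans x≈α (reflexive (≡.cong α (≡.sym (≡.trans (≡.cong (λ d → suc (m ℕ.+ d)) (Fin.toℕ-fromℕ< d<1+r)) (ℕ.m+[n∸m]≡n m<k)))))
              where
              m<k : m ℕ.< k
              m<k with ℕ.<-≤-connex m k
              ... | inj₁ m<k = m<k
              ... | inj₂ k≤m = ⊥-elim (ℕ.<⇒≱ (α-pos⁻¹ {k} (<-respʳ-≈ x≈α 0<x)) (ℕ.≤-trans (double-mono k≤m) 2m≤n))
              d<1+r : k ∸ suc m ℕ.< suc r
              d<1+r = s≤s (≡.subst (k ∸ suc m ℕ.≤_) (≡.trans (≡.cong (_∸ m) (≡.sym m+r≡n′)) (ℕ.m+n∸m≡n m r)) (ℕ.∸-monoˡ-≤ (suc m) k≤n))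

          μ⁺-enumerates : Enumerates (IsRoot M[x] ∩ Positive) μ⁺
          μ⁺-enumerates = record
            { increasing = λ {i} {j} i<j → β-mono (m+i<n′ (Fin.toℕ<n i)) (m+i<n′ (Fin.toℕ<n j)) (ℕ.+-monoʳ-< m i<j)
            ; sound      = λ i → μ-root _ , positive i
            ; complete   = complete
            }
            where
            positive : ∀ i → 0# < μ⁺ i
            positive i with β-location (m ℕ.+ toℕ i) (m+i<n′ (Fin.toℕ<n i))
            ... | above _ α<β  = <-trans (α-pos {suc (m ℕ.+ toℕ i)} (above-half (toℕ i))) α<β
            ... | at-0 2k≡n _  = ⊥-elim (ℕ.<⇒≢ (above-half (toℕ i)) (≡.sym 2k≡n))
            ... | below 2k<n _ = ⊥-elim (ℕ.<-asym (above-half (toℕ i)) 2k<n)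
            complete : ∀ x → x ∈ IsRoot M[x] ∩ Positive → ∃ λ i → x ≈ μ⁺ i
            complete x (root , 0<x) with β-complete x root
            ... | k , k<n′ , x≈β = fromℕ< d<r ,
              trans x≈β (reflexive (≡.cong μ (Fin.fromℕ<-cong _ _
                (≡.sym (≡.trans (≡.cong (m ℕ.+_) (Fin.toℕ-fromℕ< d<r)) (ℕ.m+[n∸m]≡n m≤k))) k<n′ _)))
              where
              m≤k : m ℕ.≤ k
              m≤k with β-location k k<n′
              ... | above n<2k+2 _ = half 2m≤n n<2k+2
              ... | at-0 _ β≈0     = ⊥-elim (>⇒≉ 0<x (trans x≈β β≈0))
              ... | below 2k<n β<α = ⊥-elim (<-asym 0<x (<-respˡ-≈ (sym x≈β) (<-trans β<α (α-neg {suc k} 2k<n))))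
              d<r : k ∸ m ℕ.< r
              d<r = ≡.subst (k ∸ m ℕ.<_) (≡.trans (≡.cong (_∸ m) (≡.sym m+r≡n′)) (ℕ.m+n∸m≡n m r)) (ℕ.∸-monoˡ-< k<n′ m≤k)

          positive-interlacing : (IsRoot M[x] ∩ Positive) StrictlyInterlaces (IsRoot K[x] ∩ Positive)
          positive-interlacing = r , α⁺ , μ⁺ , α⁺-enumerates , μ⁺-enumerates , λ i →
            <-respˡ-≈ (reflexive (≡.cong (λ j → α (suc (m ℕ.+ j))) (≡.sym (Fin.toℕ-inject₁ i)))) (lower i) ,
            <-respʳ-≈ (reflexive (≡.cong (λ j → α (suc j)) (≡.sym (ℕ.+-suc m (toℕ i))))) (β<α (m ℕ.+ toℕ i) (m+i<n′ (Fin.toℕ<n i)))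
            where
            lower : ∀ i → α (suc (m ℕ.+ toℕ i)) < μ⁺ i
            lower i with β-location (m ℕ.+ toℕ i) (m+i<n′ (Fin.toℕ<n i))
            ... | above _ α<β  = α<β
            ... | at-0 2k≡n _  = ⊥-elim (ℕ.<⇒≢ (above-half (toℕ i)) (≡.sym 2k≡n))
            ... | below 2k<n _ = ⊥-elim (ℕ.<-asym (above-half (toℕ i)) 2k<n)

          α⁻ : Fin (suc r) → Carrier
          α⁻ i = α (toℕ i)

          μ⁻ : Fin r → Carrier
          μ⁻ i = β (toℕ i) (i<n′ (Fin.toℕ<n i))

          α⁻-enumerates : Enumerates (IsRoot K[x] ∩ Negative) α⁻
          α⁻-enumerates = record
            { increasing = λ {i} {j} i<j → α-mono {toℕ i} {toℕ j} i<j
            ; sound      = λ i →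
                α-root {toℕ i} (ℕ.≤-trans (ℕ.m≤m+n _ _) (ℕ.<⇒≤ (below-half (ℕ.s≤s⁻¹ (Fin.toℕ<n i))))) ,
                α-neg {toℕ i} (below-half (ℕ.s≤s⁻¹ (Fin.toℕ<n i)))
            ; complete   = complete
            }
            where
            complete : ∀ x → x ∈ IsRoot K[x] ∩ Negative → ∃ λ i → x ≈ α⁻ i
            complete x (root , x<0) with α-complete x root
            ... | k , k≤n , x≈α = fromℕ< k<1+r , trans x≈α (reflexive (≡.cong α (≡.sym (Fin.toℕ-fromℕ< k<1+r))))
              where
              k<1+r : k ℕ.< suc r
              k<1+r with ℕ.<-≤-connex k (suc r)
              ... | inj₁ k<1+r = k<1+r
              ... | inj₂ r<k   = ⊥-elim (ℕ.<⇒≱ (α-neg⁻¹ {k} (<-respˡ-≈ x≈α x<0)) (ℕ.≤-trans n≤2r+2 (double-mono r<k)))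

          private
            β<α-below : ∀ i → μ⁻ i < α (suc (toℕ i))
            β<α-below i with β-location (toℕ i) (i<n′ (Fin.toℕ<n i))
            ... | above n<2k _ = ⊥-elim (ℕ.<-asym (below-half (Fin.toℕ<n i)) n<2k)
            ... | at-0 2k≡n _  = ⊥-elim (ℕ.<⇒≢ (below-half (Fin.toℕ<n i)) 2k≡n)
            ... | below _ β<α  = β<α

          μ⁻-enumerates : Enumerates (IsRoot M[x] ∩ Negative) μ⁻
          μ⁻-enumerates = record
            { increasing = λ {i} {j} i<j → β-mono (i<n′ (Fin.toℕ<n i)) (i<n′ (Fin.toℕ<n j)) i<j
            ; sound      = λ i → μ-root _ , <-trans (β<α-below i) (α-neg {suc (toℕ i)} (below-half (Fin.toℕ<n i)))
            ; complete   = complete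
            }
            where
            complete : ∀ x → x ∈ IsRoot M[x] ∩ Negative → ∃ λ i → x ≈ μ⁻ i
            complete x (root , x<0) with β-complete x root
            ... | k , k<n′ , x≈β = fromℕ< k<r ,
              trans x≈β (reflexive (≡.cong μ (Fin.fromℕ<-cong _ _ (≡.sym (Fin.toℕ-fromℕ< k<r)) k<n′ _)))
              where
              k<r : k ℕ.< r
              k<r with β-location k k<n′
              ... | above n<2k α<β = ⊥-elim (<-asym x<0 (<-respʳ-≈ (sym x≈β) (<-trans (α-pos {suc k} n<2k) α<β)))
              ... | at-0 _ β≈0     = ⊥-elim (<⇒≉ x<0 (trans x≈β β≈0))
              ... | below 2k<n _ with ℕ.<-≤-connex k r
              ...   | inj₁ k<r = k<r
              ...   | inj₂ r≤k = ⊥-elim (ℕ.<⇒≱ 2k<n (ℕ.≤-trans n≤2r+2 (double-mono (s≤s r≤k))))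

          negative-interlacing : (IsRoot M[x] ∩ Negative) StrictlyInterlaces (IsRoot K[x] ∩ Negative)
          negative-interlacing = r , α⁻ , μ⁻ , α⁻-enumerates , μ⁻-enumerates , λ i →
            <-respˡ-≈ (reflexive (≡.cong α (≡.sym (Fin.toℕ-inject₁ i)))) (α<β (toℕ i) (i<n′ (Fin.toℕ<n i))) ,
            β<α-below i

        -- The last argument reads ⌊(n′ + 1)/2⌋ ≤ ⌊(n′ + 2)/2⌋, the sides being ⌈n′/2⌉ and 1 +
        -- ⌊n′/2⌋ by definition.
        open HalfInterlacing ℕ.⌈ n′ /2⌉ ℕ.⌊ n′ /2⌋
          (≡.trans (ℕ.+-comm ℕ.⌈ n′ /2⌉ ℕ.⌊ n′ /2⌋) (ℕ.⌊n/2⌋+⌈n/2⌉≡n n′))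
          (ℕ.⌊n/2⌋≤⌈n/2⌉ n′) (ℕ.⌊n/2⌋-mono (ℕ.n≤1+n (suc n′))) public
          using (positive-interlacing; negative-interlacing)

        interlacings : Interlacings
        interlacings =
          (K-roots.all-roots-simple , K-roots.all-roots-real) ,
          (L-roots.all-roots-simple , L-roots.all-roots-real) ,
          (M-roots.all-roots-simple , M-roots.all-roots-real) ,
          L-interlaces-K , M-interlaces-L , positive-interlacing , negative-interlacing

    interlacings : Interlacings
    interlacings = RootsOfM.interlacings
      (λ i → proj₁ (M-root i))
      (λ i → proj₁ (proj₁ (proj₂ (M-root i))))
      (λ i → proj₂ (proj₁ (proj₂ (M-root i))))
      (λ i → proj₁ (proj₂ (proj₂ (M-root i))))
      (λ i → proj₂ (proj₂ (proj₂ (M-root i))))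
      where
      root : ∀ i → ∃ λ x → (α (toℕ i) < x × x < α (suc (toℕ i))) × IsRoot L[x] x
      root i = L-root (toℕ i) (Fin.toℕ<n i)
      open RootsOfL
        (λ i → proj₁ (root i))
        (λ i → proj₁ (proj₁ (proj₂ (root i))))
        (λ i → proj₂ (proj₁ (proj₂ (root i))))
        (λ i → proj₂ (proj₂ (root i)))

    private
      symmetric : ∀ p m o → (∀ x → eval p x ≈ D x m o) → RootsSymmetric p
      symmetric p m o eval-p x root = trans (eval-p (- x)) (trans (D-neg x m o)
        (trans (*-congˡ (trans (sym (eval-p x)) root)) (zeroʳ _)))

    K-symmetric : RootsSymmetric K[x]
    K-symmetric = symmetric K[x] (suc n) 0 eval-K

    L-symmetric : RootsSymmetric L[x]
    L-symmetric = symmetric L[x] n 1 eval-L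

    M-symmetric : RootsSymmetric M[x]
    M-symmetric = symmetric M[x] n′ 1 eval-M

-- The spans of differences of characters, as eigenspaces and as representations

module SpanOfDifferences {ℓ} (ℝ : RealNumbers ℓ) where
  open RealNumbers ℝ hiding (zero)
  open IntegerSolver commutativeRing
  open OrderedField ℝ
  open Spectra ℝ hiding (0#; _≈_)
  open HypercubeFourier ℝ
  open SetoidReasoning setoid

  record IsLinear {n} (Φ : V n → Carrier) : Set ℓ where
    field
      cong   : ∀ {f g} → f ≈ᴹ g → Φ f ≈ Φ g
      +-homo : ∀ f g → Φ (f +ᴹ g) ≈ Φ f + Φ g
      *-homo : ∀ c f → Φ (c *ₗ f) ≈ c * Φ f

    0-homo : Φ 0ᴹ ≈ 0#
    0-homo = trans (cong λ u → sym (zeroˡ 0#)) (trans (*-homo 0# 0ᴹ) (zeroˡ _))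

    neg-homo : ∀ f → Φ (-ᴹ f) ≈ - Φ f
    neg-homo f = trans (cong λ u → solve 1 (λ x → :- x := :- :1 :* x) refl (f u))
      (trans (*-homo (- 1#) f) (solve 1 (λ x → :- :1 :* x := :- x) refl (Φ f)))

    difference-homo : ∀ f g → Φ (f +ᴹ -ᴹ g) ≈ Φ f - Φ g
    difference-homo f g = trans (+-homo f (-ᴹ g)) (+-congˡ (neg-homo g))
  open IsLinear

  span-kernel : ∀ {n} {Φ : V n → Carrier} → IsLinear Φ → {G : Pred (V n) ℓ} →
                (∀ {f} → f ∈ G → Φ f ≈ 0#) → ∀ {f} → f ∈ span G → Φ f ≈ 0#
  span-kernel Φ-linear G⊆ (generator f∈G)  = G⊆ f∈G
  span-kernel Φ-linear G⊆ 0∈               = 0-homo Φ-linear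
  span-kernel Φ-linear G⊆ (+∈ {f} {g} f∈ g∈) = trans (+-homo Φ-linear f g)
    (trans (+-cong (span-kernel Φ-linear G⊆ f∈) (span-kernel Φ-linear G⊆ g∈)) (+-identityˡ 0#))
  span-kernel Φ-linear G⊆ (*∈ c {f} f∈)    = trans (*-homo Φ-linear c f)
    (trans (*-congˡ (span-kernel Φ-linear G⊆ f∈)) (zeroʳ c))
  span-kernel Φ-linear G⊆ (resp f≈g f∈)    = trans (sym (cong Φ-linear f≈g)) (span-kernel Φ-linear G⊆ f∈)

  value-linear : ∀ {n} (u : Vertex n) → IsLinear λ f → f u
  value-linear u .cong f≈g     = f≈g u
  value-linear u .+-homo f g   = refl
  value-linear u .*-homo c f   = refl

  ^-linear : ∀ {n} (u : Vertex n) → IsLinear λ f → (f ^) u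
  ^-linear u .cong f≈g   = ^-cong f≈g u
  ^-linear u .+-homo f g = ^-+ f g u
  ^-linear u .*-homo c f = ^-* c f u

  scale-linear : ∀ {n} {Φ : V n → Carrier} c → IsLinear Φ → IsLinear λ f → c * Φ f
  scale-linear c Φ-linear .cong f≈g     = *-congˡ (cong Φ-linear f≈g)
  scale-linear c Φ-linear .+-homo f g   = trans (*-congˡ (+-homo Φ-linear f g)) (distribˡ c _ _)
  scale-linear c Φ-linear .*-homo d f   = trans (*-congˡ (*-homo Φ-linear d f))
    (solve 3 (λ c d x → c :* (d :* x) := d :* (c :* x)) refl c d _)

  -linear : ∀ {n} {Φ Ψ : V n → Carrier} → IsLinear Φ → IsLinear Ψ → IsLinear λ f → Φ f - Ψ f
  -linear Φ-linear Ψ-linear .cong f≈g   = +-cong (cong Φ-linear f≈g) (-‿cong (cong Ψ-linear f≈g))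
  -linear Φ-linear Ψ-linear .+-homo f g = trans (+-cong (+-homo Φ-linear f g) (-‿cong (+-homo Ψ-linear f g)))
    (solve 4 (λ a b c d → (a :+ b) :- (c :+ d) := (a :- c) :+ (b :- d)) refl _ _ _ _)
  -linear Φ-linear Ψ-linear .*-homo c f = trans (+-cong (*-homo Φ-linear c f) (-‿cong (*-homo Ψ-linear c f)))
    (solve 3 (λ c a b → c :* a :- c :* b := c :* (a :- b)) refl c _ _)

  ∑ᵥ-linear : ∀ {m n} {Φ : Vertex m → V n → Carrier} → (∀ u → IsLinear (Φ u)) → IsLinear λ f → ∑ᵥ λ u → Φ u f
  ∑ᵥ-linear {m} linear .cong f≈g   = ∑ᵥ-cong {m} λ u → cong (linear u) f≈g
  ∑ᵥ-linear {m} {Φ = Φ} linear .+-homo f g =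
    trans (∑ᵥ-cong {m} λ u → +-homo (linear u) f g) (∑ᵥ-+ {m} (λ u → Φ u f) (λ u → Φ u g))
  ∑ᵥ-linear {m} {Φ = Φ} linear .*-homo c f =
    trans (∑ᵥ-cong {m} λ u → *-homo (linear u) c f) (∑ᵥ-* {m} c (λ u → Φ u f))

  N-linear : ∀ {n} (w : Vertex n) → IsLinear λ f → N f w
  N-linear w = ∑ᵥ-linear λ u → record
    { cong   = λ f≈g → *-congʳ (f≈g u)
    ; +-homo = λ f g → distribʳ _ (f u) (g u)
    ; *-homo = λ c f → *-assoc c (f u) _
    }

  weightSum : ∀ {n} → ℕ → V n → Carrier
  weightSum k f = ∑ᵥ λ u → e k u * f u

  ^-weightSum-linear : ∀ {n} k → IsLinear {n} λ f → weightSum k (f ^)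
  ^-weightSum-linear k = ∑ᵥ-linear λ u → scale-linear (e k u) (^-linear u)

  module _ {n k : ℕ} where

    -- The properties of the span that follow are each cast as the vanishing of such a functional,
    -- so they need only be checked on single characters.
    differences-kernel : {Φ : V n → Carrier} → IsLinear Φ → (∀ u v → ω u ≡ k → ω v ≡ k → Φ (E u) ≈ Φ (E v)) →
                         ∀ {f} → f ∈ V̂̂[ n -2* k ] → Φ f ≈ 0#
    differences-kernel {Φ} Φ-linear equal = span-kernel Φ-linear λ (u , v , ωu≡k , ωv≡k , f≈) →
      trans (cong Φ-linear f≈) (trans (difference-homo Φ-linear (E u) (E v))
        (trans (+-congʳ (equal u v ωu≡k ωv≡k)) (-‿inverseʳ _)))

    differences-𝟎 : ∀ {f} → f ∈ V̂̂[ n -2* k ] → f 𝟎 ≈ 0#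
    differences-𝟎 = differences-kernel (value-linear 𝟎) λ u v _ _ →
      trans (trans (E-sym u 𝟎) (E-𝟎 u)) (sym (trans (E-sym v 𝟎) (E-𝟎 v)))

    differences-𝟏 : ∀ {f} → f ∈ V̂̂[ n -2* k ] → f 𝟏 ≈ 0#
    differences-𝟏 = differences-kernel (value-linear 𝟏) λ u v ωu≡k ωv≡k →
      trans (at-𝟏 u) (trans (reflexive (≡.cong ε (≡.trans ωu≡k (≡.sym ωv≡k)))) (sym (at-𝟏 v)))
      where
      at-𝟏 : ∀ u → E u 𝟏 ≈ ε (ω u)
      at-𝟏 u = trans (E-sym u 𝟏) (E-𝟏 u)

    differences-eigen : ∀ {f} → f ∈ V̂̂[ n -2* k ] → ∀ w → N f w ≈ κ n k * f w
    differences-eigen {f} f∈ w = begin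
      N f w                                        ≈⟨ solve 2 (λ x y → x := (x :- y) :+ y) refl _ _ ⟩
      (N f w - κ n k * f w) + κ n k * f w          ≈⟨ +-congʳ (differences-kernel
                                                        (-linear (N-linear w) (scale-linear (κ n k) (value-linear w)))
                                                        (λ u v ωu≡k ωv≡k → trans (vanishing u ωu≡k) (sym (vanishing v ωv≡k))) f∈) ⟩
      0# + κ n k * f w                             ≈⟨ +-identityˡ _ ⟩
      κ n k * f w                                  ∎
      where
      vanishing : ∀ u → ω u ≡ k → N (E u) w - κ n k * E u w ≈ 0#
      vanishing u ≡.refl = trans (+-congʳ (E-eigenvector u w)) (-‿inverseʳ _)

    differences-^ : ∀ {f} → f ∈ V̂̂[ n -2* k ] → ∀ w → ω w ≢ k → (f ^) w ≈ 0#
    differences-^ f∈ w ωw≢k = differences-kernel (^-linear w) (λ u v ωu≡k ωv≡k →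
      trans (off u ωu≡k) (sym (off v ωv≡k))) f∈
      where
      off : ∀ u → ω u ≡ k → (E u ^) w ≈ 0#
      off u ωu≡k = E^-off-diagonal u w λ u≡w → ωw≢k (≡.trans (≡.cong ω (≡.sym u≡w)) ωu≡k)

    -- The transform of `E u` is 2ⁿ at u and 0 elsewhere, so its sum over weight j depends on ω(u)
    -- only.
    differences-weightSum : ∀ {f} → f ∈ V̂̂[ n -2* k ] → ∀ j → weightSum j (f ^) ≈ 0#
    differences-weightSum f∈ j = differences-kernel (^-weightSum-linear j) (λ u v ωu≡k ωv≡k →
      trans (at u) (trans (*-congʳ (reflexive (≡.cong (λ i → if does (i ℕ.≟ j) then 1# else 0#) (≡.trans ωu≡k (≡.sym ωv≡k)))))
        (sym (at v)))) f∈
      where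
      at : ∀ u → weightSum j (E u ^) ≈ e j u * 2^ n
      at u = trans
        (∑ᵥ-single {n} {λ w → e j w * (E u ^) w} u λ w w≢u →
          trans (*-congˡ (E^-off-diagonal u w (w≢u ∘ ≡.sym))) (zeroʳ _))
        (*-congˡ (E^-diagonal u))

    -- On the character `E u` both sides are 2ⁿ if σ u = w and 0 otherwise.
    differences-^-permute : ∀ σ {f} → f ∈ V̂̂[ n -2* k ] → ∀ w → (act σ f ^) w ≈ (f ^) (permute (Perm.flip σ) w)
    differences-^-permute σ {f} f∈ w = begin
      (act σ f ^) w
        ≈⟨ solve 2 (λ x y → x := (x :- y) :+ y) refl _ _ ⟩
      ((act σ f ^) w - (f ^) (permute (Perm.flip σ) w)) + (f ^) (permute (Perm.flip σ) w)
        ≈⟨ +-congʳ (differences-kernel (-linear act-^-linear (^-linear (permute (Perm.flip σ) w)))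
             (λ u v _ _ → trans (vanishing u) (sym (vanishing v))) f∈) ⟩
      0# + (f ^) (permute (Perm.flip σ) w)
        ≈⟨ +-identityˡ _ ⟩
      (f ^) (permute (Perm.flip σ) w)  ∎
      where
      open Action (vecAction n Parity) using (act-∘; act-cong; act-id)
      act-^-linear : IsLinear λ f → (act σ f ^) w
      act-^-linear .cong f≈g   = ^-cong (λ v → f≈g (permute (Perm.flip σ) v)) w
      act-^-linear .+-homo f g = ^-+ (act σ f) (act σ g) w
      act-^-linear .*-homo c f = ^-* c (act σ f) w
      permute-flip : ∀ u → permute σ (permute (Perm.flip σ) u) ≡ u
      permute-flip u = ≡.trans (≡.sym (act-∘ σ (Perm.flip σ) u))
        (≡.trans (act-cong {Perm.flip σ Perm.∘ₚ σ} {Perm.id} (λ i → Perm.inverseʳ σ) u) (act-id u))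
      flip-permute : ∀ u → permute (Perm.flip σ) (permute σ u) ≡ u
      flip-permute u = ≡.trans (≡.sym (act-∘ (Perm.flip σ) σ u))
        (≡.trans (act-cong {σ Perm.∘ₚ Perm.flip σ} {Perm.id} (λ i → Perm.inverseˡ σ) u) (act-id u))
      E-permute : ∀ u → act σ (E u) ≈ᴹ E (permute σ u)
      E-permute u v = reflexive (≡.cong sign (≡.sym (∙-permute σ u v)))
      equal : ∀ u → Dec (u ≡ permute (Perm.flip σ) w) → (act σ (E u) ^) w ≈ (E u ^) (permute (Perm.flip σ) w)
      equal u (yes ≡.refl) = trans (^-cong (E-permute u) w)
        (trans (reflexive (≡.cong (λ x → (E x ^) w) (permute-flip w))) (trans (E^-diagonal w) (sym (E^-diagonal u))))
      equal u (no u≢) = trans (^-cong (E-permute u) w)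
        (trans (E^-off-diagonal (permute σ u) w
          (λ σu≡w → u≢ (≡.trans (≡.sym (flip-permute u)) (≡.cong (permute (Perm.flip σ)) σu≡w))))
          (sym (E^-off-diagonal u (permute (Perm.flip σ) w) u≢)))
      vanishing : ∀ u → (act σ (E u) ^) w - (E u ^) (permute (Perm.flip σ) w) ≈ 0#
      vanishing u = trans (+-congʳ (equal u (u ≟ᵥ permute (Perm.flip σ) w))) (-‿inverseʳ _)

  -- Eigenvectors of the induced subgraphs

  inside-eigenspace : ∀ {n} {G : Pred (Vertex n) 0ℓ} (G? : ∀ u → Dec (G u)) {f : V n} {x} →
    (∀ u → ¬ G u → f u ≈ 0#) → (∀ w → G w → N f w ≈ x * f w) → f ∈ Eigenspace G? x
  inside-eigenspace {G = G} G? {f} {x} supported eigen w = by-cases (G? w)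
    where
    by-cases : Dec (G w) → A G? f w ≈ x * f w
    by-cases (yes Gw) = trans (A-inside G? supported w Gw) (eigen w Gw)
    by-cases (no ¬Gw) = trans (A-outside G? f w ¬Gw) (sym (trans (*-congˡ (supported w ¬Gw)) (zeroʳ x)))

  eigenspace-inside : ∀ {n} {G : Pred (Vertex n) 0ℓ} (G? : ∀ u → Dec (G u)) {f : V n} {x} →
    (∀ u → ¬ G u → f u ≈ 0#) → f ∈ Eigenspace G? x → ∀ w → G w → N f w ≈ x * f w
  eigenspace-inside G? supported f∈ w Gw = trans (sym (A-inside G? supported w Gw)) (f∈ w)

  supported-Q̂ : ∀ {n} {f : V n} → f 𝟎 ≈ 0# → ∀ u → ¬ u ≢ 𝟎 → f u ≈ 0#
  supported-Q̂ f𝟎≈0 u ¬u≢𝟎 with u ≟ᵥ 𝟎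
  ... | yes ≡.refl = f𝟎≈0
  ... | no u≢𝟎     = ⊥-elim (¬u≢𝟎 u≢𝟎)

  supported-Q̂̂ : ∀ {n} {f : V n} → f 𝟎 ≈ 0# → f 𝟏 ≈ 0# → ∀ u → ¬ (u ≢ 𝟎 × u ≢ 𝟏) → f u ≈ 0#
  supported-Q̂̂ f𝟎≈0 f𝟏≈0 u ¬inside with u ≟ᵥ 𝟎 | u ≟ᵥ 𝟏
  ... | yes ≡.refl | _          = f𝟎≈0
  ... | no _       | yes ≡.refl = f𝟏≈0
  ... | no u≢𝟎     | no u≢𝟏     = ⊥-elim (¬inside (u≢𝟎 , u≢𝟏))

  differences⊆Q̂-eigenspace : ∀ n k → V̂̂[ n -2* k ] ⊆ Eigenspace Q̂? (κ n k)
  differences⊆Q̂-eigenspace n k f∈ = inside-eigenspace Q̂? (supported-Q̂ (differences-𝟎 {n} {k} f∈))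
    λ w _ → differences-eigen {n} {k} f∈ w

  differences⊆Q̂̂-eigenspace : ∀ n k → V̂̂[ n -2* k ] ⊆ Eigenspace Q̂̂? (κ n k)
  differences⊆Q̂̂-eigenspace n k f∈ =
    inside-eigenspace Q̂̂? (supported-Q̂̂ (differences-𝟎 {n} {k} f∈) (differences-𝟏 {n} {k} f∈))
      λ w _ → differences-eigen {n} {k} f∈ w

  -- Membership in V̂̂ₙ₋₂ₖ is a condition on the Fourier transform

  ∑ᵥ∈span : ∀ {m n} {G : Pred (V n) ℓ} (F : Vertex m → V n) → (∀ u → F u ∈ span G) →
            (λ v → ∑ᵥ λ u → F u v) ∈ span G
  ∑ᵥ∈span {zero}  F F∈ = F∈ []
  ∑ᵥ∈span {suc m} F F∈ = +∈ (∑ᵥ∈span (F ∘ (0ℙ ∷_)) (F∈ ∘ (0ℙ ∷_))) (∑ᵥ∈span (F ∘ (1ℙ ∷_)) (F∈ ∘ (1ℙ ∷_)))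

  -- As the coefficients have sum 0, one fixed character of weight k may be subtracted from all the
  -- others without changing their combination.
  level^∈differences : ∀ {n k} → k ℕ.≤ n → (g : V n) → weightSum k g ≈ 0# →
                       (λ u → e k u * g u) ^ ∈ V̂̂[ n -2* k ]
  level^∈differences {n} {k} k≤n g ∑g≈0 = resp equal (∑ᵥ∈span F F∈)
    where
    base : Vertex n
    base = leadingOnes n k
    F : Vertex n → V n
    F u = (e k u * g u) *ₗ (E u +ᴹ -ᴹ E base)
    F∈ : ∀ u → F u ∈ V̂̂[ n -2* k ]
    F∈ u = by-cases (ω u ℕ.≟ k)
      where
      by-cases : Dec (ω u ≡ k) → F u ∈ V̂̂[ n -2* k ]
      by-cases (yes ωu≡k) = *∈ (e k u * g u)
        (generator (u , base , ωu≡k , ω-leadingOnes n k≤n , λ v → refl))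
      by-cases (no ωu≢k)  = resp (λ v → sym (trans (*-congʳ (trans (*-congʳ (e-elsewhere k u ωu≢k)) (zeroˡ _))) (zeroˡ _))) 0∈
    equal : (λ v → ∑ᵥ λ u → F u v) ≈ᴹ (λ u → e k u * g u) ^
    equal v = begin
      ∑ᵥ {n} (λ u → (e k u * g u) * (E u v - E base v))
        ≈⟨ ∑ᵥ-cong {n} (λ u → solve 3 (λ x y z → x :* (y :- z) := x :* y :+ :- z :* x) refl (e k u * g u) (E u v) (E base v)) ⟩
      ∑ᵥ {n} ((λ u → (e k u * g u) * E u v) +ᴹ (- E base v *ₗ (λ u → e k u * g u)))
        ≈⟨ ∑ᵥ-+ {n} (λ u → (e k u * g u) * E u v) (- E base v *ₗ (λ u → e k u * g u)) ⟩
      ∑ᵥ {n} (λ u → (e k u * g u) * E u v) + ∑ᵥ {n} (- E base v *ₗ (λ u → e k u * g u))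
        ≈⟨ +-cong (∑ᵥ-cong {n} λ u → *-congˡ (E-sym u v))
             (trans (∑ᵥ-* {n} (- E base v) (λ u → e k u * g u)) (trans (*-congˡ ∑g≈0) (zeroʳ _))) ⟩
      ∑ᵥ {n} (λ u → (e k u * g u) * E v u) + 0#
        ≈⟨ +-identityʳ _ ⟩
      ∑ᵥ {n} (λ u → (e k u * g u) * E v u)  ∎

  -- The projection to the part of weight k and mean zero, on the Fourier side.
  module Projection {n k} (k≤n : k ℕ.≤ n) (g : V n) where

    mean : Carrier
    mean = weightSum k g * (levelSize n k) ⁻¹

    projection : V n
    projection = (2^ n) ⁻¹ *ₗ (λ u → e k u * (g u - mean)) ^

    projection∈ : projection ∈ V̂̂[ n -2* k ]
    projection∈ = *∈ ((2^ n) ⁻¹) (level^∈differences k≤n (λ u → g u - mean) (begin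
      ∑ᵥ {n} (λ u → e k u * (g u - mean))
        ≈⟨ ∑ᵥ-cong {n} (λ u → solve 3 (λ e g m → e :* (g :- m) := e :* g :+ :- m :* e) refl (e k u) (g u) mean) ⟩
      ∑ᵥ {n} ((λ u → e k u * g u) +ᴹ (- mean *ₗ e k))
        ≈⟨ ∑ᵥ-+ {n} (λ u → e k u * g u) (- mean *ₗ e k) ⟩
      weightSum k g + ∑ᵥ {n} (- mean *ₗ e k)
        ≈⟨ +-congˡ (∑ᵥ-* {n} (- mean) (e k)) ⟩
      weightSum k g + - (weightSum k g * (levelSize n k) ⁻¹) * levelSize n k
        ≈⟨ solve 3 (λ w i s → w :+ :- (w :* i) :* s := w :- w :* (s :* i)) refl _ _ _ ⟩
      weightSum k g - weightSum k g * (levelSize n k * (levelSize n k) ⁻¹)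
        ≈⟨ +-congˡ (-‿cong (trans (*-congˡ (⁻¹-inverseʳ (levelSize≉0 k≤n))) (*-identityʳ _))) ⟩
      weightSum k g - weightSum k g
        ≈⟨ -‿inverseʳ _ ⟩
      0#  ∎))

    projection^ : ∀ u → (projection ^) u ≈ e k u * (g u - mean)
    projection^ u = begin
      (projection ^) u
        ≈⟨ ^-* ((2^ n) ⁻¹) ((λ u → e k u * (g u - mean)) ^) u ⟩
      (2^ n) ⁻¹ * (((λ u → e k u * (g u - mean)) ^) ^) u
        ≈⟨ *-congˡ (^-involutive (λ u → e k u * (g u - mean)) u) ⟩
      (2^ n) ⁻¹ * (2^ n * (e k u * (g u - mean)))
        ≈⟨ solve 3 (λ i t x → i :* (t :* x) := (t :* i) :* x) refl _ _ _ ⟩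
      (2^ n * (2^ n) ⁻¹) * (e k u * (g u - mean))
        ≈⟨ trans (*-congʳ (⁻¹-inverseʳ (2^≉0 n))) (*-identityˡ _) ⟩
      e k u * (g u - mean)  ∎

  -- V̂̂ₙ₋₂ₖ ⊕ trivial ≅ k-subsets

  toParity : Bool → Parity
  toParity false = 0ℙ
  toParity true  = 1ℙ

  fromParity : Parity → Bool
  fromParity 0ℙ = false
  fromParity 1ℙ = true

  χ : ∀ {n} → Subset n → Vertex n
  χ = Vec.map toParity

  χ⁻¹ : ∀ {n} → Vertex n → Subset n
  χ⁻¹ = Vec.map fromParity

  χ-χ⁻¹ : ∀ {n} (u : Vertex n) → χ (χ⁻¹ u) ≡ u
  χ-χ⁻¹ []       = ≡.refl
  χ-χ⁻¹ (0ℙ ∷ u) = ≡.cong (0ℙ ∷_) (χ-χ⁻¹ u)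
  χ-χ⁻¹ (1ℙ ∷ u) = ≡.cong (1ℙ ∷_) (χ-χ⁻¹ u)

  χ⁻¹-χ : ∀ {n} (p : Subset n) → χ⁻¹ (χ p) ≡ p
  χ⁻¹-χ []          = ≡.refl
  χ⁻¹-χ (false ∷ p) = ≡.cong (false ∷_) (χ⁻¹-χ p)
  χ⁻¹-χ (true ∷ p)  = ≡.cong (true ∷_) (χ⁻¹-χ p)

  ω-χ : ∀ {n} (p : Subset n) → ω (χ p) ≡ ∣ p ∣
  ω-χ []          = ≡.refl
  ω-χ (false ∷ p) = ω-χ p
  ω-χ (true ∷ p)  = ≡.cong suc (ω-χ p)

  ∣χ⁻¹∣ : ∀ {n} (u : Vertex n) → ∣ χ⁻¹ u ∣ ≡ ω u
  ∣χ⁻¹∣ u = ≡.trans (≡.sym (ω-χ (χ⁻¹ u))) (≡.cong ω (χ-χ⁻¹ u))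

  χ-permute : ∀ {n} σ (p : Subset n) → χ (permute σ p) ≡ permute σ (χ p)
  χ-permute σ p = ≡.trans (≡.sym (Vec.tabulate-∘ toParity λ i → lookup p (σ ⟨$⟩ˡ i)))
    (Vec.tabulate-cong λ i → ≡.sym (Vec.lookup-map (σ ⟨$⟩ˡ i) toParity p))

  module KSubsetIsomorphism {n k : ℕ} (k≤n : k ℕ.≤ n) where
    private
      module Source = Representation (V̂̂Rep n k ⊕ trivial n)
      module Target = Representation (kSubsetRep n k)

    -- The transform of f has mean 0 over weight k, so the trivial summand c becomes the mean of the
    -- function on k-subsets.
    to : Source.Carrierᴹ → Target.Carrierᴹ
    to ((f , _) , c) (p , _) = (f ^) (χ p) + c

    private
      injective : ∀ {x y} → to x Target.≈ᴹ to y → x Source.≈ᴹ y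
      injective {(f , f∈) , c} {(g , g∈) , d} equal = ^-injective f g f^≈g^ , c≈d
        where
        on-level : ∀ u → ω u ≡ k → (f ^) u + c ≈ (g ^) u + d
        on-level u ωu≡k = ≡.subst (λ v → (f ^) v + c ≈ (g ^) v + d) (χ-χ⁻¹ u)
          (equal (χ⁻¹ u , ≡.trans (∣χ⁻¹∣ u) ωu≡k))
        total : ∀ {f} → f ∈ V̂̂[ n -2* k ] → ∀ c → ∑ᵥ {n} (λ u → e k u * ((f ^) u + c)) ≈ levelSize n k * c
        total {f} f∈ c = begin
          ∑ᵥ {n} (λ u → e k u * ((f ^) u + c))
            ≈⟨ ∑ᵥ-cong {n} (λ u → distribˡ (e k u) ((f ^) u) c) ⟩
          ∑ᵥ {n} ((λ u → e k u * (f ^) u) +ᴹ (λ u → e k u * c))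
            ≈⟨ ∑ᵥ-+ {n} (λ u → e k u * (f ^) u) (λ u → e k u * c) ⟩
          weightSum k (f ^) + ∑ᵥ {n} (λ u → e k u * c)
            ≈⟨ +-cong (differences-weightSum {n} {k} f∈ k) (∑ᵥ-*ʳ {n} (e k) c) ⟩
          0# + levelSize n k * c
            ≈⟨ +-identityˡ _ ⟩
          levelSize n k * c  ∎
        pointwise : ∀ u → Dec (ω u ≡ k) → e k u * ((f ^) u + c) ≈ e k u * ((g ^) u + d)
        pointwise u (yes ωu≡k) = *-congˡ (on-level u ωu≡k)
        pointwise u (no ωu≢k)  = trans (trans (*-congʳ (e-elsewhere k u ωu≢k)) (zeroˡ _))
          (sym (trans (*-congʳ (e-elsewhere k u ωu≢k)) (zeroˡ _)))
        c≈d : c ≈ d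
        c≈d = *-cancelˡ (levelSize≉0 k≤n) (trans (sym (total f∈ c))
          (trans (∑ᵥ-cong {n} λ u → pointwise u (ω u ℕ.≟ k)) (total g∈ d)))
        at : ∀ u → Dec (ω u ≡ k) → (f ^) u ≈ (g ^) u
        at u (yes ωu≡k) = begin
          (f ^) u              ≈⟨ solve 2 (λ x c → x := (x :+ c) :- c) refl _ c ⟩
          ((f ^) u + c) - c    ≈⟨ +-cong (on-level u ωu≡k) (-‿cong c≈d) ⟩
          ((g ^) u + d) - d    ≈⟨ solve 2 (λ x c → (x :+ c) :- c := x) refl _ d ⟩
          (g ^) u              ∎
        at u (no ωu≢k)  = trans (differences-^ {n} {k} f∈ u ωu≢k) (sym (differences-^ {n} {k} g∈ u ωu≢k))
        f^≈g^ : f ^ ≈ᴹ g ^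
        f^≈g^ u = at u (ω u ℕ.≟ k)

      to-cong : ∀ {x y} → x Source.≈ᴹ y → to x Target.≈ᴹ to y
      to-cong (f≈g , c≈d) (p , _) = +-cong (^-cong f≈g (χ p)) c≈d

      module Preimage (h : Target.Carrierᴹ) where
        -- The value 0 at other weights is arbitrary: the projection and the mean see only weight k.
        extension : (u : Vertex n) → Dec (ω u ≡ k) → Carrier
        extension u (yes ωu≡k) = h (χ⁻¹ u , ≡.trans (∣χ⁻¹∣ u) ωu≡k)
        extension u (no _)     = 0#

        g : V n
        g u = extension u (ω u ℕ.≟ k)

        open Projection k≤n g

        preimage : Source.Carrierᴹ
        preimage = (projection , projection∈) , mean

        extension-χ : ∀ p ∣p∣≡k d → extension (χ p) d ≈ h (p , ∣p∣≡k)
        extension-χ p ∣p∣≡k (yes ωχp≡k) = reflexive (≡.cong h (Σ-≡,≡→≡ (χ⁻¹-χ p , ℕ.≡-irrelevant _ _)))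
        extension-χ p ∣p∣≡k (no ωχp≢k)  = ⊥-elim (ωχp≢k (≡.trans (ω-χ p) ∣p∣≡k))

        to-preimage : to preimage Target.≈ᴹ h
        to-preimage (p , ∣p∣≡k) = begin
          (projection ^) (χ p) + mean
            ≈⟨ +-congʳ (projection^ (χ p)) ⟩
          e k (χ p) * (g (χ p) - mean) + mean
            ≈⟨ +-congʳ (*-congʳ (e-value k (χ p) (≡.trans (ω-χ p) ∣p∣≡k))) ⟩
          1# * (g (χ p) - mean) + mean
            ≈⟨ solve 2 (λ g m → :1 :* (g :- m) :+ m := g) refl _ _ ⟩
          g (χ p)
            ≈⟨ extension-χ p ∣p∣≡k (ω (χ p) ℕ.≟ k) ⟩
          h (p , ∣p∣≡k)  ∎

    isomorphism : V̂̂Rep n k ⊕ trivial n ≅ kSubsetRep n k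
    isomorphism = record
      { to            = to
      ; isIsomorphism = record
        { isLeftModuleMonomorphism = record
          { isLeftModuleHomomorphism = record
            { +ᴹ-isGroupHomomorphism = record
              { isMonoidHomomorphism = record
                { isMagmaHomomorphism = record
                  { isRelHomomorphism = record { cong = λ {x} {y} → to-cong {x} {y} }
                  ; homo = λ ((f , _) , c) ((g , _) , d) (p , _) → trans (+-congʳ (^-+ f g (χ p)))
                      (solve 4 (λ x y c d → (x :+ y) :+ (c :+ d) := (x :+ c) :+ (y :+ d)) refl _ _ c d)
                  }
                ; ε-homo = λ (p , _) → trans (+-identityʳ _) (^-0 (χ p))
                }
              ; ⁻¹-homo = λ ((f , _) , c) (p , _) → trans (+-congʳ (^-neg f (χ p)))
                  (solve 2 (λ x c → :- x :+ :- c := :- (x :+ c)) refl _ c)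
              }
            ; *ₗ-homo = λ a ((f , _) , c) (p , _) → trans (+-congʳ (^-* a f (χ p))) (sym (distribˡ a _ c))
            }
          ; injective = λ {x} {y} → injective {x} {y}
          }
        ; surjective = λ h → Preimage.preimage h , λ {x} x≈ (p , ∣p∣≡k) →
            trans (to-cong {x} {Preimage.preimage h} x≈ (p , ∣p∣≡k)) (Preimage.to-preimage h (p , ∣p∣≡k))
        }
      ; equivariant   = λ σ ((f , f∈) , c) (p , _) → +-congʳ (trans (differences-^-permute {n} {k} σ f∈ (χ p))
          (reflexive (≡.cong (f ^) (≡.sym (χ-permute (Perm.flip σ) p)))))
      }

-- Radial eigenvectors of the two induced subgraphs, and the kernel for even n

module RadialEigenspaces {ℓ} (ℝ : RealNumbers ℓ) (n′ : ℕ) where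
  open RealNumbers ℝ hiding (zero)
  open IntegerSolver commutativeRing
  open OrderedField ℝ
  open Spectra ℝ hiding (0#; _≈_)
  open HypercubeFourier ℝ
  open WeightSums ℝ using (^-poles)
  open SpanOfDifferences ℝ
  open Spectrum ℝ n′
  open SetoidReasoning setoid

  -- For t = n and t = n - 1 these are the vertices of the two subgraphs, so one argument serves
  -- both.
  Between : ℕ → Vertex n → Set
  Between t u = 1 ℕ.≤ ω u × ω u ℕ.≤ t

  between? : ∀ t u → Dec (Between t u)
  between? t u = (1 ℕ.≤? ω u) ×-dec (ω u ℕ.≤? t)

  Supported : ℕ → V n → Set ℓ
  Supported t f = ∀ u → ¬ Between t u → f u ≈ 0#

  module _ {G : Pred (V n) ℓ} {t : ℕ} where

    span⇒radial : (∀ {f} → f ∈ G → ∃ λ k → 1 ℕ.≤ k × k ℕ.≤ t × f ≈ᴹ e k) →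
                  ∀ {f} → f ∈ span G → Radial f × Supported t f
    span⇒radial G⇒ (generator f∈G) with G⇒ f∈G
    ... | k , 1≤k , k≤t , f≈ = ((λ j → if does (j ℕ.≟ k) then 1# else 0#) , f≈) ,
      λ u outside → trans (f≈ u) (e-elsewhere k u λ { ≡.refl → outside (1≤k , k≤t) })
    span⇒radial G⇒ 0∈ = ((λ _ → 0#) , λ u → refl) , λ u _ → refl
    span⇒radial G⇒ (+∈ f∈ g∈) with span⇒radial G⇒ f∈ | span⇒radial G⇒ g∈
    ... | (φ , f≈) , f≈0 | (ψ , g≈) , g≈0 =
      ((λ k → φ k + ψ k) , λ u → +-cong (f≈ u) (g≈ u)) ,
      λ u outside → trans (+-cong (f≈0 u outside) (g≈0 u outside)) (+-identityˡ 0#)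
    span⇒radial G⇒ (*∈ c f∈) with span⇒radial G⇒ f∈
    ... | (φ , f≈) , f≈0 =
      ((λ k → c * φ k) , λ u → *-congˡ (f≈ u)) , λ u outside → trans (*-congˡ (f≈0 u outside)) (zeroʳ c)
    span⇒radial G⇒ (resp f≈g f∈) with span⇒radial G⇒ f∈
    ... | (φ , f≈) , f≈0 =
      (φ , λ u → trans (sym (f≈g u)) (f≈ u)) , λ u outside → trans (sym (f≈g u)) (f≈0 u outside)

    -- The combination of the `e k` with coefficients φ k is built up weight by weight; its stage m
    -- already agrees with φ at the weights 1, ..., m.
    radial⇒span : (∀ k → 1 ℕ.≤ k → k ℕ.≤ t → e k ∈ span G) → ∀ {f} → Radial f → Supported t f → f ∈ span G
    radial⇒span e∈ {f} (φ , f≈) supported = resp (λ u → partial≈f u (between? t u)) (partial∈ t ℕ.≤-refl)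
      where
      partial : ℕ → V n
      partial zero    = 0ᴹ
      partial (suc m) = partial m +ᴹ (φ (suc m) *ₗ e (suc m))
      partial∈ : ∀ m → m ℕ.≤ t → partial m ∈ span G
      partial∈ zero    m≤t = 0∈
      partial∈ (suc m) m<t = +∈ (partial∈ m (ℕ.<⇒≤ m<t)) (*∈ (φ (suc m)) (e∈ (suc m) (s≤s z≤n) m<t))
      add-0 : ∀ m u → ω u ≢ suc m → partial (suc m) u ≈ partial m u
      add-0 m u ωu≢ = trans (+-congˡ (trans (*-congˡ (e-elsewhere (suc m) u ωu≢)) (zeroʳ _))) (+-identityʳ _)
      outside-0 : ∀ m u → ¬ Between m u → partial m u ≈ 0#
      outside-0 zero    u _       = refl
      outside-0 (suc m) u outside = trans
        (add-0 m u λ ωu≡ → outside (≡.subst (1 ℕ.≤_) (≡.sym ωu≡) (s≤s z≤n) , ℕ.≤-reflexive ωu≡))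
        (outside-0 m u λ (1≤ωu , ωu≤m) → outside (1≤ωu , ℕ.m≤n⇒m≤1+n ωu≤m))
      inside-φ : ∀ m u → Between m u → partial m u ≈ φ (ω u)
      inside-φ zero    u (1≤ωu , ωu≤0) = ⊥-elim (ℕ.<⇒≱ 1≤ωu ωu≤0)
      inside-φ (suc m) u (1≤ωu , ωu≤) with ℕ.m≤n⇒m<n∨m≡n ωu≤
      ... | inj₁ ωu<  = trans (add-0 m u (ℕ.<⇒≢ ωu<)) (inside-φ m u (1≤ωu , ℕ.s≤s⁻¹ ωu<))
      ... | inj₂ ωu≡ = trans
        (+-cong (outside-0 m u λ (_ , ωu≤m) → ℕ.<⇒≱ (ℕ.≤-reflexive (≡.sym ωu≡)) ωu≤m)
                (trans (*-congˡ (e-value (suc m) u ωu≡)) (*-identityʳ _)))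
        (trans (+-identityˡ _) (reflexive (≡.cong φ (≡.sym ωu≡))))
      partial≈f : ∀ u → Dec (Between t u) → partial t u ≈ f u
      partial≈f u (yes inside) = trans (inside-φ t u inside) (sym (f≈ u))
      partial≈f u (no outside) = trans (outside-0 t u outside) (sym (supported u outside))

  radial-weightSum : ∀ {f : V n} → Radial f → (∀ k → weightSum k (f ^) ≈ 0#) → f ≈ᴹ 0ᴹ
  radial-weightSum {f} f-radial sums≈0 = ^-injective f 0ᴹ λ u → begin
    (f ^) u      ≈⟨ f^≈ u ⟩
    ψ (ω u)      ≈⟨ *-≈0 (levelSize≉0 (ω≤n u)) (ψ≈0 (ω u)) ⟩
    0#           ≈⟨ ^-0 u ⟨
    (0ᴹ ^) u     ∎
    where
    ψ : ℕ → Carrier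
    ψ = proj₁ (^-radial f-radial)
    f^≈ : ∀ u → (f ^) u ≈ ψ (ω u)
    f^≈ = proj₂ (^-radial f-radial)
    ψ≈0 : ∀ k → levelSize n k * ψ k ≈ 0#
    ψ≈0 k = begin
      levelSize n k * ψ k                  ≈⟨ ∑ᵥ-*ʳ {n} (e k) (ψ k) ⟨
      ∑ᵥ {n} (λ u → e k u * ψ k)           ≈⟨ ∑ᵥ-cong {n} (λ u → trans (*-congˡ (f^≈ u)) (e-weighted k u ψ)) ⟨
      weightSum k (f ^)                    ≈⟨ sums≈0 k ⟩
      0#                                   ∎

  ∑V̂̂-weightSum : ∀ {f} → f ∈ ∑V̂̂ n → ∀ k → weightSum k (f ^) ≈ 0#
  ∑V̂̂-weightSum f∈ k = span-kernel (^-weightSum-linear k)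
    (λ (j , _ , _ , f∈j) → differences-weightSum {n} {j} f∈j k) f∈

  module EigenLine
    (x : Carrier) (t : ℕ) (t≤n : t ℕ.≤ n) (root : D x t 1 ≈ 0#)
    {G : Pred (Vertex n) 0ℓ} (G? : ∀ u → Dec (G u))
    (G⇒between : ∀ {u} → G u → Between t u) (between⇒G : ∀ {u} → Between t u → G u)
    (S : Subspace n)
    (S⇒ : ∀ {f} → f ∈ S → Radial f × Supported t f)
    (⇒S : ∀ {f} → Radial f → Supported t f → f ∈ S)
    where

    private
      W : Subspace n
      W = S ∩ Eigenspace G? x

      a : ℕ → Carrier
      a = solution x t

      F : Carrier
      F = factorial t

      line : V n
      line = a ∘ ω

      outside-G : ∀ {f} → Supported t f → ∀ u → ¬ G u → f u ≈ 0#
      outside-G supported u ¬Gu = supported u (¬Gu ∘ between⇒G)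

      -- At 𝟎 the solution has the value `D x t 1`, which is 0 because x is a root; beyond weight t
      -- it vanishes by construction.
      line-supported : Supported t line
      line-supported u outside with ω u ℕ.≟ 0
      ... | yes ωu≡0 = trans (reflexive (≡.cong a ωu≡0)) (trans (solution-first x t) root)
      ... | no ωu≢0  = solution-beyond x t (ω u) (ℕ.≰⇒> λ ωu≤t → outside (ℕ.n≢0⇒n>0 ωu≢0 , ωu≤t))

      line∈W : line ∈ W
      line∈W = ⇒S (a , λ u → refl) line-supported ,
        inside-eigenspace G? (outside-G line-supported) λ w Gw →
          row⇒eigen {x} {a} w (solution-row x t (ω w) (proj₁ (G⇒between Gw)) (proj₂ (G⇒between Gw)))

      line≉0 : ¬ line ≈ᴹ 0ᴹ
      line≉0 line≈0 = >⇒≉ (factorial-pos t) (trans (sym (solution-last x t))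
        (trans (reflexive (≡.cong a (≡.sym (ω-leadingOnes n t≤n)))) (line≈0 (leadingOnes n t))))

      -- The rows 1, ..., t determine a solution from its value at weight t. There `line` has the
      -- value t!, whence the factor c.
      multiple : ∀ {g} → g ∈ W → ∃ λ c → g ≈ᴹ c *ₗ line
      multiple {g} (g∈S , g-eigen) = c , λ u → pointwise u (ω u ℕ.≤? t)
        where
        g-radial : Radial g
        g-radial = proj₁ (S⇒ g∈S)
        g-supported : Supported t g
        g-supported = proj₂ (S⇒ g∈S)
        ψ : ℕ → Carrier
        ψ = proj₁ g-radial
        g≈ψ : ∀ u → g u ≈ ψ (ω u)
        g≈ψ = proj₂ g-radial
        c : Carrier
        c = ψ t * F ⁻¹
        rows : ∀ k → 1 ℕ.≤ k → k ℕ.≤ t → Row x ψ k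
        rows k 1≤k k≤t = ≡.subst (Row x ψ) ωw≡k (eigen⇒row {x} g-radial w
          (eigenspace-inside G? (outside-G g-supported) g-eigen w
            (between⇒G (≡.subst (1 ℕ.≤_) (≡.sym ωw≡k) 1≤k , ≡.subst (ℕ._≤ t) (≡.sym ωw≡k) k≤t))))
          where
          w : Vertex n
          w = leadingOnes n k
          ωw≡k : ω w ≡ k
          ωw≡k = ω-leadingOnes n (ℕ.≤-trans k≤t t≤n)
        -- For t = n the value of ψ beyond n is arbitrary but has coefficient 0; for t < n there are
        -- vertices of weight t + 1, and g vanishes at them.
        top : ⟦ n ∸ t ⟧ * ψ (suc t) ≈ 0#
        top with ℕ.m≤n⇒m<n∨m≡n t≤n
        ... | inj₂ t≡n = trans (*-congʳ (reflexive (≡.cong ⟦_⟧ (≡.trans (≡.cong (n ∸_) t≡n) (ℕ.n∸n≡0 n))))) (zeroˡ _)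
        ... | inj₁ t<n = trans (*-congˡ (trans (reflexive (≡.cong ψ (≡.sym (ω-leadingOnes n t<n))))
          (trans (sym (g≈ψ (leadingOnes n (suc t)))) (g-supported (leadingOnes n (suc t)) λ (_ , ω≤t) →
            ℕ.<⇒≱ ℕ.≤-refl (≡.subst (ℕ._≤ t) (ω-leadingOnes n t<n) ω≤t))))) (zeroʳ _)
        proportional : ∀ k → k ℕ.≤ t → ψ k ≈ c * a k
        proportional k k≤t = *-cancelˡ (>⇒≉ (rising-pos m k)) (begin
          rising m k * ψ k
            ≈⟨ *-comm _ _ ⟩
          ψ k * rising m k
            ≈⟨ rows⇒continuant {x} {ψ} {t} rows top m k m+k≡t ⟩
          ψ t * D x m (suc k)
            ≈⟨ trans (*-congˡ (⁻¹-inverseʳ (>⇒≉ (factorial-pos t)))) (*-identityʳ _) ⟨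
          (ψ t * D x m (suc k)) * (F * F ⁻¹)
            ≈⟨ solve 4 (λ p d f i → (p :* d) :* (f :* i) := (p :* i) :* (f :* d)) refl _ _ _ _ ⟩
          c * (F * D x m (suc k))
            ≈⟨ *-congˡ (*-congʳ (solution-last x t)) ⟨
          c * (a t * D x m (suc k))
            ≈⟨ *-congˡ (rows⇒continuant {x} {a} {t} (solution-row x t)
                 (trans (*-congˡ (solution-beyond x t (suc t) ℕ.≤-refl)) (zeroʳ _)) m k m+k≡t) ⟨
          c * (a k * rising m k)
            ≈⟨ solve 3 (λ c a r → c :* (a :* r) := r :* (c :* a)) refl _ _ _ ⟩
          rising m k * (c * a k)  ∎)
          where
          m : ℕ
          m = t ∸ k
          m+k≡t : m ℕ.+ k ≡ t
          m+k≡t = ℕ.m∸n+n≡m k≤t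
        pointwise : ∀ u → Dec (ω u ℕ.≤ t) → g u ≈ c * line u
        pointwise u (yes ωu≤t) = trans (g≈ψ u) (proportional (ω u) ωu≤t)
        pointwise u (no ωu≰t)  = trans (g-supported u (ωu≰t ∘ proj₂))
          (sym (trans (*-congˡ (solution-beyond x t (ω u) (ℕ.≰⇒> ωu≰t))) (zeroʳ c)))

    one-dimensional : OneDimensional W
    one-dimensional = line , line∈W , line≉0 , λ g → multiple {g}

    trivial-action : TrivialAction W
    trivial-action σ f (f∈S , _) = radial⇒invariant (proj₁ (S⇒ f∈S)) σ

    trivial-intersection : TrivialIntersection W (∑V̂̂ n)
    trivial-intersection f (f∈S , _) f∈∑ = radial-weightSum (proj₁ (S⇒ f∈S)) (∑V̂̂-weightSum f∈∑)

  Û⇒ : ∀ {f} → f ∈ Û n → Radial f × Supported n f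
  Û⇒ = span⇒radial λ f∈ → f∈

  ⇒Û : ∀ {f} → Radial f → Supported n f → f ∈ Û n
  ⇒Û = radial⇒span λ k 1≤k k≤n → generator (k , 1≤k , k≤n , λ u → refl)

  Û̂⇒ : ∀ {f} → f ∈ Û̂ n → Radial f × Supported n′ f
  Û̂⇒ = span⇒radial λ (k , 1≤k , k<n , f≈) → k , 1≤k , ℕ.s≤s⁻¹ k<n , f≈

  ⇒Û̂ : ∀ {f} → Radial f → Supported n′ f → f ∈ Û̂ n
  ⇒Û̂ = radial⇒span λ k 1≤k k≤n′ → generator (k , 1≤k , s≤s k≤n′ , λ u → refl)

  ≢𝟎⇒between : ∀ {u : Vertex n} → u ≢ 𝟎 → Between n u
  ≢𝟎⇒between {u} u≢𝟎 = ℕ.n≢0⇒n>0 (u≢𝟎 ∘ ω≡0⇒𝟎 u) , ω≤n u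

  between⇒≢𝟎 : ∀ {t u} → Between t u → u ≢ 𝟎
  between⇒≢𝟎 (1≤ωu , _) ≡.refl = ℕ.<⇒≢ 1≤ωu (≡.sym (ω-𝟎 n))

  ≢𝟎≢𝟏⇒between : ∀ {u : Vertex n} → u ≢ 𝟎 × u ≢ 𝟏 → Between n′ u
  ≢𝟎≢𝟏⇒between {u} (u≢𝟎 , u≢𝟏) =
    proj₁ (≢𝟎⇒between u≢𝟎) , ℕ.s≤s⁻¹ (ℕ.≤∧≢⇒< (ω≤n u) (u≢𝟏 ∘ ω≡n⇒𝟏 u))

  between⇒≢𝟎≢𝟏 : ∀ {u} → Between n′ u → u ≢ 𝟎 × u ≢ 𝟏
  between⇒≢𝟎≢𝟏 inside = between⇒≢𝟎 inside , λ { ≡.refl →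
    ℕ.<⇒≱ ℕ.≤-refl (≡.subst (ℕ._≤ n′) (ω-𝟏 n) (proj₂ inside)) }

  module Q̂-line (x : Carrier) (root : D x n 1 ≈ 0#) =
    EigenLine x n ℕ.≤-refl root Q̂? ≢𝟎⇒between between⇒≢𝟎 (Û n) Û⇒ ⇒Û

  module Q̂̂-line (x : Carrier) (root : D x n′ 1 ≈ 0#) =
    EigenLine x n′ (ℕ.n≤1+n n′) root Q̂̂? ≢𝟎≢𝟏⇒between between⇒≢𝟎≢𝟏 (Û̂ n) Û̂⇒ ⇒Û̂

  -- The kernel for even n

  module Kernel (m : ℕ) (n≡2m : n ≡ 2 ℕ.* m) where

    1≤m : 1 ℕ.≤ m
    1≤m = ℕ.n≢0⇒n>0 λ { ≡.refl → ℕ.1+n≢0 n≡2m }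

    m+m≡n : m ℕ.+ m ≡ n
    m+m≡n = ≡.trans (≡.cong (m ℕ.+_) (≡.sym (ℕ.+-identityʳ m))) (≡.sym n≡2m)

    m<n : m ℕ.< n
    m<n = ≡.subst (m ℕ.<_) m+m≡n (ℕ.m<m+n m 1≤m)

    κ≈0 : κ n m ≈ 0#
    κ≈0 = trans (+-congʳ (reflexive (≡.cong ⟦_⟧ n≡2m))) (-‿inverseʳ _)

    κ≉0 : ∀ {k} → k ≢ m → ¬ κ n k ≈ 0#
    κ≉0 {k} k≢m κ≈0 = k≢m (ℕ.*-cancelˡ-≡ k m 2 (≡.trans (≡.sym (⟦⟧-injective (begin
      ⟦ n ⟧                              ≈⟨ solve 2 (λ x y → x := (x :- y) :+ y) refl ⟦ n ⟧ ⟦ 2 ℕ.* k ⟧ ⟩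
      κ n k + ⟦ 2 ℕ.* k ⟧                ≈⟨ +-congʳ κ≈0 ⟩
      0# + ⟦ 2 ℕ.* k ⟧                   ≈⟨ +-identityˡ _ ⟩
      ⟦ 2 ℕ.* k ⟧                        ∎))) n≡2m))

    private
      W : Subspace n
      W = V̂̂ ∩ Eigenspace Q̂̂? 0#

      differences⊆W : V̂̂[ n -2* m ] ⊆ W
      differences⊆W {f} f∈ = (differences-𝟎 {n} {m} f∈ , differences-𝟏 {n} {m} f∈) ,
        λ w → trans (differences⊆Q̂̂-eigenspace n m f∈ w) (*-congʳ κ≈0)

      Û̂⊆W : Û̂ n ∩ Eigenspace Q̂̂? 0# ⊆ W
      Û̂⊆W (f∈Û̂ , eigen) =
        (proj₂ (Û̂⇒ f∈Û̂) 𝟎 (λ inside → proj₁ (between⇒≢𝟎≢𝟏 inside) ≡.refl) ,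
         proj₂ (Û̂⇒ f∈Û̂) 𝟏 (λ inside → proj₂ (between⇒≢𝟎≢𝟏 {𝟏} inside) ≡.refl)) , eigen

      intersection : TrivialIntersection V̂̂[ n -2* m ] (Û̂ n ∩ Eigenspace Q̂̂? 0#)
      intersection f f∈ (f∈Û̂ , _) = radial-weightSum (proj₁ (Û̂⇒ f∈Û̂)) (differences-weightSum {n} {m} f∈)

      -- `N f` is concentrated at the poles, so κ times the transform of f is radial. At the weights
      -- other than m one divides by κ. At weight m, where κ = 0, the transform is unconstrained,
      -- and subtracting the projection replaces it by its mean there.
      module Decomposition (f : V n) (f∈V̂̂ : f ∈ V̂̂ {n}) (f-eigen : f ∈ Eigenspace Q̂̂? 0#) where
        open Projection {n} {m} (ℕ.<⇒≤ m<n) (f ^) using (mean; projection; projection∈; projection^) public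

        remainder : V n
        remainder = f +ᴹ -ᴹ projection

        Nf≈0 : ∀ v → v ≢ 𝟎 → v ≢ 𝟏 → N f v ≈ 0#
        Nf≈0 v v≢𝟎 v≢𝟏 = trans
          (eigenspace-inside Q̂̂? (supported-Q̂̂ (proj₁ f∈V̂̂) (proj₂ f∈V̂̂)) f-eigen v (v≢𝟎 , v≢𝟏)) (zeroˡ _)

        residue : ℕ → Carrier
        residue k = N f 𝟎 + N f 𝟏 * ε k

        κf^ : ∀ u → κ n (ω u) * (f ^) u ≈ residue (ω u)
        κf^ u = trans (sym (^-N f u)) (^-poles (N f) Nf≈0 u)

        ψ : (k : ℕ) → Dec (k ≡ m) → Carrier
        ψ k (yes _) = mean
        ψ k (no _)  = (κ n k) ⁻¹ * residue k

        remainder^ : ∀ u → (remainder ^) u ≈ (f ^) u - e m u * ((f ^) u - mean)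
        remainder^ u = trans (^-+ f (-ᴹ projection) u)
          (+-congˡ (trans (^-neg projection u) (-‿cong (projection^ u))))

        remainder^≈ψ : ∀ u (d : Dec (ω u ≡ m)) → (remainder ^) u ≈ ψ (ω u) d
        remainder^≈ψ u (yes ωu≡m) = trans (remainder^ u) (trans
          (+-congˡ (-‿cong (*-congʳ (e-value m u ωu≡m))))
          (solve 2 (λ y c → y :- :1 :* (y :- c) := c) refl ((f ^) u) mean))
        remainder^≈ψ u (no ωu≢m) = trans (remainder^ u) (trans
          (+-congˡ (-‿cong (*-congʳ (e-elsewhere m u ωu≢m))))
          (trans (solve 2 (λ y c → y :- :0 :* (y :- c) := y) refl ((f ^) u) mean)
          (*-cancelˡ κ≉ (begin
            κ n (ω u) * (f ^) u
              ≈⟨ κf^ u ⟩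
            residue (ω u)
              ≈⟨ *-identityˡ _ ⟨
            1# * residue (ω u)
              ≈⟨ *-congʳ (⁻¹-inverseʳ κ≉) ⟨
            (κ n (ω u) * (κ n (ω u)) ⁻¹) * residue (ω u)
              ≈⟨ *-assoc _ _ _ ⟩
            κ n (ω u) * ((κ n (ω u)) ⁻¹ * residue (ω u))  ∎))))
          where
          κ≉ : ¬ κ n (ω u) ≈ 0#
          κ≉ = κ≉0 ωu≢m

        remainder-radial : Radial remainder
        remainder-radial = ^-radial⁻¹ remainder
          ((λ k → ψ k (k ℕ.≟ m)) , λ u → remainder^≈ψ u (ω u ℕ.≟ m))

        remainder-outside : ∀ u → ¬ (u ≢ 𝟎 × u ≢ 𝟏) → remainder u ≈ 0#
        remainder-outside = supported-Q̂̂
          (trans (+-cong (proj₁ f∈V̂̂) (-‿cong (differences-𝟎 {n} {m} projection∈))) (-‿inverseʳ 0#))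
          (trans (+-cong (proj₂ f∈V̂̂) (-‿cong (differences-𝟏 {n} {m} projection∈))) (-‿inverseʳ 0#))

        remainder∈ : remainder ∈ Û̂ n ∩ Eigenspace Q̂̂? 0#
        remainder∈ =
          ⇒Û̂ remainder-radial (λ u outside → remainder-outside u (outside ∘ ≢𝟎≢𝟏⇒between)) ,
          inside-eigenspace Q̂̂? remainder-outside λ w (w≢𝟎 , w≢𝟏) → begin
            N remainder w
              ≈⟨ IsLinear.difference-homo (N-linear w) f projection ⟩
            N f w - N projection w
              ≈⟨ +-cong (Nf≈0 w w≢𝟎 w≢𝟏) (-‿cong (trans (differences-eigen {n} {m} projection∈ w) (*-congʳ κ≈0))) ⟩
            0# - 0# * projection w
              ≈⟨ solve 2 (λ p r → :0 :- :0 :* p := :0 :* r) refl (projection w) (remainder w) ⟩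
            0# * remainder w  ∎

        sum : f ≈ᴹ projection +ᴹ remainder
        sum u = solve 2 (λ x y → x := y :+ (x :- y)) refl (f u) (projection u)

    direct-sum : IsDirectSum W V̂̂[ n -2* m ] (Û̂ n ∩ Eigenspace Q̂̂? 0#)
    direct-sum = differences⊆W , Û̂⊆W , intersection , λ f (f∈V̂̂ , eigen) →
      let open Decomposition f f∈V̂̂ eigen in
      projection , remainder , projection∈ , remainder∈ , sum

open import Data.Nat.Base using (_≤_; _<_; _*_)

theorem4 :
  ∀ {ℓ} (ℝ : RealNumbers ℓ) (n : ℕ) .{{_ : NonZero n}} →
  let open Spectra ℝ
      K[x] = charPoly (K n)
      L[x] = charPoly (L n)
      M[x] = charPoly (M n)
  in
  -- (i)
  ( (AllRootsSimple K[x] × AllRootsReal K[x] × RootsSymmetric K[x])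
  × (AllRootsSimple L[x] × AllRootsReal L[x] × RootsSymmetric L[x])
  × (AllRootsSimple M[x] × AllRootsReal M[x] × RootsSymmetric M[x]) ) ×
  -- (ii)
  ( (∀ μ → IsRoot K[x] μ ⇔ IsEigenvalue (Q? {n}) μ)
  × (∀ μ → IsEigenvalue (Q? {n}) μ ⇔ (∃ λ k → k ≤ n × μ ≈ κ n k)) ) ×
  -- (iii)
  IsRoot L[x] StrictlyInterlaces IsRoot K[x] ×
  -- (iv)
  IsRoot M[x] StrictlyInterlaces IsRoot L[x] ×
  -- (v)
  ( (IsRoot M[x] ∩ Positive) StrictlyInterlaces (IsRoot K[x] ∩ Positive)
  × (IsRoot M[x] ∩ Negative) StrictlyInterlaces (IsRoot K[x] ∩ Negative) ) ×
  -- (vi)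
  (∀ k → 1 ≤ k → k < n →
      V̂̂[ n -2* k ] ⊆ V̂̂
    × V̂̂ {n} ⊆ V̂
    × V̂̂[ n -2* k ] ⊆ Eigenspace Q̂? (κ n k)
    × V̂̂[ n -2* k ] ⊆ Eigenspace Q̂̂? (κ n k)
    × V̂̂Rep n k ⊕ trivial n ≅ kSubsetRep n k) ×
  -- (vii)
  ( (∀ μ → IsRoot L[x] μ →
      let W = Û n ∩ Eigenspace Q̂? μ in
      OneDimensional W × TrivialAction W × TrivialIntersection W (∑V̂̂ n))
  × (∀ μ → IsRoot M[x] μ →
      let W = Û̂ n ∩ Eigenspace Q̂̂? μ in
      OneDimensional W × TrivialAction W × TrivialIntersection W (∑V̂̂ n))
  × (∀ m → n ≡ 2 * m →
      IsRoot M[x] 0#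
    × κ n m ≈ 0#
    × IsDirectSum (V̂̂ ∩ Eigenspace Q̂̂? 0#) V̂̂[ n -2* m ] (Û̂ n ∩ Eigenspace Q̂̂? 0#)) )
theorem4 ℝ (suc n′) =
  ((K-simple , K-real , K-symmetric) , (L-simple , L-real , L-symmetric) , (M-simple , M-real , M-symmetric)) ,
  -- Roots and eigenvalues are both compared with the list of the `κ n k`.
  ( (λ μ → mk⇔ (λ root → κ⇒eigenvalue μ (K-root⇒κ root)) (λ eigen → κ⇒K-root (eigenvalue⇒κ μ eigen)))
  , (λ μ → mk⇔ (eigenvalue⇒κ μ) (κ⇒eigenvalue μ)) ) ,
  L-interlacing , M-interlacing , (positive , negative) ,
  (λ k 1≤k k<n →
    (λ f∈ → differences-𝟎 {n} {k} f∈ , differences-𝟏 {n} {k} f∈) ,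
    proj₁ ,
    differences⊆Q̂-eigenspace n k ,
    differences⊆Q̂̂-eigenspace n k ,
    KSubsetIsomorphism.isomorphism (ℕ.<⇒≤ k<n)) ,
  (λ μ root → let open Q̂-line μ (trans (sym (eval-L μ)) root) in
    one-dimensional , trivial-action , trivial-intersection) ,
  (λ μ root → let open Q̂̂-line μ (trans (sym (eval-M μ)) root) in
    one-dimensional , trivial-action , trivial-intersection) ,
  (λ m n≡2m → let open Kernel m n≡2m in M-root-zero {m} m+m≡n , κ≈0 , direct-sum)
  where
  open RealNumbers ℝ using (sym; trans)
  open Spectra ℝ
  open HypercubeFourier ℝ using (eigenvalue⇒κ; κ⇒eigenvalue)
  open SpanOfDifferences ℝ
  open Spectrum ℝ n′
  open RadialEigenspaces ℝ n′
  open RootLocation.CharacteristicRoots ℝ n′ (charPoly (K n)) (charPoly (L n)) (charPoly (M n))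
    eval-K eval-L eval-M K-monic L-monic M-monic
  K-simple : AllRootsSimple (charPoly (K n))
  K-simple = proj₁ (proj₁ interlacings)
  K-real : AllRootsReal (charPoly (K n))
  K-real = proj₂ (proj₁ interlacings)
  L-simple : AllRootsSimple (charPoly (L n))
  L-simple = proj₁ (proj₁ (proj₂ interlacings))
  L-real : AllRootsReal (charPoly (L n))
  L-real = proj₂ (proj₁ (proj₂ interlacings))
  M-simple : AllRootsSimple (charPoly (M n))
  M-simple = proj₁ (proj₁ (proj₂ (proj₂ interlacings)))
  M-real : AllRootsReal (charPoly (M n))
  M-real = proj₂ (proj₁ (proj₂ (proj₂ interlacings)))
  L-interlacing : IsRoot (charPoly (L n)) StrictlyInterlaces IsRoot (charPoly (K n))
  L-interlacing = proj₁ (proj₂ (proj₂ (proj₂ interlacings)))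
  M-interlacing : IsRoot (charPoly (M n)) StrictlyInterlaces IsRoot (charPoly (L n))
  M-interlacing = proj₁ (proj₂ (proj₂ (proj₂ (proj₂ interlacings))))
  positive : (IsRoot (charPoly (M n)) ∩ Positive) StrictlyInterlaces (IsRoot (charPoly (K n)) ∩ Positive)
  positive = proj₁ (proj₂ (proj₂ (proj₂ (proj₂ (proj₂ interlacings)))))
  negative : (IsRoot (charPoly (M n)) ∩ Negative) StrictlyInterlaces (IsRoot (charPoly (K n)) ∩ Negative)
  negative = proj₂ (proj₂ (proj₂ (proj₂ (proj₂ (proj₂ interlacings)))))
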